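{- Let $\mathcal{B}\subseteq\mathsf{SVW}_{n,m}$ be a full subcrystal. Then $S\mapsto(P_{\mathsf{hecke}}(S),Q_{\mathsf{hecke}}(S))$ is a bijection from $\mathcal{B}$ to the set of pairs of tableaux $(P,Q)$ of the same shape such that (a) $P$ is an increasing tableau and $P=\mathsf{tab}(S)$ for some highest weight element $S\in\mathcal{B}$, and (b) $Q$ is a semistandard set-valued tableau with all entries contained in $[n]$.
   Context: $[n]=\{1,\dots,n\}$, $\mathbf{e}_k$ standard basis of $\mathbb{Z}^n$. For $T\subseteq[n]$ (possibly empty), $\mathrm{wt}(T)=\sum_{j\in T}\mathbf{e}_j$, and for $i\in[n-1]$: $e_i(T)=T\cup\{i\}$ if $T\cap\{i,i+1\}=\{i+1\}$, $T\setminus\{i+1\}$ if $T\cap\{i,i+1\}=\{i,i+1\}$, else $0$; $f_i(T)=T\cup\{i+1\}$ if $T\cap\{i,i+1\}=\{i\}$, $T\setminus\{i\}$ if $T\cap\{i,i+1\}=\{i,i+1\}$, else $0$. With $\varepsilon_i(b)=\sup\{k:e_i^k(b)\ne0\}$, $\varphi_i(b)=\sup\{k:f_i^k(b)\ne0\}$, tensor products have additive weights, $e_i(b\otimes c)=b\otimes e_i(c)$ if $\varepsilon_i(b)\le\varphi_i(c)$ else $e_i(b)\otimes c$, $f_i(b\otimes c)=b\otimes f_i(c)$ if $\varepsilon_i(b)<\varphi_i(c)$ else $f_i(b)\otimes c$, $b\otimes0=0\otimes c=0$. $\mathsf{SVW}_{n,m}$ is the set of $m$-tuples $S=(S_1,\dots,S_m)$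 of subsets of $[n]$, a crystal via $S\leftrightarrow S_1\otimes\cdots\otimes S_m$. A full subcrystal is the vertex set of a weakly connected component of the graph with edges $S\to f_i(S)\neq 0$; highest weight means $e_i(S)=0$ for all $i$. $\mathsf{tab}(S)$ is the left-justified tableau (matrix coordinates) whose row $i$ lists $m+1-j$, over $j$ with $i\in S_j$, increasingly. An increasing tableau has Young-diagram shape with strictly increasing rows and columns. A semistandard set-valued tableau of a Young-diagram shape fills each box with a nonempty set of positive integers such that every choice of one element per box gives weakly increasing rows and strictly increasing columns. Hecke insertion of $x$ into an increasing tableau $T$: process columns from the first. In a column, let $y$ be the smallest entry with $x<y$. If no such $y$ exists: if appending $x$ at the bottom of the column gives an increasing tableau, do so and say the insertion ends at this new box; otherwise leave the tableau unchanged and, if the last box of the column is in row $r$ and the last box of row $r$ is in column $c$, say the insertion ends at $(r,c)$; stop. If $y$ exists, replace $y$ by $x$ if the result is increasing (else leave unchanged), and insert the bumped $y$ into the next column in the same way. For $i\in[n]$ let $j_1<\dots<j_k$ be the indices $j$ with $i\in S_j$, $A_i=(m+1-j_1)\cdots(m+1-j_k)$ and $I_i=i\,i\cdots i$ ($k$ copies); $A(S)=A_1\cdots A_n=A(S)_1\cdots A(S)_L$ and $I(S)=I_1\cdots I_n=I(S)_1\cdots I(S)_L$. Set $P_0=Q_0=\emptyset$; $P_k$ is the Hecke insertion of $A(S)_k$ into $P_{k-1}$, and $Q_k$ is the set-valued tableau of the same shape as $P_k$ obtained from $Q_{k-1}$ by adding $I(S)_k$ to the (possibly new) box where this insertion ends.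 $P_{\mathsf{hecke}}(S)=P_L$, $Q_{\mathsf{hecke}}(S)=Q_L$. -}

module Defs where

open import Data.Nat using (ℕ; zero; suc; _+_; _*_; _∸_; _≤_; _<_; _<ᵇ_; _≤ᵇ_; _≡ᵇ_)
open import Data.Bool using (Bool; true; false; if_then_else_; _∧_; not; T)
open import Data.List using (List; []; _∷_; _++_; length; map; reverse; concat; concatMap; foldl; upTo)
open import Data.Vec using (Vec; []; _∷_)
open import Data.Maybe using (Maybe; just; nothing)
import Data.Maybe as Maybe
open import Data.Product using (Σ; _×_; _,_)
open import Data.List.Membership.Propositional using (_∈_)
open import Data.List.Relation.Binary.Pointwise using (Pointwise)
open import Relation.Binary.PropositionalEquality using (_≡_)
open import Relation.Binary.Construct.Closure.Equivalence using (EqClosure)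

-- Subsets of [n] = {1,…,n}: a characteristic vector, position k (0-based)
-- standing for the element k+1.

Subset : ℕ → Set
Subset n = Vec Bool n

-- membership of the (1-based) element j; elements outside [n] are absent
mem : ∀ {n} → ℕ → Subset n → Bool
mem zero _ = false
mem (suc _) [] = false
mem (suc zero) (b ∷ _) = b
mem (suc (suc k)) (_ ∷ bs) = mem (suc k) bs

setm : ∀ {n} → ℕ → Bool → Subset n → Subset n
setm zero _ s = s
setm (suc _) _ [] = []
setm (suc zero) v (_ ∷ bs) = v ∷ bs
setm (suc (suc k)) v (b ∷ bs) = b ∷ setm (suc k) v bs

-- crystal operators on a single subset T (0 of the crystal = nothing)
e₁ : ∀ {n} → ℕ → Subset n → Maybe (Subset n)
e₁ i t = if mem (suc i) t
         then (if mem i t then just (setm (suc i) false t)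
                          else just (setm i true t))
         else nothing

f₁ : ∀ {n} → ℕ → Subset n → Maybe (Subset n)
f₁ i t = if mem i t
         then (if mem (suc i) t then just (setm i false t)
                                else just (setm (suc i) true t))
         else nothing

-- sup{k : g^k(a) ≠ 0}, computed by iterating g at most `fuel` times.
-- (Used only with fuel larger than the true supremum.)
iterCount : ∀ {A : Set} → ℕ → (A → Maybe A) → A → ℕ
iterCount zero g a = 0
iterCount (suc k) g a with g a
... | nothing = 0
... | just a′ = suc (iterCount k g a′)

-- ε_i, φ_i of a single subset (they are at most 2)
ε₁ : ∀ {n} → ℕ → Subset n → ℕ
ε₁ i t = iterCount 3 (e₁ i) t

-- SVW_{n,m}: m-tuples of subsets, S ↔ S₁ ⊗ (S₂ ⊗ (⋯ ⊗ Sₘ))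

SVW : ℕ → ℕ → Set
SVW n m = Vec (Subset n) m

record Ops (n m : ℕ) : Set where
  field
    eo : ℕ → SVW n m → Maybe (SVW n m)
    fo : ℕ → SVW n m → Maybe (SVW n m)

-- ε_i, φ_i of an m-fold tensor are ≤ 2m, so fuel 2m+1 computes the sup
ops : ∀ n m → Ops n m
ops n zero = record { eo = λ _ _ → nothing ; fo = λ _ _ → nothing }
ops n (suc m) = record { eo = E ; fo = F }
  where
  open Ops (ops n m)
  φT : ℕ → SVW n m → ℕ
  φT i c = iterCount (suc (2 * m)) (fo i) c
  E : ℕ → SVW n (suc m) → Maybe (SVW n (suc m))
  E i (b ∷ c) = if ε₁ i b ≤ᵇ φT i c
                then Maybe.map (b ∷_) (eo i c)
                else Maybe.map (_∷ c) (e₁ i b)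
  F : ℕ → SVW n (suc m) → Maybe (SVW n (suc m))
  F i (b ∷ c) = if ε₁ i b <ᵇ φT i c
                then Maybe.map (b ∷_) (fo i c)
                else Maybe.map (_∷ c) (f₁ i b)

eSVW : ∀ {n m} → ℕ → SVW n m → Maybe (SVW n m)
eSVW {n} {m} = Ops.eo (ops n m)

fSVW : ∀ {n m} → ℕ → SVW n m → Maybe (SVW n m)
fSVW {n} {m} = Ops.fo (ops n m)

Edge : ∀ {n m} → SVW n m → SVW n m → Set
Edge {n} S S′ = Σ ℕ λ i → (1 ≤ i) × (i < n) × (fSVW i S ≡ just S′)

-- S lies in the full subcrystal (weakly connected component) containing S₀
InComponent : ∀ {n m} → SVW n m → SVW n m → Set
InComponent S₀ S = EqClosure Edge S₀ S

HighestWeight : ∀ {n m} → SVW n m → Set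
HighestWeight {n} S = ∀ i → 1 ≤ i → i < n → eSVW i S ≡ nothing

-- Tableaux: lists of rows (matrix coordinates), row 0 on top.

Tab : Set → Set
Tab A = List (List A)

nth : ∀ {A : Set} → List A → ℕ → Maybe A
nth [] _ = nothing
nth (x ∷ _) zero = just x
nth (_ ∷ xs) (suc k) = nth xs k

at : ∀ {A : Set} → Tab A → ℕ → ℕ → Maybe A
at t r c = Maybe._>>=_ (nth t r) (λ row → nth row c)

shape : ∀ {A : Set} → Tab A → List ℕ
shape = map length

youngB : List ℕ → Bool
youngB [] = true
youngB (a ∷ []) = 1 ≤ᵇ a
youngB (a ∷ b ∷ l) = (1 ≤ᵇ a) ∧ (b ≤ᵇ a) ∧ youngB (b ∷ l)

strictB : List ℕ → Bool
strictB [] = true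
strictB (_ ∷ []) = true
strictB (a ∷ b ∷ l) = (a <ᵇ b) ∧ strictB (b ∷ l)

colsB : List ℕ → List ℕ → Bool
colsB (a ∷ as) (b ∷ bs) = (a <ᵇ b) ∧ colsB as bs
colsB _ _ = true

colsAllB : Tab ℕ → Bool
colsAllB [] = true
colsAllB (_ ∷ []) = true
colsAllB (r ∷ r′ ∷ rs) = colsB r r′ ∧ colsAllB (r′ ∷ rs)

rowsAllB : Tab ℕ → Bool
rowsAllB [] = true
rowsAllB (r ∷ rs) = strictB r ∧ rowsAllB rs

isIncB : Tab ℕ → Bool
isIncB t = youngB (shape t) ∧ rowsAllB t ∧ colsAllB t

IsIncreasing : Tab ℕ → Set
IsIncreasing t = T (isIncB t)

-- set-valued tableaux: each box a finite set of positive integers,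
-- encoded canonically as a strictly increasing list
SVTab : Set
SVTab = Tab (List ℕ)

RowsWeak : Tab ℕ → Set
RowsWeak t = ∀ r c x y → at t r c ≡ just x → at t r (suc c) ≡ just y → x ≤ y

ColsStrict : Tab ℕ → Set
ColsStrict t = ∀ r c x y → at t r c ≡ just x → at t (suc r) c ≡ just y → x < y

Choice : Tab ℕ → SVTab → Set
Choice t q = Pointwise (Pointwise _∈_) t q

IsSemistandardSetValued : SVTab → Set
IsSemistandardSetValued q =
  T (youngB (shape q)) ×
  (∀ r c B → at q r c ≡ just B → T (strictB B) × (1 ≤ length B) × (∀ x → x ∈ B → 1 ≤ x)) ×
  (∀ t → Choice t q → RowsWeak t × ColsStrict t)

EntriesIn : ℕ → SVTab → Set
EntriesIn n q = ∀ r c B x → at q r c ≡ just B → x ∈ B → (1 ≤ x) × (x ≤ n)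

lettersFrom : ∀ {n k} → ℕ → ℕ → ℕ → Vec (Subset n) k → List ℕ
lettersFrom m i j [] = []
lettersFrom m i j (t ∷ ts) =
  if mem i t then (suc m ∸ j) ∷ lettersFrom m i (suc j) ts
             else lettersFrom m i (suc j) ts

Aᵢ : ∀ {n m} → ℕ → SVW n m → List ℕ
Aᵢ {m = m} i S = lettersFrom m i 1 S

rowsIdx : ℕ → List ℕ
rowsIdx n = map suc (upTo n)

dropEmpty : Tab ℕ → Tab ℕ
dropEmpty ([] ∷ rs) = dropEmpty rs
dropEmpty rs = rs

-- tab(S): row i lists the m+1-j (i ∈ S_j) increasingly;
-- trailing empty rows are not part of the diagram
tab : ∀ {n m} → SVW n m → Tab ℕ
tab {n} S = reverse (dropEmpty (reverse (map (λ i → reverse (Aᵢ i S)) (rowsIdx n))))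

biword : ∀ {n m} → SVW n m → List (ℕ × ℕ)
biword {n} S = concatMap (λ i → map (λ a → (a , i)) (Aᵢ i S)) (rowsIdx n)

modify : ∀ {A : Set} → List A → ℕ → (A → A) → List A
modify [] _ _ = []
modify (x ∷ xs) zero g = g x ∷ xs
modify (x ∷ xs) (suc k) g = x ∷ modify xs k g

colH : ∀ {A : Set} → Tab A → ℕ → ℕ
colH [] c = 0
colH (row ∷ rs) c = if c <ᵇ length row then suc (colH rs c) else 0

rowLen : ∀ {A : Set} → Tab A → ℕ → ℕ
rowLen t r = Maybe.maybe length 0 (nth t r)

findBump : Tab ℕ → ℕ → ℕ → Maybe (ℕ × ℕ)
findBump [] c x = nothing
findBump (row ∷ rs) c x with nth row c
... | nothing = nothing
... | just y = if x <ᵇ y then just (0 , y)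
               else Maybe.map (λ { (r , z) → (suc r , z) }) (findBump rs c x)

appendBox : ∀ {A : Set} → Tab A → ℕ → ℕ → A → Maybe (Tab A)
appendBox [] zero zero v = just ((v ∷ []) ∷ [])
appendBox [] _ _ _ = nothing
appendBox (row ∷ rs) zero c v =
  if length row ≡ᵇ c then just ((row ++ (v ∷ [])) ∷ rs) else nothing
appendBox (row ∷ rs) (suc r) c v = Maybe.map (row ∷_) (appendBox rs r c v)

hinsEnd : Tab ℕ → ℕ → ℕ → Tab ℕ × (ℕ × ℕ)
hinsEnd t c x = try (appendBox t h c x)
  where
  h = colH t c
  old : Tab ℕ × (ℕ × ℕ)
  old = t , (h ∸ 1 , rowLen t (h ∸ 1) ∸ 1)
  try : Maybe (Tab ℕ) → Tab ℕ × (ℕ × ℕ)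
  try nothing = old
  try (just t′) = if isIncB t′ then (t′ , (h , c)) else old

hins : ℕ → ℕ → ℕ → Tab ℕ → Tab ℕ × (ℕ × ℕ)
hins zero c x t = t , (0 , 0)
hins (suc k) c x t with findBump t c x
... | nothing = hinsEnd t c x
... | just (r , y) = hins k (suc c) y (if isIncB t′ then t′ else t)
  where t′ = modify t r (λ row → modify row c (λ _ → x))

-- fuel: at most (width + 1) columns are visited
heckeInsert : ℕ → Tab ℕ → Tab ℕ × (ℕ × ℕ)
heckeInsert x t = hins (suc (suc (length (concat t)))) 0 x t

insSet : ℕ → List ℕ → List ℕ
insSet x [] = x ∷ []
insSet x (y ∷ ys) = if x <ᵇ y then x ∷ y ∷ ys
                    else (if x ≡ᵇ y then y ∷ ys else y ∷ insSet x ys)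

addQ : SVTab → ℕ → ℕ → ℕ → SVTab
addQ q r c i with at q r c
... | just _ = modify q r (λ row → modify row c (insSet i))
... | nothing = Maybe.fromMaybe q (appendBox q r c (i ∷ []))

heckeStep : Tab ℕ × SVTab → ℕ × ℕ → Tab ℕ × SVTab
heckeStep (p , q) (a , i) with heckeInsert a p
... | (p′ , (r , c)) = p′ , addQ q r c i

hecke : ∀ {n m} → SVW n m → Tab ℕ × SVTab
hecke S = foldl heckeStep ([] , []) (biword S)

GoodPair : ∀ {n m} → SVW n m → Tab ℕ × SVTab → Set
GoodPair {n} {m} S₀ (p , q) =
  (shape p ≡ shape q) ×
  (IsIncreasing p × (Σ (SVW n m) λ S → InComponent S₀ S × HighestWeight S × (p ≡ tab S))) ×
  (IsSemistandardSetValued q × EntriesIn n q)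

{-# OPTIONS --safe #-}

-- For P = P_hecke(S) let S_P be the element whose rows are the rows of P. Its columns
-- increase strictly, which is the ballot condition, so S_P is a highest weight element with
-- tab(S_P) = P. Moreover S_P lies in the component of S: while a letter travels along its
-- bumping path, the rows of the current tableau together with the travelling letter and the
-- letters not yet inserted form an element of SVW, and each step of the path changes this
-- element by at most two crystal operators.
--
-- Hecke insertion is a bijection onto all pairs (P , Q) of the same shape: bumping paths can
-- be retraced from the box where they end, and of two successive letters the second one is
-- smaller exactly when its path ends strictly further right, which matches decreasing words
-- with the horizontal strips of equal letters in Q. If S has image (tab(S′) , Q), then S is
-- connected to S_P = S′, so S lies in the component of S′.

module Submission where

open import Defs
open import Data.Nat using (ℕ; zero; suc; _+_; _*_; _∸_; _≤_; _<_; _≡ᵇ_; _<ᵇ_; _≤ᵇ_; z≤n; s≤s; s≤s⁻¹; _≟_; _<?_)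
open import Data.Nat.Properties
open import Data.Bool using (Bool; true; false; if_then_else_; T; _∧_; _∨_)
open import Data.Bool.Properties using (∨-identityʳ)
open import Data.List using (List; []; _∷_; _++_; _∷ʳ_; length; map; concat; concatMap; foldl; reverse; upTo; applyUpTo; replicate)
open import Data.List.Properties
  using (length-++; foldl-∷ʳ; ∷ʳ-injectiveˡ; map-++; ++-identityʳ; ++-assoc; concatMap-++; upTo-∷ʳ; length-upTo;
         length-map; unfold-reverse; reverse-++; reverse-involutive; length-reverse; ∷ʳ-++)
open import Data.List.Membership.Propositional using (_∈_)
open import Data.List.Membership.Propositional.Properties using (∈-++⁺ˡ; ∈-++⁺ʳ; ∈-++⁻; ∈-map⁺; ∈-map⁻)
open import Data.List.Membership.DecPropositional _≟_ using (_∈?_)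
open import Data.List.Relation.Binary.Pointwise using (Pointwise; []; _∷_)
open import Data.List.Relation.Unary.Any using (here; there)
open import Data.Maybe using (Maybe; just; nothing)
import Data.Maybe as Maybe
open import Data.Maybe.Properties using (just-injective)
open import Data.Product using (Σ; ∃; _×_; _,_; proj₁; proj₂)
open import Data.Product.Properties using (,-injective)
open import Data.Sum using (_⊎_; inj₁; inj₂)
open import Data.Unit using (⊤; tt)
open import Data.Empty using (⊥; ⊥-elim)
open import Data.Vec using ([]; _∷_)
open import Relation.Nullary using (¬_; Dec; yes; no)
open import Relation.Binary.Definitions using (tri<; tri≈; tri>)
open import Relation.Binary.PropositionalEquality
import Relation.Binary.Construct.Closure.Equivalence as Eq

-- Insertion paths

-- The obstacle is the blocked letter of Hecke insertion: it vanishes against its own copy in the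
-- row above, while the entry below that copy both stays and travels on. Forward and reverse paths
-- are therefore relations with two modes, travelling (`N`, `RN`) and blocked (`K`, `RK`), with
-- mirrored steps, so that a path is inverted by accumulating one relation while following the
-- other. In the crystal a value in rows `i` and `i + 1` runs through the string `{i}`, `{i , i+1}`,
-- `{i+1}`, so the counter `φ` of an increasing tableau is twice its ballot excess. A letter moving
-- up a row undoes a whole string, two operators at one tensor factor. A blocked letter makes the
-- counter odd over a stretch of values, and its release in favour of the bumped entry is one
-- operator at each end of the stretch. Unread letters of the lower row leave only an upper bound
-- for the counter of the smaller values; it suffices, since the excess is 0 there. A value in `Q`
-- does not tell whether its insertion created the box; the rest of the box does, being empty
-- exactly for a created one.

Filling : Set
Filling = ℕ → ℕ → ℕ

infix 4 _≈_
_≈_ : ∀ {A : Set} → (ℕ → ℕ → A) → (ℕ → ℕ → A) → Set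
F ≈ G = ∀ r c → F r c ≡ G r c

≈-refl : ∀ {A : Set} {F : ℕ → ℕ → A} → F ≈ F
≈-refl _ _ = refl

≈-sym : ∀ {A : Set} {F G : ℕ → ℕ → A} → F ≈ G → G ≈ F
≈-sym e r c = sym (e r c)

≈-trans : ∀ {A : Set} {F G H : ℕ → ℕ → A} → F ≈ G → G ≈ H → F ≈ H
≈-trans e f r c = trans (e r c) (f r c)

upd : ∀ {A : Set} → (ℕ → ℕ → A) → ℕ → ℕ → A → ℕ → ℕ → A
upd F r c x q k with q ≟ r | k ≟ c
... | yes _ | yes _ = x
... | yes _ | no _ = F q k
... | no _ | _ = F q k

data UpdCase {A : Set} (F : ℕ → ℕ → A) (r c : ℕ) (x : A) (q k : ℕ) : A → Set where
  equal : q ≡ r → k ≡ c → UpdCase F r c x q k x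
  apart : (q ≡ r → k ≡ c → ⊥) → UpdCase F r c x q k (F q k)

updCase : ∀ {A : Set} (F : ℕ → ℕ → A) r c x q k → UpdCase F r c x q k (upd F r c x q k)
updCase F r c x q k with q ≟ r | k ≟ c
... | yes p | yes p′ = equal p p′
... | yes _ | no n = apart (λ _ e → n e)
... | no n | _ = apart (λ e _ → n e)

-- Unlike `UpdCase`, this view gives the value as an equation, so that several updates in one goal
-- can be analysed together.
data UpdView {A : Set} (F : ℕ → ℕ → A) (r c : ℕ) (x : A) (q k : ℕ) : Set where
  hit : q ≡ r → k ≡ c → upd F r c x q k ≡ x → UpdView F r c x q k
  miss : (q ≡ r → k ≡ c → ⊥) → upd F r c x q k ≡ F q k → UpdView F r c x q k

updView : ∀ {A : Set} (F : ℕ → ℕ → A) r c x q k → UpdView F r c x q k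
updView F r c x q k with upd F r c x q k in e | updCase F r c x q k
... | _ | equal p p′ = hit p p′ e
... | _ | apart n = miss n e

upd-hit : ∀ {A : Set} (F : ℕ → ℕ → A) r c x → upd F r c x r c ≡ x
upd-hit F r c x with updView F r c x r c
... | hit _ _ e = e
... | miss n _ = ⊥-elim (n refl refl)

upd-miss : ∀ {A : Set} (F : ℕ → ℕ → A) r c x q k → (q ≡ r → k ≡ c → ⊥) → upd F r c x q k ≡ F q k
upd-miss F r c x q k n with updView F r c x q k
... | hit a b _ = ⊥-elim (n a b)
... | miss _ e = e

upd-cong : ∀ {A : Set} {F G : ℕ → ℕ → A} r c x → F ≈ G → upd F r c x ≈ upd G r c x
upd-cong {F = F} {G} r c x e q k with updView F r c x q k | updView G r c x q k
... | hit _ _ a | hit _ _ b = trans a (sym b)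
... | hit a b _ | miss n _ = ⊥-elim (n a b)
... | miss n _ | hit a b _ = ⊥-elim (n a b)
... | miss _ a | miss _ b = trans a (trans (e q k) (sym b))

upd-undo : ∀ {A : Set} (F : ℕ → ℕ → A) r c x y → F r c ≡ y → upd (upd F r c x) r c y ≈ F
upd-undo F r c x y h q k with updView (upd F r c x) r c y q k
... | hit refl refl a = trans a (sym h)
... | miss n a = trans a (upd-miss F r c x q k n)

record Inc (F : Filling) : Set where
  field
    row : ∀ r c → F r c < F r (suc c)
    col : ∀ r c → F r c < F (suc r) c

open Inc public

Inc-cong : ∀ {F G} → F ≈ G → Inc F → Inc G
Inc-cong e i .row r c = subst₂ _<_ (e r c) (e r (suc c)) (row i r c)
Inc-cong e i .col r c = subst₂ _<_ (e r c) (e (suc r) c) (col i r c)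

row-mono : ∀ {F} → Inc F → ∀ r {c c′} → c ≤ c′ → F r c ≤ F r c′
row-mono {F} i r {c} {c′} le with m≤n⇒m<n∨m≡n le
... | inj₂ refl = ≤-refl
row-mono {F} i r {c} {suc c′} le | inj₁ lt = ≤-trans (row-mono i r (s≤s⁻¹ lt)) (<⇒≤ (row i r c′))

col-mono : ∀ {F} → Inc F → ∀ {r r′} c → r ≤ r′ → F r c ≤ F r′ c
col-mono {F} i {r} {r′} c le with m≤n⇒m<n∨m≡n le
... | inj₂ refl = ≤-refl
col-mono {F} i {r} {suc r′} c le | inj₁ lt = ≤-trans (col-mono i c (s≤s⁻¹ lt)) (<⇒≤ (col i r′ c))

row-reflects : ∀ {F} → Inc F → ∀ r {c c′} → F r c < F r c′ → c < c′
row-reflects i r {c} {c′} lt with c <? c′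
... | yes p = p
... | no p = ⊥-elim (<⇒≱ lt (row-mono i r (≮⇒≥ p)))

col-reflects : ∀ {F} → Inc F → ∀ {r r′} c → F r c < F r′ c → r < r′
col-reflects i {r} {r′} c lt with r <? r′
... | yes p = p
... | no p = ⊥-elim (<⇒≱ lt (col-mono i c (≮⇒≥ p)))

-- Together with `col-index` this bounds the rows and columns of a diagram with entries below `M`,
-- which supplies the fuel for every search through it.
row-index : ∀ {F} → Inc F → ∀ r c → c ≤ F r c
row-index i r zero = z≤n
row-index i r (suc c) = ≤-<-trans (row-index i r c) (row i r c)

col-index : ∀ {F} → Inc F → ∀ r c → r ≤ F r c
col-index i zero c = z≤n
col-index i (suc r) c = ≤-<-trans (col-index i r c) (col i r c)

-- A new box and an already present corner at the same position are retraced differently, so the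
-- position alone does not determine the reverse path.
data End : Set where
  new old : ℕ → ℕ → End

endRow endCol : End → ℕ
endRow (new r _) = r
endRow (old r _) = r
endCol (new _ c) = c
endCol (old _ c) = c

module Paths (M : ℕ) where

  -- Cells outside the diagram carry the values M + (r + c), so that a tableau
  -- with entries below M is strictly increasing on the whole quadrant and
  -- appending a box is the same as bumping such a value.
  Std : Filling → Set
  Std F = ∀ r c → M ≤ F r c → F r c ≡ M + (r + c)

  Std-cong : ∀ {F G} → F ≈ G → Std F → Std G
  Std-cong e s r c le = trans (sym (e r c)) (s r c (subst (M ≤_) (sym (e r c)) le))

  Above : Filling → ℕ → ℕ → ℕ → Set
  Above F zero c x = ⊤
  Above F (suc r) c x = F r c < x

  -- N F r c x: the letter x is about to enter column c, in row r or above.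
  -- K F r c: box (r + 1 , c) could not be overwritten, so its entry moves on to
  -- column c + 1 while also staying where it is.
  mutual
    data N (F : Filling) : ℕ → ℕ → ℕ → Filling → End → Set where
      up : ∀ {r c x F′ e} → x < F r c → N F r c x F′ e → N F (suc r) c x F′ e
      put : ∀ {r c x y F′ e} → Above F r c x → F r c ≡ y → y < M →
            N (upd F r c x) r (suc c) y F′ e → N F r c x F′ e
      putE : ∀ {r c x F′} → Above F r c x → M ≤ F r c → upd F r c x ≈ F′ → N F r c x F′ (new r c)
      blk : ∀ {r c x F′ e} → F r c ≡ x → K F r c F′ e → N F (suc r) c x F′ e

    data K (F : Filling) : ℕ → ℕ → Filling → End → Set where
      -- Column `c` ends in row `r` and nothing can be appended there, so the insertion ends at the
      -- last box `(r , e)` of that row.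
      kend : ∀ {r c e F′} → M ≤ F (suc r) c → c ≤ e → F r e < M → M ≤ F r (suc e) →
             F ≈ F′ → K F r c F′ (old r e)
      kup : ∀ {r c y F′ e} → F (suc r) c ≡ y → y < M → y < F r (suc c) →
            N F r (suc c) y F′ e → K F r c F′ e
      -- The bumped entry arrives in row `r + 1` again, directly to the right of its own copy, so
      -- this box cannot be overwritten either.
      kstay : ∀ {r c F′ e} → F (suc r) c < M → F r (suc c) ≤ F (suc r) c →
              K F r (suc c) F′ e → K F r c F′ e

  -- Reverse insertion: z (in RN F r c z), or the entry of box (r , c) that also stays
  -- in place (in RK F r c), is about to enter column c - 1, in row r or below.
  mutual
    data RN (F : Filling) : ℕ → ℕ → ℕ → Filling → ℕ → Set where
      nil : ∀ {r z F₀} → F ≈ F₀ → RN F r 0 z F₀ z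
      down : ∀ {r c z F₀ x} → F (suc r) c < z → RN F (suc r) (suc c) z F₀ x → RN F r (suc c) z F₀ x
      put : ∀ {r c z w F₀ x} → z < F (suc r) c → F r c ≡ w →
            RN (upd F r c z) r c w F₀ x → RN F r (suc c) z F₀ x
      blk : ∀ {r c z F₀ x} → F (suc r) c ≡ z → RK F r c F₀ x → RN F r (suc c) z F₀ x

    data RK (F : Filling) : ℕ → ℕ → Filling → ℕ → Set where
      nil : ∀ {r F₀ x} → F ≈ F₀ → F r 0 ≡ x → RK F r 0 F₀ x
      down : ∀ {r c z F₀ x} → F r (suc c) ≡ z → F (suc r) c < z →
             RN F (suc r) (suc c) z F₀ x → RK F r (suc c) F₀ x
      stay : ∀ {r c F₀ x} → F r (suc c) ≤ F (suc r) c → RK F r c F₀ x → RK F r (suc c) F₀ x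

  -- A new box is emptied, which means restoring its default value, and its entry is sent left; the
  -- entry of an old corner is sent left but also stays.
  RStart : Filling → End → Filling → ℕ → Set
  RStart F (new r c) F₀ x = RN (upd F r c (M + (r + c))) r c (F r c) F₀ x
  RStart F (old r c) F₀ x = RK F r c F₀ x

  Above-cong : ∀ {F G} → F ≈ G → ∀ r c x → Above F r c x → Above G r c x
  Above-cong e zero c x a = tt
  Above-cong e (suc r) c x a = subst (_< x) (e r c) a

  mutual
    N-cong : ∀ {F G r c x F′ e} → F ≈ G → N F r c x F′ e → N G r c x F′ e
    N-cong q (up {r} {c} lt n) = up (subst (_ <_) (q r c) lt) (N-cong q n)
    N-cong q (put {r} {c} {x} a refl lt n) =
      put (Above-cong q r c x a) (sym (q r c)) lt (N-cong (upd-cong r c x q) n)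
    N-cong q (putE {r} {c} {x} a le e) =
      putE (Above-cong q r c x a) (subst (M ≤_) (q r c) le) (≈-trans (≈-sym (upd-cong r c x q)) e)
    N-cong q (blk {r} {c} refl k) = blk (sym (q r c)) (K-cong q k)

    K-cong : ∀ {F G r c F′ e} → F ≈ G → K F r c F′ e → K G r c F′ e
    K-cong q (kend {r} {c} {e} a b d f g) =
      kend (subst (M ≤_) (q _ _) a) b (subst (_< M) (q _ _) d) (subst (M ≤_) (q _ _) f) (≈-trans (≈-sym q) g)
    K-cong q (kup a b d n) = kup (trans (sym (q _ _)) a) b (subst (_ <_) (q _ _) d) (N-cong q n)
    K-cong q (kstay a b k) = kstay (subst (_< M) (q _ _) a) (subst₂ _≤_ (q _ _) (q _ _) b) (K-cong q k)

  mutual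
    RN-cong : ∀ {F G r c z F₀ x} → F ≈ G → RN F r c z F₀ x → RN G r c z F₀ x
    RN-cong q (nil e) = nil (≈-trans (≈-sym q) e)
    RN-cong q (down a n) = down (subst (_< _) (q _ _) a) (RN-cong q n)
    RN-cong q (put {r} {c} {z} a b n) = put (subst (_ <_) (q _ _) a) (trans (sym (q _ _)) b) (RN-cong (upd-cong r c z q) n)
    RN-cong q (blk a k) = blk (trans (sym (q _ _)) a) (RK-cong q k)

    RK-cong : ∀ {F G r c F₀ x} → F ≈ G → RK F r c F₀ x → RK G r c F₀ x
    RK-cong q (nil e a) = nil (≈-trans (≈-sym q) e) (trans (sym (q _ _)) a)
    RK-cong q (down a b n) = down (trans (sym (q _ _)) a) (subst (_< _) (q _ _) b) (RN-cong q n)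
    RK-cong q (stay a k) = stay (subst₂ _≤_ (q _ _) (q _ _) a) (RK-cong q k)

  RStart-cong : ∀ {F G} e {F₀ x} → F ≈ G → RStart F e F₀ x → RStart G e F₀ x
  RStart-cong (new r c) q n = subst (λ w → RN _ r c w _ _) (q r c) (RN-cong (upd-cong r c _ q) n)
  RStart-cong (old r c) q k = RK-cong q k

  mutual
    -- The steps are separated by comparing the travelling letter with the entry of row `r + 1` in
    -- the column to be entered, so they never overlap.
    RN-det : ∀ {F r c z F₀ x F₁ y} → RN F r c z F₀ x → RN F r c z F₁ y → F₀ ≈ F₁ × x ≡ y
    RN-det (nil e) (nil f) = ≈-trans (≈-sym e) f , refl
    RN-det (down _ a) (down _ b) = RN-det a b
    RN-det (down p _) (put q _ _) = ⊥-elim (<-asym p q)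
    RN-det (down p _) (blk q _) = ⊥-elim (<-irrefl q p)
    RN-det (put p _ _) (down q _) = ⊥-elim (<-asym p q)
    RN-det (put _ refl a) (put _ refl b) = RN-det a b
    RN-det (put p _ _) (blk q _) = ⊥-elim (<-irrefl (sym q) p)
    RN-det (blk p _) (down q _) = ⊥-elim (<-irrefl p q)
    RN-det (blk p _) (put q _ _) = ⊥-elim (<-irrefl (sym p) q)
    RN-det (blk _ a) (blk _ b) = RK-det a b

    RK-det : ∀ {F r c F₀ x F₁ y} → RK F r c F₀ x → RK F r c F₁ y → F₀ ≈ F₁ × x ≡ y
    RK-det (nil e refl) (nil f refl) = ≈-trans (≈-sym e) f , refl
    RK-det (down refl _ a) (down refl _ b) = RN-det a b
    RK-det (down refl p _) (stay q _) = ⊥-elim (<⇒≱ p q)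
    RK-det (stay p _) (down refl q _) = ⊥-elim (<⇒≱ q p)
    RK-det (stay _ a) (stay _ b) = RK-det a b

  RStart-det : ∀ {F} e {F₀ x F₁ y} → RStart F e F₀ x → RStart F e F₁ y → F₀ ≈ F₁ × x ≡ y
  RStart-det (new _ _) = RN-det
  RStart-det (old _ _) = RK-det

  -- Invariants of paths; forward and reverse paths are inverse to each other.

  Left : Filling → ℕ → ℕ → ℕ → Set
  Left F r c x = ∀ k → c ≡ suc k → F r k < x

  Left-up : ∀ {F} → Inc F → ∀ r c {x} → Left F (suc r) c x → Left F r c x
  Left-up i r c l k e = <-trans (col i r k) (l k e)

  Left-put : ∀ F r c x {y} → x < y → Left (upd F r c x) r (suc c) y
  Left-put F r c x lt k refl = subst (_< _) (sym (upd-hit F r c x)) lt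

  upd-lower-Inc : ∀ {F r c x} → Inc F → x < F r c → Left F r c x → Above F r c x → Inc (upd F r c x)
  upd-lower-Inc {F} {r} {c} {x} i lt l a = record { row = rw ; col = cl }
    where
    rw : ∀ q k → upd F r c x q k < upd F r c x q (suc k)
    rw q k with updView F r c x q k | updView F r c x q (suc k)
    ... | hit _ p _ | hit _ p′ _ = ⊥-elim (1+n≢n (trans p′ (sym p)))
    ... | hit refl refl e | miss _ e′ = subst₂ _<_ (sym e) (sym e′) (<-trans lt (row i r c))
    ... | miss _ e | hit refl refl e′ = subst₂ _<_ (sym e) (sym e′) (l k refl)
    ... | miss _ e | miss _ e′ = subst₂ _<_ (sym e) (sym e′) (row i q k)
    cl : ∀ q k → upd F r c x q k < upd F r c x (suc q) k
    cl q k with updView F r c x q k | updView F r c x (suc q) k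
    ... | hit p _ _ | hit p′ _ _ = ⊥-elim (1+n≢n (trans p′ (sym p)))
    ... | hit refl refl e | miss _ e′ = subst₂ _<_ (sym e) (sym e′) (<-trans lt (col i r c))
    ... | miss _ e | hit refl refl e′ = subst₂ _<_ (sym e) (sym e′) a
    ... | miss _ e | miss _ e′ = subst₂ _<_ (sym e) (sym e′) (col i q k)

  upd-raise-Inc : ∀ {F r c z} → Inc F → F r c < z → z < F r (suc c) → z < F (suc r) c → Inc (upd F r c z)
  upd-raise-Inc {F} {r} {c} {z} i lt rt bl = record { row = rw ; col = cl }
    where
    rw : ∀ q k → upd F r c z q k < upd F r c z q (suc k)
    rw q k with updView F r c z q k | updView F r c z q (suc k)
    ... | hit _ p _ | hit _ p′ _ = ⊥-elim (1+n≢n (trans p′ (sym p)))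
    ... | hit refl refl e | miss _ e′ = subst₂ _<_ (sym e) (sym e′) rt
    ... | miss _ e | hit refl refl e′ = subst₂ _<_ (sym e) (sym e′) (<-trans (row i r k) lt)
    ... | miss _ e | miss _ e′ = subst₂ _<_ (sym e) (sym e′) (row i q k)
    cl : ∀ q k → upd F r c z q k < upd F r c z (suc q) k
    cl q k with updView F r c z q k | updView F r c z (suc q) k
    ... | hit p _ _ | hit p′ _ _ = ⊥-elim (1+n≢n (trans p′ (sym p)))
    ... | hit refl refl e | miss _ e′ = subst₂ _<_ (sym e) (sym e′) bl
    ... | miss _ e | hit refl refl e′ = subst₂ _<_ (sym e) (sym e′) (<-trans (col i q k) lt)
    ... | miss _ e | miss _ e′ = subst₂ _<_ (sym e) (sym e′) (col i q k)

  upd-Std : ∀ {F} r c x → x < M → Std F → Std (upd F r c x)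
  upd-Std {F} r c x lt s q k le with updView F r c x q k
  ... | hit _ _ e = ⊥-elim (<⇒≱ lt (subst (M ≤_) e le))
  ... | miss _ e = trans e (s q k (subst (M ≤_) e le))

  upd-out-Std : ∀ {F} r c → Std F → Std (upd F r c (M + (r + c)))
  upd-out-Std {F} r c s q k le with updView F r c (M + (r + c)) q k
  ... | hit refl refl e = e
  ... | miss _ e = trans e (s q k (subst (M ≤_) e le))

  -- By `lt` and `left` the letter `x` fits into box `(r , c)` as far as its right, lower and left
  -- neighbours are concerned. Only the entry above remains to be compared, which is what the steps
  -- of `N` do.
  record NI (F : Filling) (r c x : ℕ) : Set where
    field
      inc : Inc F
      std : Std F
      x<M : x < M
      lt : x < F r c
      left : Left F r c x

  NI-cong : ∀ {F G r c x} → F ≈ G → NI F r c x → NI G r c x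
  NI-cong e i = record
    { inc = Inc-cong e (NI.inc i) ; std = Std-cong e (NI.std i) ; x<M = NI.x<M i
    ; lt = subst (_ <_) (e _ _) (NI.lt i) ; left = λ k q → subst (_< _) (e _ _) (NI.left i k q) }

  record KI (F : Filling) (r c : ℕ) : Set where
    field
      inc : Inc F
      std : Std F
      lt : F r c < M

  NI-up : ∀ {F r c x} → x < F r c → NI F (suc r) c x → NI F r c x
  NI-up {r = r} {c} p i = record { NI i ; lt = p ; left = Left-up (NI.inc i) r c (NI.left i) }

  NI-put : ∀ {F r c x y} → Above F r c x → F r c ≡ y → y < M → NI F r c x → NI (upd F r c x) r (suc c) y
  NI-put {F} {r} {c} {x} a refl p i = record
    { inc = upd-lower-Inc (NI.inc i) (NI.lt i) (NI.left i) a
    ; std = upd-Std r c x (NI.x<M i) (NI.std i)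
    ; x<M = p
    ; lt = subst (F r c <_) (sym (upd-miss F r c x r (suc c) (λ _ → 1+n≢n))) (row (NI.inc i) r c)
    ; left = Left-put F r c x (NI.lt i)
    }

  NI-blk : ∀ {F r c x} → F r c ≡ x → NI F (suc r) c x → KI F r c
  NI-blk refl i = record { NI i ; lt = NI.x<M i }

  KI-up : ∀ {F r c y} → F (suc r) c ≡ y → y < M → y < F r (suc c) → KI F r c → NI F r (suc c) y
  KI-up {r = r} {c} refl p q i = record { KI i ; x<M = p ; lt = q ; left = λ { k refl → col (KI.inc i) r c } }

  KI-stay : ∀ {F r c} → F (suc r) c < M → F r (suc c) ≤ F (suc r) c → KI F r c → KI F r (suc c)
  KI-stay p q i = record { KI i ; lt = ≤-<-trans q p }

  -- The reverse path is accumulated while the insertion path is followed.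
  mutual
    N⇒R : ∀ {F r c x F′ e F₀ x₀} → NI F r c x → RN F r c x F₀ x₀ → N F r c x F′ e → RStart F′ e F₀ x₀
    N⇒R {r = suc r} {c} i a (up p n) = N⇒R (NI-up p i) (RN-up r c (NI.left i) a) n
    N⇒R {F} {r} {c} {x} i a (put ab refl p n) = N⇒R (NI-put ab refl p i) (put below (upd-hit F r c x) back) n
      where
      below : F r c < upd F r c x (suc r) c
      below = subst (F r c <_) (sym (upd-miss F r c x (suc r) c (λ q _ → 1+n≢n q))) (col (NI.inc i) r c)
      back = RN-cong (≈-sym (upd-undo F r c x (F r c) refl)) a
    N⇒R {F} {r} {c} {x} {F′} i a (putE ab p q) = subst (λ w → RN _ r c w _ _) val (RN-cong eq a)
      where
      val : x ≡ F′ r c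
      val = trans (sym (upd-hit F r c x)) (q r c)
      eq : F ≈ upd F′ r c (M + (r + c))
      eq = ≈-trans (≈-sym (upd-undo F r c x _ (NI.std i r c p))) (upd-cong r c _ q)
    N⇒R {r = suc r} {c} i a (blk refl k) = K⇒R (NI-blk refl i) (acc c (NI.left i) a) k
      where
      acc : ∀ c {F F₀ x₀} → Left F (suc r) c (F r c) → RN F (suc r) c (F r c) F₀ x₀ → RK F r c F₀ x₀
      acc zero l (nil e) = nil e refl
      acc (suc c) l a = down refl (l c refl) a

    RN-up : ∀ r c {F x F₀ x₀} → Left F (suc r) c x → RN F (suc r) c x F₀ x₀ → RN F r c x F₀ x₀
    RN-up r zero l (nil e) = nil e
    RN-up r (suc c) l a = down (l c refl) a

    K⇒R : ∀ {F r c F′ e F₀ x₀} → KI F r c → RK F r c F₀ x₀ → K F r c F′ e → RStart F′ e F₀ x₀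
    K⇒R {F} {r} {c} i a (kend p q s t eq) = RK-cong eq (go q s)
      where
      go : ∀ {e} → c ≤ e → F r e < M → RK F r e _ _
      go {e} le s with m≤n⇒m<n∨m≡n le
      ... | inj₂ refl = a
      go {suc e} le s | inj₁ lt = stay (≤-trans (<⇒≤ s) (≤-trans p (row-mono (KI.inc i) (suc r) (s≤s⁻¹ lt))))
                                       (go (s≤s⁻¹ lt) (<-trans (row (KI.inc i) r e) s))
    K⇒R i a (kup refl q s n) = N⇒R (KI-up refl q s i) (blk refl a) n
    K⇒R i a (kstay p q k) = K⇒R (KI-stay p q i) (stay q a) k

  record RNI (F : Filling) (r c z : ℕ) : Set where
    field
      inc : Inc F
      std : Std F
      z<M : z < M
      right : z < F r c
      left : Left F r c z

  RNI-down : ∀ {F r c z} → F (suc r) c < z → RNI F r (suc c) z → RNI F (suc r) (suc c) z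
  RNI-down {r = r} {c} p i = record { RNI i ; right = <-trans (RNI.right i) (col (RNI.inc i) r (suc c)) ; left = λ { k refl → p } }

  RNI-put : ∀ {F r c z w} → z < F (suc r) c → F r c ≡ w → RNI F r (suc c) z → RNI (upd F r c z) r c w
  RNI-put {F} {r} {c} {z} p refl i = record
    { inc = upd-raise-Inc (RNI.inc i) (RNI.left i c refl) (RNI.right i) p
    ; std = upd-Std r c z (RNI.z<M i) (RNI.std i)
    ; z<M = <-trans (RNI.left i c refl) (RNI.z<M i)
    ; right = subst (F r c <_) (sym (upd-hit F r c z)) (RNI.left i c refl)
    ; left = λ { k refl → subst (_< F r c) (sym (upd-miss F r c z r k (λ _ q → 1+n≢n (sym q)))) (row (RNI.inc i) r k) }
    }

  RNI-blk : ∀ {F r c z} → RNI F r (suc c) z → KI F r c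
  RNI-blk {c = c} i = record { RNI i ; lt = <-trans (RNI.left i c refl) (RNI.z<M i) }

  RKI-down : ∀ {F r c z} → F r (suc c) ≡ z → F (suc r) c < z → KI F r (suc c) → RNI F (suc r) (suc c) z
  RKI-down {r = r} {c} refl p i = record { KI i ; z<M = KI.lt i ; right = col (KI.inc i) r (suc c) ; left = λ { k refl → p } }

  RKI-stay : ∀ {F r c} → KI F r (suc c) → KI F r c
  RKI-stay {r = r} {c} i = record { KI i ; lt = <-trans (row (KI.inc i) r c) (KI.lt i) }

  Above-upd : ∀ {F} → Inc F → ∀ r c z → Above (upd F r c z) r c (F r c)
  Above-upd i zero c z = tt
  Above-upd {F} i (suc r) c z = subst (_< F (suc r) c) (sym (upd-miss F (suc r) c z r c (λ q _ → 1+n≢n (sym q)))) (col i r c)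

  mutual
    -- Here the forward path from the current position to the end is the accumulator: each reverse
    -- step extends it at its front.
    R⇒N : ∀ {F r c z F′ e F₀ x₀} → RNI F r c z → N F r c z F′ e → RN F r c z F₀ x₀ →
          ∃ λ q → NI F₀ q 0 x₀ × N F₀ q 0 x₀ F′ e
    R⇒N {r = r} i a (nil e) = r , NI-cong e (record { RNI i ; x<M = RNI.z<M i ; lt = RNI.right i ; left = λ _ () }) , N-cong e a
    R⇒N i a (down p n) = R⇒N (RNI-down p i) (up (RNI.right i) a) n
    R⇒N {F} {r} {suc c} {z} i a (put p refl n) =
      R⇒N (RNI-put p refl i)
          (put (Above-upd (RNI.inc i) r c z) (upd-hit F r c z) (RNI.z<M i)
               (N-cong (≈-sym (upd-undo F r c z (F r c) refl)) a)) n
    R⇒N i a (blk refl k) = RK⇒N (RNI-blk i) (kup refl (RNI.z<M i) (RNI.right i) a) k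

    RK⇒N : ∀ {F r c F′ e F₀ x₀} → KI F r c → K F r c F′ e → RK F r c F₀ x₀ →
           ∃ λ q → NI F₀ q 0 x₀ × N F₀ q 0 x₀ F′ e
    RK⇒N {r = r} i a (nil e refl) =
      suc r , NI-cong e (record { KI i ; x<M = KI.lt i ; lt = col (KI.inc i) r 0 ; left = λ _ () }) , N-cong e (blk refl a)
    RK⇒N i a (down refl q n) = R⇒N (RKI-down refl q i) (blk refl a) n
    RK⇒N {F} {r} {suc c} i a (stay p k) = RK⇒N (RKI-stay i) (widen a) k
      where
      -- If box `(r + 1 , c)` is outside the diagram, so is the one to its right. Then the forward
      -- path can only be `kend`, and its bound on the starting column may be relaxed.
      widen : ∀ {F′ e} → K F r (suc c) F′ e → K F r c F′ e
      widen a with F (suc r) c <? M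
      ... | yes q = kstay q p a
      widen (kend m le s t eq) | no q = kend (≮⇒≥ q) (<⇒≤ le) s t eq
      widen (kup refl m _ _) | no q = ⊥-elim (q (<-trans (row (KI.inc i) (suc r) c) m))
      widen (kstay m _ _) | no q = ⊥-elim (q (<-trans (row (KI.inc i) (suc r) c) m))

  -- Existence of insertion and reverse paths.

  row-end : ∀ {F} → Inc F → ∀ r c → F r c < M → ∃ λ e → c ≤ e × F r e < M × M ≤ F r (suc e)
  -- By `row-index` every row has left the diagram at column `M`.
  row-end {F} i r c lt = go M c (m≤m+n M c) lt
    where
    go : ∀ n c → M ≤ n + c → F r c < M → ∃ λ e → c ≤ e × F r e < M × M ≤ F r (suc e)
    go zero c b lt = ⊥-elim (<⇒≱ lt (≤-trans b (row-index i r c)))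
    go (suc n) c b lt with F r (suc c) <? M
    ... | no p = c , ≤-refl , lt , ≮⇒≥ p
    ... | yes p with go n (suc c) (subst (M ≤_) (sym (+-suc n c)) b) p
    ...   | e , q , h = e , <⇒≤ q , h

  mutual
    -- The pair `(n , r)` decreases lexicographically: `n` bounds how far the travelling letter can
    -- still grow below `M`, and a round that keeps `n` lowers the row.
    N-total : ∀ n {F} r {c x} → M ≤ n + x → NI F r c x → ∃ λ F′ → ∃ λ e → N F r c x F′ e
    N-total zero r b i = ⊥-elim (<⇒≱ (NI.x<M i) b)
    N-total (suc n) {F} zero b i = N-put n zero tt b i
    N-total (suc n) {F} (suc r) {c} {x} b i with <-cmp x (F r c)
    ... | tri< p _ _ with N-total (suc n) r b (NI-up p i)
    ...   | F′ , e , h = F′ , e , up p h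
    N-total (suc n) {F} (suc r) {c} {x} b i | tri≈ _ refl _
      with K-total (suc n) r (≤-trans b (+-monoʳ-≤ (suc n) (<⇒≤ (col (NI.inc i) r c)))) (NI-blk refl i)
    ... | F′ , e , h = F′ , e , blk refl h
    N-total (suc n) {F} (suc r) {c} {x} b i | tri> _ _ p = N-put n (suc r) p b i

    N-put : ∀ n {F} r {c x} → Above F r c x → M ≤ suc n + x → NI F r c x → ∃ λ F′ → ∃ λ e → N F r c x F′ e
    N-put n {F} r {c} {x} a b i with F r c <? M
    ... | no p = _ , _ , putE a (≮⇒≥ p) ≈-refl
    ... | yes p with N-total n r (≤-trans b (subst (_≤ n + F r c) (+-suc n x) (+-monoʳ-≤ n (NI.lt i)))) (NI-put a refl p i)
    ...   | F′ , e , h = F′ , e , put a refl p h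

    K-total : ∀ n {F} r {c} → M ≤ n + F (suc r) c → KI F r c → ∃ λ F′ → ∃ λ e → K F r c F′ e
    K-total n {F} r {c} b i with F (suc r) c <? M
    ... | no p with row-end (KI.inc i) r c (KI.lt i)
    ...   | e , q , h , t = _ , _ , kend (≮⇒≥ p) q h t ≈-refl
    K-total n {F} r {c} b i | yes p with F (suc r) c <? F r (suc c)
    K-total n {F} r {c} b i | yes p | yes q with N-total n r b (KI-up refl p q i)
    ... | F′ , e , h = F′ , e , kup refl p q h
    K-total zero r b i | yes p | no q = ⊥-elim (<⇒≱ p b)
    K-total (suc n) {F} r {c} b i | yes p | no q
      with K-total n r (≤-trans b (subst (_≤ n + F (suc r) (suc c)) (+-suc n _) (+-monoʳ-≤ n (row (KI.inc i) (suc r) c)))) (KI-stay p (≮⇒≥ q) i)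
    ... | F′ , e , h = F′ , e , kstay p (≮⇒≥ q) h

  mutual
    RN-total : ∀ c {F r z} → RNI F r c z → ∃ λ F₀ → ∃ λ x → RN F r c z F₀ x
    RN-total zero i = _ , _ , nil ≈-refl
    RN-total (suc c) {z = z} i = RN-total-suc c z (m≤m+n z _) i

    -- Moving down must stop: the entry in row `r + 1` is at least `r + 1`, so it exceeds `z` once
    -- `r` has reached `z`.
    RN-total-suc : ∀ c n {F r z} → z ≤ n + r → RNI F r (suc c) z → ∃ λ F₀ → ∃ λ x → RN F r (suc c) z F₀ x
    RN-total-suc c n {F} {r} {z} b i with <-cmp (F (suc r) c) z
    RN-total-suc c zero {F} {r} {z} b i | tri< p _ _ = ⊥-elim (<⇒≱ p (≤-trans b (<⇒≤ (col-index (RNI.inc i) (suc r) c))))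
    RN-total-suc c (suc n) {F} {r} {z} b i | tri< p _ _
      with RN-total-suc c n (subst (z ≤_) (sym (+-suc n r)) b) (RNI-down p i)
    ... | F₀ , x , h = F₀ , x , down p h
    RN-total-suc c n b i | tri≈ _ p _ with RK-total c (RNI-blk i)
    ... | F₀ , x , h = F₀ , x , blk p h
    RN-total-suc c n {F} {r} {z} b i | tri> _ _ p with RN-total c (RNI-put p refl i)
    ... | F₀ , x , h = F₀ , x , put p refl h

    RK-total : ∀ c {F r} → KI F r c → ∃ λ F₀ → ∃ λ x → RK F r c F₀ x
    RK-total zero i = _ , _ , nil ≈-refl refl
    RK-total (suc c) {F} {r} i with F (suc r) c <? F r (suc c)
    ... | yes p with RN-total (suc c) (RKI-down refl p i)
    ...   | F₀ , x , h = F₀ , x , down refl p h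
    RK-total (suc c) {F} {r} i | no p with RK-total c (RKI-stay i)
    ... | F₀ , x , h = F₀ , x , stay (≮⇒≥ p) h

  -- Effect of a path on the entries and on the diagram.

  mutual
    N-Inc : ∀ {F r c x F′ e} → NI F r c x → N F r c x F′ e → Inc F′ × Std F′
    N-Inc i (up p n) = N-Inc (NI-up p i) n
    N-Inc i (put a b p n) = N-Inc (NI-put a b p i) n
    N-Inc {r = r} {c} {x} i (putE a p q) =
      Inc-cong q (upd-lower-Inc (NI.inc i) (NI.lt i) (NI.left i) a) , Std-cong q (upd-Std r c x (NI.x<M i) (NI.std i))
    N-Inc i (blk p k) = K-Inc (NI-blk p i) k

    K-Inc : ∀ {F r c F′ e} → KI F r c → K F r c F′ e → Inc F′ × Std F′
    K-Inc i (kend _ _ _ _ q) = Inc-cong q (KI.inc i) , Std-cong q (KI.std i)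
    K-Inc i (kup a p q n) = N-Inc (KI-up a p q i) n
    K-Inc i (kstay p q k) = K-Inc (KI-stay p q i) k

  upd-≤ : ∀ F r c x → x ≤ F r c → ∀ q k → upd F r c x q k ≤ F q k
  upd-≤ F r c x le q k with updView F r c x q k
  ... | hit refl refl e = subst (_≤ F r c) (sym e) le
  ... | miss _ e = ≤-reflexive e

  mutual
    N-≤ : ∀ {F r c x F′ e} → NI F r c x → N F r c x F′ e → ∀ q k → F′ q k ≤ F q k
    N-≤ i (up p n) = N-≤ (NI-up p i) n
    N-≤ i (put a b p n) q k = ≤-trans (N-≤ (NI-put a b p i) n q k) (upd-≤ _ _ _ _ (<⇒≤ (NI.lt i)) q k)
    N-≤ i (putE a p eq) q k = subst (_≤ _) (eq q k) (upd-≤ _ _ _ _ (<⇒≤ (NI.lt i)) q k)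
    N-≤ i (blk p n) = K-≤ (NI-blk p i) n

    K-≤ : ∀ {F r c F′ e} → KI F r c → K F r c F′ e → ∀ q k → F′ q k ≤ F q k
    K-≤ i (kend _ _ _ _ eq) q k = ≤-reflexive (sym (eq q k))
    K-≤ i (kup a p s n) = N-≤ (KI-up a p s i) n
    K-≤ i (kstay p q k) = K-≤ (KI-stay p q i) k

  mutual
    -- Every letter written is the inserted one or a larger one bumped later. This keeps entries
    -- positive and keeps the first entry of a row above the letters still to come.
    N-low : ∀ {F r c x F′ e} → NI F r c x → N F r c x F′ e → ∀ q k → x ≤ F′ q k ⊎ F′ q k ≡ F q k
    N-low i (up p n) = N-low (NI-up p i) n
    N-low {F} {r} {c} {x} i (put a refl p n) q k with N-low (NI-put a refl p i) n q k
    ... | inj₁ h = inj₁ (≤-trans (<⇒≤ (NI.lt i)) h)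
    ... | inj₂ h with updView F r c x q k
    ...   | hit _ _ e = inj₁ (≤-reflexive (sym (trans h e)))
    ...   | miss _ e = inj₂ (trans h e)
    N-low {F} {r} {c} {x} i (putE a p eq) q k with updView F r c x q k
    ... | hit _ _ e = inj₁ (≤-reflexive (trans (sym e) (eq q k)))
    ... | miss _ e = inj₂ (trans (sym (eq q k)) e)
    N-low {F} {suc r} {c} i (blk refl n) q k with K-low (NI-blk refl i) n q k
    ... | inj₁ h = inj₁ (≤-trans (<⇒≤ (col (NI.inc i) r c)) h)
    ... | inj₂ h = inj₂ h

    K-low : ∀ {F r c F′ e} → KI F r c → K F r c F′ e → ∀ q k → F (suc r) c ≤ F′ q k ⊎ F′ q k ≡ F q k
    K-low i (kend _ _ _ _ eq) q k = inj₂ (sym (eq q k))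
    K-low i (kup refl p s n) = N-low (KI-up refl p s i) n
    K-low {F} {r} {c} i (kstay p s n) q k with K-low (KI-stay p s i) n q k
    ... | inj₁ h = inj₁ (≤-trans (<⇒≤ (row (KI.inc i) (suc r) c)) h)
    ... | inj₂ h = inj₂ h

  mutual
    N-local : ∀ {F r c x F′ e} → N F r c x F′ e → ∀ q k → k < c ⊎ r < q → F′ q k ≡ F q k
    N-local (up p n) q k (inj₁ h) = N-local n q k (inj₁ h)
    N-local (up p n) q k (inj₂ h) = N-local n q k (inj₂ (<-trans (n<1+n _) h))
    N-local {F} {r} {c} {x} (put a b p n) q k h =
      trans (N-local n q k (widen h)) (upd-miss F r c x q k (away h))
      where
      widen : k < c ⊎ r < q → k < suc c ⊎ r < q
      widen (inj₁ h) = inj₁ (<-trans h (n<1+n c))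
      widen (inj₂ h) = inj₂ h
      away : k < c ⊎ r < q → q ≡ r → k ≡ c → ⊥
      away (inj₁ h) _ e = <-irrefl e h
      away (inj₂ h) e _ = <-irrefl (sym e) h
    N-local {F} {r} {c} {x} (putE a p eq) q k h = trans (sym (eq q k)) (upd-miss F r c x q k (away h))
      where
      away : k < c ⊎ r < q → q ≡ r → k ≡ c → ⊥
      away (inj₁ h) _ e = <-irrefl e h
      away (inj₂ h) e _ = <-irrefl (sym e) h
    N-local (blk p n) q k (inj₁ h) = K-local n q k (inj₁ (<⇒≤ h))
    N-local (blk p n) q k (inj₂ h) = K-local n q k (inj₂ (<-trans (n<1+n _) h))

    K-local : ∀ {F r c F′ e} → K F r c F′ e → ∀ q k → k ≤ c ⊎ r < q → F′ q k ≡ F q k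
    K-local (kend _ _ _ _ eq) q k h = sym (eq q k)
    K-local (kup a p s n) q k (inj₁ h) = N-local n q k (inj₁ (s≤s h))
    K-local (kup a p s n) q k (inj₂ h) = N-local n q k (inj₂ h)
    K-local (kstay p s n) q k (inj₁ h) = K-local n q k (inj₁ (≤-trans h (n≤1+n _)))
    K-local (kstay p s n) q k (inj₂ h) = K-local n q k (inj₂ h)

  mutual
    N-col : ∀ {F r c x F′ e} → N F r c x F′ e → c ≤ endCol e
    N-col (up p n) = N-col n
    N-col (put a b p n) = <⇒≤ (N-col n)
    N-col (putE a p eq) = ≤-refl
    N-col (blk p n) = K-col n

    K-col : ∀ {F r c F′ e} → K F r c F′ e → c ≤ endCol e
    K-col (kend _ p _ _ _) = p
    K-col (kup a p s n) = <⇒≤ (N-col n)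
    K-col (kstay p s n) = <⇒≤ (K-col n)

  Box : Filling → Filling → End → Set
  Box F F′ (new r c) =
    M ≤ F r c × F′ r c < M × (∀ q k → (q ≡ r → k ≡ c → ⊥) → M ≤ F q k → M ≤ F′ q k)
  Box F F′ (old r c) =
    F r c < M × M ≤ F r (suc c) × M ≤ F (suc r) c × (∀ q k → M ≤ F q k → M ≤ F′ q k)

  Box-upd : ∀ {F F′} r c x e → Inc F → x < M → x < F r c → F r c < M → Box (upd F r c x) F′ e → Box F F′ e
  Box-upd {F} {F′} r c x e i x<M lt p = go e
    where
    grow : ∀ q k → M ≤ upd F r c x q k → M ≤ F q k
    grow q k h = ≤-trans h (upd-≤ F r c x (<⇒≤ lt) q k)
    shrink : ∀ q k → M ≤ F q k → M ≤ upd F r c x q k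
    shrink q k h with updView F r c x q k
    ... | hit refl refl _ = ⊥-elim (<⇒≱ p h)
    ... | miss _ e = subst (M ≤_) (sym e) h
    go : ∀ e → Box (upd F r c x) F′ e → Box F F′ e
    go (new _ _) (a , b , f) = grow _ _ a , b , λ q k n h → f q k n (shrink q k h)
    go (old s d) (a , b , g , f) = ≰⇒> (λ h → <⇒≱ a (shrink s d h)) , grow _ _ b , grow _ _ g , λ q k h → f q k (shrink q k h)

  mutual
    N-Box : ∀ {F r c x F′ e} → NI F r c x → N F r c x F′ e → Box F F′ e
    N-Box i (up p n) = N-Box (NI-up p i) n
    N-Box {r = r} {c} {x} {e = e} i (put a refl p n) = Box-upd r c x e (NI.inc i) (NI.x<M i) (NI.lt i) p (N-Box (NI-put a refl p i) n)
    N-Box {F} {r} {c} {x} i (putE a p eq) =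
      p , subst (_< M) (trans (sym (upd-hit F r c x)) (eq r c)) (NI.x<M i) ,
      λ q k n h → subst (M ≤_) (trans (sym (upd-miss F r c x q k n)) (eq q k)) h
    N-Box i (blk p n) = K-Box (NI-blk p i) n

    K-Box : ∀ {F r c F′ e} → KI F r c → K F r c F′ e → Box F F′ e
    K-Box {r = r} i (kend m le s t eq) =
      s , t , ≤-trans m (row-mono (KI.inc i) (suc r) le) , λ q k h → subst (M ≤_) (eq q k) h
    K-Box i (kup a p s n) = N-Box (KI-up a p s i) n
    K-Box i (kstay p s n) = K-Box (KI-stay p s i) n

  mutual
    RN-≥ : ∀ {F r c z F₀ x} → RNI F r c z → RN F r c z F₀ x → ∀ q k → F q k ≤ F₀ q k
    RN-≥ i (nil e) q k = ≤-reflexive (e q k)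
    RN-≥ i (down p n) = RN-≥ (RNI-down p i) n
    RN-≥ {F} {r} {suc c} {z} i (put p e n) q k = ≤-trans raise (RN-≥ (RNI-put p e i) n q k)
      where
      raise : F q k ≤ upd F r c z q k
      raise with updView F r c z q k
      ... | hit refl refl e = subst (F r c ≤_) (sym e) (<⇒≤ (RNI.left i c refl))
      ... | miss _ e = ≤-reflexive (sym e)
    RN-≥ i (blk p k) = RK-≥ (RNI-blk i) k

    RK-≥ : ∀ {F r c F₀ x} → KI F r c → RK F r c F₀ x → ∀ q k → F q k ≤ F₀ q k
    RK-≥ i (nil e p) q k = ≤-reflexive (e q k)
    RK-≥ i (down e p n) = RN-≥ (RKI-down e p i) n
    RK-≥ i (stay p k) = RK-≥ (RKI-stay i) k

  mutual
    RN-pos : ∀ {F r c z F₀ x} → (∀ q k → 1 ≤ F q k) → 1 ≤ z → RN F r c z F₀ x → 1 ≤ x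
    RN-pos f h (nil _) = h
    RN-pos f h (down _ n) = RN-pos f h n
    RN-pos {F} {r} {suc c} {z} f h (put _ refl n) = RN-pos f′ (f r c) n
      where
      f′ : ∀ q k → 1 ≤ upd F r c z q k
      f′ q k with updView F r c z q k
      ... | hit _ _ e = subst (1 ≤_) (sym e) h
      ... | miss _ e = subst (1 ≤_) (sym e) (f q k)
    RN-pos f h (blk _ k) = RK-pos f k

    RK-pos : ∀ {F r c F₀ x} → (∀ q k → 1 ≤ F q k) → RK F r c F₀ x → 1 ≤ x
    RK-pos f (nil _ refl) = f _ _
    RK-pos f (down refl _ n) = RN-pos f (f _ _) n
    RK-pos f (stay _ k) = RK-pos f k

  mutual
    RN-local : ∀ {F r c z F₀ x} → RN F r c z F₀ x → ∀ q k → c ≤ k → F₀ q k ≡ F q k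
    RN-local (nil e) q k h = sym (e q k)
    RN-local (down _ n) q k h = RN-local n q k h
    RN-local {F} {r} {suc c} {z} (put _ _ n) q k h =
      trans (RN-local n q k (<⇒≤ h)) (upd-miss F r c z q k (λ _ e → <-irrefl (sym e) h))
    RN-local (blk _ n) q k h = RK-local n q k (<⇒≤ h)

    RK-local : ∀ {F r c F₀ x} → RK F r c F₀ x → ∀ q k → c ≤ k → F₀ q k ≡ F q k
    RK-local (nil e _) q k h = sym (e q k)
    RK-local (down _ _ n) q k h = RN-local n q k h
    RK-local (stay _ n) q k h = RK-local n q k (<⇒≤ h)

  -- Comparison of two successive paths, forward and backward.

  -- A letter entering column c below the head of a chain is bumped out of every
  -- column up to e (N-pass); a path leaves behind a chain headed by its first letter.
  data Chain (F : Filling) : ℕ → ℕ → ℕ → Set where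
    last : ∀ {c v} r → F r c ≡ v → v < M → Chain F c v c
    link : ∀ {c v w e} r → F r c ≡ v → v < w → Chain F (suc c) w e → Chain F c v e

  Chain-cong : ∀ {F G c v e} → (∀ q k → c ≤ k → F q k ≡ G q k) → Chain F c v e → Chain G c v e
  Chain-cong h (last r e lt) = last r (trans (sym (h r _ ≤-refl)) e) lt
  Chain-cong h (link r e lt ch) = link r (trans (sym (h r _ ≤-refl)) e) lt (Chain-cong (λ q k le → h q k (<⇒≤ le)) ch)

  Chain-<M : ∀ {F c v e} → Chain F c v e → v < M
  Chain-<M (last _ _ lt) = lt
  Chain-<M (link _ _ lt ch) = <-trans lt (Chain-<M ch)

  mutual
    N-Chain : ∀ {F r c x F′ e} → NI F r c x → N F r c x F′ e → Chain F′ c x (endCol e)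
    N-Chain i (up p n) = N-Chain (NI-up p i) n
    N-Chain {F} {r} {c} {x} i (put a refl p n) =
      link r (trans (N-local n r c (inj₁ (n<1+n c))) (upd-hit F r c x)) (NI.lt i) (N-Chain (NI-put a refl p i) n)
    N-Chain {F} {r} {c} {x} i (putE a p eq) = last r (trans (sym (eq r c)) (upd-hit F r c x)) (NI.x<M i)
    N-Chain i (blk refl k) = K-Chain (NI-blk refl i) k

    -- While blocked, the chain follows row `r`: it begins with the copy of the letter that caused
    -- the block, and at `kend` the row runs on to its last box, where the insertion ends.
    K-Chain : ∀ {F r c F′ e} → KI F r c → K F r c F′ e → Chain F′ c (F r c) (endCol e)
    K-Chain {F} {r} {c₀} {F′} i (kend {e = e} _ le s _ eq) = go c₀ (e ∸ c₀) (m∸n+n≡m le)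
      where
      go : ∀ c n → n + c ≡ e → Chain F′ c (F r c) e
      go c zero refl = last r (sym (eq r c)) s
      go c (suc n) h = link r (sym (eq r c)) (row (KI.inc i) r c) (go (suc c) n (trans (+-suc n c) h))
    K-Chain {F} {r} {c} i (kup refl p q n) =
      link r (N-local n r c (inj₁ (n<1+n c))) (col (KI.inc i) r c) (N-Chain (KI-up refl p q i) n)
    K-Chain {F} {r} {c} i (kstay p q k) =
      link r (K-local k r c (inj₁ (n≤1+n c))) (row (KI.inc i) r c) (K-Chain (KI-stay p q i) k)

  Above-≤ : ∀ {F} → Inc F → ∀ {r c y q} → Above F r c y → y < F q c → r ≤ q
  Above-≤ i {zero} a lt = z≤n
  Above-≤ {F} i {suc r} {c} a lt = col-reflects i c (<-trans a lt)

  Chain-head : ∀ {F c v e} → Chain F c v e → ∃ λ q → F q c ≡ v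
  Chain-head (last q h _) = q , h
  Chain-head (link q h _ _) = q , h

  mutual
    -- Column `c` contains `v`, which is larger than the letter, so the entry bumped is at most `v`
    -- and hence smaller than the next entry of the chain. This repeats up to the last column of the
    -- chain and pushes the path past it.
    N-pass : ∀ {F r c y v F′ e e′} → NI F r c y → Chain F c v e → y < v → N F r c y F′ e′ → e < endCol e′
    N-pass i ch lt (up p n) = N-pass (NI-up p i) ch lt n
    N-pass i (last _ _ _) lt (put a refl p n) = N-col n
    N-pass {F} {r} {c} {y} i (link q refl vw ch) lt (put a refl p n) =
      N-pass (NI-put a refl p i)
        (Chain-cong (λ s k le → sym (upd-miss F r c y s k (λ _ e → <-irrefl (sym e) le))) ch)
        (≤-<-trans (col-mono (NI.inc i) c (Above-≤ (NI.inc i) a lt)) vw) n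
    N-pass {c = c} i ch lt (putE a p eq) with Chain-head ch
    ... | q , refl = ⊥-elim (<⇒≱ (Chain-<M ch) (≤-trans p (col-mono (NI.inc i) c (Above-≤ (NI.inc i) a lt))))
    N-pass {c = c} i ch lt (blk refl k) with Chain-head ch
    ... | q , refl = K-pass (NI-blk refl i) ch (col-mono (NI.inc i) c (col-reflects (NI.inc i) c lt)) k

    K-pass : ∀ {F r c v F′ e e′} → KI F r c → Chain F c v e → F (suc r) c ≤ v → K F r c F′ e′ → e < endCol e′
    K-pass i ch le (kend p _ _ _ _) = ⊥-elim (<⇒≱ (Chain-<M ch) (≤-trans p le))
    K-pass i (last _ _ _) le (kup refl p s n) = N-col n
    K-pass i (link _ refl vw ch) le (kup refl p s n) = N-pass (KI-up refl p s i) ch (≤-<-trans le vw) n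
    K-pass i (last _ _ _) le (kstay p s k) = K-col k
    K-pass {c = c} i (link _ refl vw ch) le (kstay p s k) with Chain-head ch
    ... | q , refl = K-pass (KI-stay p s i) ch (col-mono (KI.inc i) (suc c) (col-reflects (KI.inc i) (suc c) (≤-<-trans (≤-trans s le) vw))) k

  -- The mirror image of Chain: a reverse path entering column c above the head of
  -- the chain ends with a letter above x.
  data RChain (F : Filling) (x : ℕ) : ℕ → ℕ → Set where
    last : ∀ {w} r → F r 0 ≡ w → w < M → x < w → RChain F x 0 w
    link : ∀ {c v w} r → F r (suc c) ≡ w → w < M → v < w → RChain F x c v → RChain F x (suc c) w

  RChain-<M : ∀ {F x c w} → RChain F x c w → w < M
  RChain-<M (last _ _ p _) = p
  RChain-<M (link _ _ p _ _) = p

  RChain-head : ∀ {F x c w} → RChain F x c w → ∃ λ q → F q c ≡ w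
  RChain-head (last q h _ _) = q , h
  RChain-head (link q h _ _ _) = q , h

  RChain-down : ∀ {F x c w c′} → c′ ≤ c → RChain F x c w → ∃ λ v → RChain F x c′ v
  RChain-down z≤n ch@(last _ _ _ _) = _ , ch
  RChain-down le ch@(link _ _ _ _ ch′) with m≤n⇒m<n∨m≡n le
  ... | inj₂ refl = _ , ch
  ... | inj₁ lt = RChain-down (s≤s⁻¹ lt) ch′

  mutual
    RN-RChain : ∀ {F r c z F₀ x} → RNI F r (suc c) z → RN F r (suc c) z F₀ x → ∃ λ w → w ≤ z × RChain F₀ x c w
    RN-RChain i (down p n) = RN-RChain (RNI-down p i) n
    RN-RChain {F} {r} {zero} {z} i (put p refl n@(nil e)) =
      z , ≤-refl , last r (trans (RN-local n r 0 z≤n) (upd-hit F r 0 z)) (RNI.z<M i) (RNI.left i 0 refl)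
    RN-RChain {F} {r} {suc c} {z} i (put p refl n) with RN-RChain (RNI-put p refl i) n
    ... | w , le , ch = z , ≤-refl ,
      link r (trans (RN-local n r (suc c) ≤-refl) (upd-hit F r (suc c) z)) (RNI.z<M i) (≤-<-trans le (RNI.left i (suc c) refl)) ch
    RN-RChain {F} {r} {c} i (blk refl k) = F (suc r) c , ≤-refl , RK-RChain (RNI-blk i) (RNI.z<M i) k

    -- While blocked, the reversed letter is an entry of row `r`, so the strictly larger values for
    -- the chain are found in row `r + 1`.
    RK-RChain : ∀ {F r c F₀ x} → KI F r c → F (suc r) c < M → RK F r c F₀ x → RChain F₀ x c (F (suc r) c)
    RK-RChain {F} {r} i p k@(nil e refl) = last (suc r) (sym (e (suc r) 0)) p (col (KI.inc i) r 0)
    RK-RChain {F} {r} {suc c} i p (down refl q n) with RN-RChain (RKI-down refl q i) n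
    ... | w , le , ch = link (suc r) (RN-local n (suc r) (suc c) ≤-refl) p (≤-<-trans le (col (KI.inc i) r (suc c))) ch
    RK-RChain {F} {r} {suc c} i p (stay q k) =
      link (suc r) (RK-local k (suc r) (suc c) (n≤1+n c)) p (row (KI.inc i) (suc r) c)
        (RK-RChain (RKI-stay i) (<-trans (row (KI.inc i) (suc r) c) p) k)

  RChain-cong : ∀ {F G x c w} → (∀ q k → k ≤ c → F q k ≡ G q k) → RChain F x c w → RChain G x c w
  RChain-cong h (last r e p q) = last r (trans (sym (h r 0 ≤-refl)) e) p q
  RChain-cong h (link r e p q ch) = link r (trans (sym (h r _ ≤-refl)) e) p q (RChain-cong (λ s k le → h s k (m≤n⇒m≤1+n le)) ch)

  mutual
    -- Mirror image of `N-pass`: the letter sent left from a column is at least the chain entry of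
    -- that column, hence larger than the next chain entry, and finally larger than `y`.
    RN-rpass : ∀ {F r c z w F₀ x y} → RNI F r (suc c) z → RChain F y c w → w < z → RN F r (suc c) z F₀ x → y < x
    RN-rpass i ch lt (down p n) = RN-rpass (RNI-down p i) ch lt n
    RN-rpass {c = c} i ch lt (put p refl n) with RChain-head ch
    ... | q , refl = RN-put-rpass (RNI-put p refl i)
          ch (col-mono (RNI.inc i) c (s≤s⁻¹ (col-reflects (RNI.inc i) c (<-trans lt p)))) n
    RN-rpass {c = c} i ch lt (blk refl k) with RChain-head ch
    ... | q , refl = RK-rpass (RNI-blk i) ch (col-mono (RNI.inc i) c (s≤s⁻¹ (col-reflects (RNI.inc i) c lt))) k

    RN-put-rpass : ∀ {F r c z w F₀ x y} → RNI (upd F r c z) r c (F r c) → RChain F y c w → w ≤ F r c →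
                   RN (upd F r c z) r c (F r c) F₀ x → y < x
    RN-put-rpass i (last _ refl _ lt) le (nil _) = <-≤-trans lt le
    RN-put-rpass {F} {r} {suc c} {z} i (link _ refl _ lt ch) le n =
      RN-rpass i (RChain-cong (λ q k p → sym (upd-miss F r (suc c) z q k (λ _ e → <-irrefl e (s≤s p)))) ch) (<-≤-trans lt le) n

    RK-rpass : ∀ {F r c w F₀ x y} → KI F r c → RChain F y c w → w ≤ F r c → RK F r c F₀ x → y < x
    RK-rpass i (last _ refl _ lt) le (nil _ refl) = <-≤-trans lt le
    RK-rpass i (link _ refl _ lt ch) le (down refl q n) = RN-rpass (RKI-down refl q i) ch (<-≤-trans lt le) n
    RK-rpass {c = suc c} i (link _ refl _ lt ch) le (stay p k) with RChain-head ch
    ... | q , refl = RK-rpass (RKI-stay i) ch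
          (col-mono (KI.inc i) c (s≤s⁻¹ (col-reflects (KI.inc i) c (<-≤-trans lt (≤-trans le p))))) k

  -- Complete insertions and their reversal.

  Corner : Filling → End → Set
  Corner F e = F (endRow e) (endCol e) < M × M ≤ F (endRow e) (suc (endCol e)) × M ≤ F (suc (endRow e)) (endCol e)

  Ins : Filling → ℕ → Filling → End → Set
  Ins F x F′ e = ∃ λ s → NI F s 0 x × N F s 0 x F′ e

  Ins⇒RStart : ∀ {F x F′ e} → Ins F x F′ e → RStart F′ e F x
  Ins⇒RStart (s , i , n) = N⇒R i (nil ≈-refl) n

  Ins-total : ∀ {F s x} → NI F s 0 x → ∃ λ F′ → ∃ λ e → N F s 0 x F′ e
  Ins-total {s = s} {x} i = N-total M s (m≤m+n M x) i

  -- Emptying a corner keeps the filling increasing because its right and lower neighbours carry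
  -- default values, which are one larger than the default value written.
  RNI-start : ∀ {F r c} → Inc F → Std F → Corner F (new r c) → RNI (upd F r c (M + (r + c))) r c (F r c)
  RNI-start {F} {r} {c} i s (p , q , t) = record
    { inc = upd-raise-Inc i (<-≤-trans p (m≤m+n M _))
        (subst (M + (r + c) <_) (sym (s r (suc c) q)) (+-monoʳ-< M (+-monoʳ-< r (n<1+n c))))
        (subst (M + (r + c) <_) (sym (s (suc r) c t)) (+-monoʳ-< M (n<1+n _)))
    ; std = upd-out-Std r c s
    ; z<M = p
    ; right = subst (F r c <_) (sym (upd-hit F r c _)) (<-≤-trans p (m≤m+n M _))
    ; left = λ { k refl → subst (_< F r c) (sym (upd-miss F r c _ r k (λ _ e → 1+n≢n (sym e)))) (row i r k) }
    }

  record Reversed (F : Filling) (e : End) : Set where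
    field
      F₀ : Filling
      x : ℕ
      retrace : RStart F e F₀ x
      ins : Ins F₀ x F e
      x≥1 : 1 ≤ x
      F≤F₀ : ∀ q k → F q k ≤ F₀ q k

  reverse-insert : ∀ {F} e → Inc F → Std F → (∀ r c → 1 ≤ F r c) → Corner F e → Reversed F e
  reverse-insert {F} (new r c) i s f k with RN-total c (RNI-start i s k)
  ... | F₀ , x , h = record
    { retrace = h
    ; ins = R⇒N (RNI-start i s k) (putE (Above-upd i r c _) (subst (M ≤_) (sym (upd-hit F r c _)) (m≤m+n M _)) (upd-undo F r c _ _ refl)) h
    ; x≥1 = RN-pos (λ q k → ≤-trans (f q k) (raise q k)) (f r c) h
    ; F≤F₀ = λ q k′ → ≤-trans (raise q k′) (RN-≥ (RNI-start i s k) h q k′)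
    }
    where
    raise : ∀ q k → F q k ≤ upd F r c (M + (r + c)) q k
    raise q k′ with updView F r c (M + (r + c)) q k′
    ... | hit refl refl e = subst (F r c ≤_) (sym e) (<⇒≤ (<-≤-trans (proj₁ k) (m≤m+n M _)))
    ... | miss _ e = ≤-reflexive (sym e)
  reverse-insert {F} (old r c) i s f (p , q , t) with RK-total c (record { inc = i ; std = s ; lt = p })
  ... | F₀ , x , h = record
    { retrace = h
    ; ins = RK⇒N (record { inc = i ; std = s ; lt = p }) (kend t ≤-refl p q ≈-refl) h
    ; x≥1 = RK-pos f h
    ; F≤F₀ = RK-≥ (record { inc = i ; std = s ; lt = p }) h
    }

  pieri : ∀ {F x F₁ e₁ y F₂ e₂} → Ins F x F₁ e₁ → Ins F₁ y F₂ e₂ → y < x → endCol e₁ < endCol e₂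
  pieri (_ , i , n) (_ , i′ , n′) lt = N-pass i′ (N-Chain i n) lt n′

  RStart-chain : ∀ {F} e {F₁ x} → Inc F → Std F → Corner F e → RStart F e F₁ x →
                 ∀ e′ → Corner F₁ e′ → endCol e′ < endCol e → ∃ λ w → RChain F₁ x (endCol e′) w
  RStart-chain (new r (suc c)) i s k n e′ k′ lt with RN-RChain (RNI-start i s k) n
  ... | _ , _ , ch = RChain-down (s≤s⁻¹ lt) ch
  RStart-chain {F} (old r c) {F₁} {x} i s k n e′ k′ lt = go c (record { inc = i ; std = s ; lt = proj₁ k }) n lt
    where
    go : ∀ c → KI F r c → RK F r c F₁ x → endCol e′ < c → ∃ λ w → RChain F₁ x (endCol e′) w
    go (suc c) i (down refl q n) lt with RN-RChain (RKI-down refl q i) n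
    ... | _ , _ , ch = RChain-down (s≤s⁻¹ lt) ch
    go (suc c) i (stay q n) lt with m≤n⇒m<n∨m≡n (s≤s⁻¹ lt)
    ... | inj₁ lt′ = go c (RKI-stay i) n lt′
    -- The chain has to reach column `c` itself, in row `r + 1`. Row `r` still has a box in column
    -- `c + 1`, so the corner `e′` of column `c` lies in a lower row and box `(r + 1 , c)` is
    -- inside.
    ... | inj₂ refl = _ , RK-RChain (RKI-stay i) (≤-<-trans (col-mono (KI.inc i) c below) (subst (_< M) (RK-local n _ c ≤-refl) (proj₁ k′))) n
      where
      below : suc r ≤ endRow e′
      below = col-reflects (KI.inc i) (suc c)
        (<-≤-trans (KI.lt i) (subst (M ≤_) (RK-local n _ (suc c) (n≤1+n c)) (proj₁ (proj₂ k′))))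

  -- The letter inserted second is removed first, and its reverse path leaves a chain that reaches
  -- the column of `e₁`. A corner is the bottom of its column, so the next reverse path sends out a
  -- letter at least as large as the chain entry there.
  reverse-pieri : ∀ {F₂} e₂ {F₁ y} e₁ {F₀ x} → Inc F₂ → Std F₂ → Corner F₂ e₂ → RStart F₂ e₂ F₁ y →
                  Inc F₁ → Std F₁ → Corner F₁ e₁ → RStart F₁ e₁ F₀ x → endCol e₁ < endCol e₂ → y < x
  reverse-pieri e₂ {F₁} {y} e₁ i₂ s₂ k₂ n₂ i₁ s₁ k₁ n₁ lt with RStart-chain e₂ i₂ s₂ k₂ n₂ e₁ k₁ lt
  ... | w , ch = go e₁ k₁ n₁ ch
    where
    bottom : ∀ e → Corner F₁ e → ∀ {w} → RChain F₁ y (endCol e) w → w ≤ F₁ (endRow e) (endCol e)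
    bottom e (_ , _ , b) ch with RChain-head ch
    ... | q , refl = col-mono i₁ (endCol e) (s≤s⁻¹ (col-reflects i₁ (endCol e) (<-≤-trans (RChain-<M ch) b)))
    go : ∀ e {F₀ x} → Corner F₁ e → RStart F₁ e F₀ x → ∀ {w} → RChain F₁ y (endCol e) w → y < x
    go e@(new r c) k n ch = RN-put-rpass (RNI-start i₁ s₁ k) ch (bottom e k ch) n
    go e@(old r c) k n ch = RK-rpass (record { inc = i₁ ; std = s₁ ; lt = proj₁ k }) ch (bottom e k ch) n

-- Crystal operators

T⇒≡true : ∀ {b} → T b → b ≡ true
T⇒≡true {true} _ = refl

¬T⇒≡false : ∀ {b} → ¬ T b → b ≡ false
¬T⇒≡false {false} _ = refl
¬T⇒≡false {true} h = ⊥-elim (h _)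

<ᵇ-true : ∀ {m n} → m < n → (m <ᵇ n) ≡ true
<ᵇ-true lt = T⇒≡true (<⇒<ᵇ lt)

<ᵇ-false : ∀ {m n} → n ≤ m → (m <ᵇ n) ≡ false
<ᵇ-false {m} {n} le = ¬T⇒≡false (λ h → <⇒≱ (<ᵇ⇒< m n h) le)

≤ᵇ-true : ∀ {m n} → m ≤ n → (m ≤ᵇ n) ≡ true
≤ᵇ-true le = T⇒≡true (≤⇒≤ᵇ le)

mem-setm : ∀ {n} k v (s : Subset n) → k < n → mem (suc k) (setm (suc k) v s) ≡ v
mem-setm zero v (_ ∷ s) lt = refl
mem-setm (suc k) v (_ ∷ s) lt = mem-setm k v s (s≤s⁻¹ lt)

mem-setm-≢ : ∀ {n} k l v (s : Subset n) → k ≢ l → mem (suc k) (setm (suc l) v s) ≡ mem (suc k) s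
mem-setm-≢ k l v [] ne = refl
mem-setm-≢ zero zero v (_ ∷ s) ne = ⊥-elim (ne refl)
mem-setm-≢ zero (suc l) v (_ ∷ s) ne = refl
mem-setm-≢ (suc k) zero v (_ ∷ s) ne = refl
mem-setm-≢ (suc k) (suc l) v (_ ∷ s) ne = mem-setm-≢ k l v s (λ e → ne (cong suc e))

-- The arguments tell whether `i` and `i + 1` belong to the subset. The only nontrivial string is
-- `{i}`, `{i , i+1}`, `{i+1}`, whence the values up to 2.
ε φ : Bool → Bool → ℕ
ε _ false = 0
ε true true = 1
ε false true = 2
φ false _ = 0
φ true true = 1
φ true false = 2

εS φS : ∀ {n} → ℕ → Subset n → ℕ
εS k s = ε (mem (suc k) s) (mem (suc (suc k)) s)
φS k s = φ (mem (suc k) s) (mem (suc (suc k)) s)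

φ≤2 : ∀ a b → φ a b ≤ 2
φ≤2 false _ = z≤n
φ≤2 true true = s≤s z≤n
φ≤2 true false = ≤-refl

module _ {n : ℕ} (k : ℕ) (k<n : suc k < n) where

  private
    i = suc k
    k≢1+k : k ≢ suc k
    k≢1+k e = 1+n≢n (sym e)

  ε₁≡εS : (s : Subset n) → ε₁ i s ≡ εS k s
  ε₁≡εS s with mem (suc (suc k)) s in eb
  ... | false = refl
  ... | true with mem (suc k) s in ea
  ...   | true rewrite mem-setm (suc k) false s k<n = refl
  ...   | false rewrite mem-setm-≢ (suc k) k true s (λ e → k≢1+k (sym e)) | eb | mem-setm k true s (<⇒≤ k<n)
                      | mem-setm (suc k) false (setm (suc k) true s) k<n = refl

  f₁-zero : (s : Subset n) → φS k s ≡ 0 → f₁ i s ≡ nothing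
  f₁-zero s h with mem (suc k) s | mem (suc (suc k)) s
  ... | false | _ = refl
  f₁-zero s () | true | true
  f₁-zero s () | true | false

  -- The last component serves the tensor rule: as `ε` does not drop under `f`, a further `f` acts
  -- on the same factor.
  f₁-suc : (s : Subset n) → ∀ {p} → φS k s ≡ suc p → ∃ λ s′ → f₁ i s ≡ just s′ × φS k s′ ≡ p × εS k s ≤ εS k s′
  f₁-suc s h with mem (suc k) s in ea | mem (suc (suc k)) s in eb
  f₁-suc s refl | true | true = _ , refl , lem , lem′
    where
    lem : φS k (setm (suc k) false s) ≡ 0
    lem rewrite mem-setm k false s (<⇒≤ k<n) = refl
    lem′ : 1 ≤ εS k (setm (suc k) false s)
    lem′ rewrite mem-setm k false s (<⇒≤ k<n) | mem-setm-≢ (suc k) k false s (λ e → k≢1+k (sym e)) | eb = s≤s z≤n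
  f₁-suc s refl | true | false = _ , refl , lem , z≤n
    where
    lem : φS k (setm (suc (suc k)) true s) ≡ 1
    lem rewrite mem-setm (suc k) true s k<n | mem-setm-≢ k (suc k) true s k≢1+k | ea = refl

  -- The tensor rule `φ(b ⊗ c) = φ(b) + max(0 , φ(c) - ε(b))`, with truncated subtraction for the
  -- maximum.
  φW : ∀ {m} → SVW n m → ℕ
  φW [] = 0
  φW (s ∷ c) = φS k s + (φW c ∸ εS k s)

  φW-bound : ∀ {m} (c : SVW n m) → φW c ≤ 2 * m
  φW-bound [] = z≤n
  φW-bound {suc m} (s ∷ c) = subst (φW (s ∷ c) ≤_) (sym (*-suc 2 m))
    (+-mono-≤ (φ≤2 (mem (suc k) s) _) (≤-trans (m∸n≤m (φW c) (εS k s)) (φW-bound c)))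

  iterCount-φ : ∀ {m} → (∀ (c : SVW n m) → φW c ≡ 0 → fSVW i c ≡ nothing) →
                (∀ (c : SVW n m) {p} → φW c ≡ suc p → ∃ λ c′ → fSVW i c ≡ just c′ × φW c′ ≡ p) →
                ∀ fuel (c : SVW n m) → φW c ≤ fuel → iterCount fuel (fSVW i) c ≡ φW c
  iterCount-φ z s zero c le = sym (n≤0⇒n≡0 le)
  iterCount-φ z s (suc fuel) c le with φW c in eq
  ... | zero rewrite z c eq = refl
  ... | suc p with s c eq
  ...   | c′ , e , refl rewrite e = cong suc (iterCount-φ z s fuel c′ (s≤s⁻¹ le))

  mutual
    -- By `φW-bound` the fuel is never exhausted. The mutual block is an induction on the number of
    -- factors, because `f` on `m + 1` factors consults `φ` on `m` of them.
    φT≡φW : ∀ {m} (c : SVW n m) → iterCount (suc (2 * m)) (fSVW i) c ≡ φW c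
    φT≡φW c = iterCount-φ f-zero f-suc _ c (m≤n⇒m≤1+n (φW-bound c))

    f-right : ∀ {m} s (c : SVW n m) → εS k s < φW c → fSVW i (s ∷ c) ≡ Maybe.map (s ∷_) (fSVW i c)
    f-right s c lt rewrite ε₁≡εS s | φT≡φW c | <ᵇ-true lt = refl

    f-left : ∀ {m} s (c : SVW n m) → φW c ≤ εS k s → fSVW i (s ∷ c) ≡ Maybe.map (_∷ c) (f₁ i s)
    f-left s c le rewrite ε₁≡εS s | φT≡φW c | <ᵇ-false le = refl

    f-zero : ∀ {m} (c : SVW n m) → φW c ≡ 0 → fSVW i c ≡ nothing
    f-zero [] h = refl
    f-zero (s ∷ c) h = trans (f-left s c (m∸n≡0⇒m≤n (m+n≡0⇒n≡0 (φS k s) h))) (cong (Maybe.map (_∷ c)) (f₁-zero s (m+n≡0⇒m≡0 _ h)))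

    f-suc : ∀ {m} (c : SVW n m) {p} → φW c ≡ suc p → ∃ λ c′ → fSVW i c ≡ just c′ × φW c′ ≡ p
    f-suc (s ∷ c) h with <-≤-connex (εS k s) (φW c)
    f-suc (s ∷ c) h | inj₁ lt with φW c in eq
    f-suc (s ∷ c) {p} h | inj₁ lt | suc q with f-suc c eq
    ... | c′ , e , refl = s ∷ c′ , trans (f-right s c (subst (εS k s <_) (sym eq) lt)) (cong (Maybe.map (s ∷_)) e) ,
      suc-injective (trans (sym (trans (cong (φS k s +_) (+-∸-assoc 1 (s≤s⁻¹ lt))) (+-suc (φS k s) _))) h)
    f-suc (s ∷ c) {p} h | inj₂ le with f₁-suc s (trans (sym (trans (cong (φS k s +_) (m≤n⇒m∸n≡0 le)) (+-identityʳ _))) h)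
    ... | s′ , e , e′ , le′ = s′ ∷ c , trans (f-left s c le) (cong (Maybe.map (_∷ c)) e) ,
      trans (cong₂ _+_ e′ (m≤n⇒m∸n≡0 (≤-trans le le′))) (+-identityʳ p)

  e-right : ∀ {m} s (c : SVW n m) → εS k s ≤ φW c → eSVW i (s ∷ c) ≡ Maybe.map (s ∷_) (eSVW i c)
  e-right s c le rewrite ε₁≡εS s | φT≡φW c | ≤ᵇ-true le = refl

-- β q t says whether row q (0-based, the element q + 1) contains the value t = m + 1 - j;
-- hence the head of the vector carries the value m.
Rows : Set
Rows = ℕ → ℕ → Bool

column : ∀ n → (ℕ → Bool) → Subset n
column zero g = []
column (suc n) g = g 0 ∷ column n (λ k → g (suc k))

word : ∀ n m → Rows → SVW n m
word n zero β = []
word n (suc m) β = column n (λ q → β q (suc m)) ∷ word n m β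

mem-column : ∀ n g k → k < n → mem (suc k) (column n g) ≡ g k
mem-column (suc n) g zero lt = refl
mem-column (suc n) g (suc k) lt = mem-column n (λ q → g (suc q)) k (s≤s⁻¹ lt)

column-cong : ∀ n {g h : ℕ → Bool} → (∀ k → k < n → g k ≡ h k) → column n g ≡ column n h
column-cong zero e = refl
column-cong (suc n) e = cong₂ _∷_ (e 0 (s≤s z≤n)) (column-cong n (λ k lt → e (suc k) (s≤s lt)))

setm-column : ∀ n g h k v → (∀ q → q ≢ k → h q ≡ g q) → h k ≡ v → setm (suc k) v (column n g) ≡ column n h
setm-column zero g h k v e p = refl
setm-column (suc n) g h zero v e p = cong₂ _∷_ (sym p) (column-cong n (λ k _ → sym (e (suc k) (λ ()))))
setm-column (suc n) g h (suc k) v e p =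
  cong₂ _∷_ (sym (e 0 (λ ()))) (setm-column n _ _ k v (λ q ne → e (suc q) (λ z → ne (suc-injective z))) p)

word-cong : ∀ n m {β γ} → (∀ q t → q < n → 1 ≤ t → t ≤ m → β q t ≡ γ q t) → word n m β ≡ word n m γ
word-cong n zero e = refl
word-cong n (suc m) e = cong₂ _∷_ (column-cong n (λ q lt → e q (suc m) lt (s≤s z≤n) ≤-refl))
                                  (word-cong n m (λ q t a b c → e q t a b (m≤n⇒m≤1+n c)))

-- For the operators with index k + 1, which act on rows k and k + 1 (0-based):
-- φR β t is φ of the tensor factors carrying the values 1, …, t.
module Pair (n k : ℕ) (k<n : suc k < n) where

  εR φ₁R : Rows → ℕ → ℕ
  εR β t = ε (β k t) (β (suc k) t)
  φ₁R β t = φ (β k t) (β (suc k) t)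

  φR : Rows → ℕ → ℕ
  φR β zero = 0
  φR β (suc t) = φ₁R β (suc t) + (φR β t ∸ εR β (suc t))

  εS-column : ∀ g → εS k (column n g) ≡ ε (g k) (g (suc k))
  εS-column g = cong₂ ε (mem-column n g k (<⇒≤ k<n)) (mem-column n g (suc k) k<n)

  φW-word : ∀ m β → φW k k<n (word n m β) ≡ φR β m
  φW-word zero β = refl
  φW-word (suc m) β = cong₂ _+_ (cong₂ φ (mem-column n _ k (<⇒≤ k<n)) (mem-column n _ (suc k) k<n))
    (cong₂ _∸_ (φW-word m β) (εS-column _))

  -- In the signature rule: beyond `s` all `ε` signs are cancelled by the counter of the smaller
  -- values, so no subtraction in `φR` is truncated there.
  Matched : Rows → ℕ → ℕ → Set
  Matched β s m = ∀ t → s ≤ t → t < m → εR β (suc t) ≤ φR β t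

  matched⇒e≡nothing : ∀ m β → Matched β 0 m → eSVW (suc k) (word n m β) ≡ nothing
  matched⇒e≡nothing zero β h = refl
  matched⇒e≡nothing (suc m) β h =
    trans (e-right k k<n (column n (λ q → β q (suc m))) (word n m β) (subst₂ _≤_ (sym (εS-column _)) (sym (φW-word m β)) (h m z≤n ≤-refl)))
          (cong (Maybe.map _) (matched⇒e≡nothing m β (λ t a b → h t a (m≤n⇒m≤1+n b))))

  φR-cong : ∀ β γ t → (∀ q s → s ≤ t → β q s ≡ γ q s) → φR β t ≡ φR γ t
  φR-cong β γ zero e = refl
  φR-cong β γ (suc t) e = cong₂ _+_ (cong₂ φ (e k (suc t) ≤-refl) (e (suc k) (suc t) ≤-refl))
    (cong₂ _∸_ (φR-cong β γ t (λ q s le → e q s (m≤n⇒m≤1+n le))) (cong₂ ε (e k (suc t) ≤-refl) (e (suc k) (suc t) ≤-refl)))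

  -- Matching makes the subtractions beyond `s` exact, so a surplus present at `s` is carried along
  -- unchanged.
  φR-raise : ∀ β γ d s m → (∀ q t → s < t → t ≤ m → β q t ≡ γ q t) → φR γ s ≡ d + φR β s → Matched β s m →
             ∀ t → s ≤ t → t ≤ m → φR γ t ≡ d + φR β t
  φR-raise β γ d s m e h μ t le b with m≤n⇒m<n∨m≡n le
  ... | inj₂ refl = h
  φR-raise β γ d s m e h μ (suc t) le b | inj₁ lt = begin
    φ₁R γ (suc t) + (φR γ t ∸ εR γ (suc t))
      ≡⟨ cong₂ _+_ (cong₂ φ (sym (e k (suc t) lt b)) (sym (e (suc k) (suc t) lt b)))
          (cong₂ _∸_ (φR-raise β γ d s m e h μ t (s≤s⁻¹ lt) (<⇒≤ b)) (cong₂ ε (sym (e k (suc t) lt b)) (sym (e (suc k) (suc t) lt b)))) ⟩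
    φ₁R β (suc t) + (d + φR β t ∸ εR β (suc t))
      ≡⟨ cong (φ₁R β (suc t) +_) (+-∸-assoc d (μ t (s≤s⁻¹ lt) b)) ⟩
    φ₁R β (suc t) + (d + (φR β t ∸ εR β (suc t)))
      ≡⟨ sym (+-assoc (φ₁R β (suc t)) d _) ⟩
    φ₁R β (suc t) + d + (φR β t ∸ εR β (suc t))
      ≡⟨ cong (_+ (φR β t ∸ εR β (suc t))) (+-comm (φ₁R β (suc t)) d) ⟩
    d + φ₁R β (suc t) + (φR β t ∸ εR β (suc t))
      ≡⟨ +-assoc d _ _ ⟩
    d + φR β (suc t) ∎
    where open ≡-Reasoning

  data Lowers (β γ : Rows) (t : ℕ) : Set where
    first : β k t ≡ true → β (suc k) t ≡ false → γ ≈ upd β (suc k) t true → Lowers β γ t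
    second : β k t ≡ true → β (suc k) t ≡ true → γ ≈ upd β k t false → Lowers β γ t

  Lowers-off : ∀ {β γ s} → Lowers β γ s → ∀ q t → t ≢ s → γ q t ≡ β q t
  Lowers-off (first _ _ e) q t ne = trans (e q t) (upd-miss _ _ _ _ q t (λ _ z → ne z))
  Lowers-off (second _ _ e) q t ne = trans (e q t) (upd-miss _ _ _ _ q t (λ _ z → ne z))

  f₁-column : ∀ {β γ s} → Lowers β γ s → f₁ (suc k) (column n (λ q → β q s)) ≡ just (column n (λ q → γ q s))
  f₁-column {β} {γ} {s} (first a b e)
    rewrite mem-column n (λ q → β q s) k (<⇒≤ k<n) | mem-column n (λ q → β q s) (suc k) k<n | a | b =
    cong just (setm-column n _ _ (suc k) true (λ q ne → trans (e q s) (upd-miss β (suc k) s true q s (λ z _ → ne z)))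
                (trans (e (suc k) s) (upd-hit β (suc k) s true)))
  f₁-column {β} {γ} {s} (second a b e)
    rewrite mem-column n (λ q → β q s) k (<⇒≤ k<n) | mem-column n (λ q → β q s) (suc k) k<n | a | b =
    cong just (setm-column n _ _ k false (λ q ne → trans (e q s) (upd-miss β k s false q s (λ z _ → ne z)))
                (trans (e k s) (upd-hit β k s false)))

  -- The strict inequalities let `f` pass every factor with a value above `s + 1`, and the opposite
  -- inequality stops it at `s + 1`.
  f-word : ∀ {β γ s} m → Lowers β γ (suc s) → s < m → φR β s ≤ εR β (suc s) →
           (∀ t → s < t → t < m → εR β (suc t) < φR β t) → fSVW (suc k) (word n m β) ≡ just (word n m γ)
  f-word {β} {γ} {s} (suc m) l lt h μ with m≤n⇒m<n∨m≡n (s≤s⁻¹ lt)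
  ... | inj₁ lt′ =
    trans (f-right k k<n (column n (λ q → β q (suc m))) (word n m β) (subst₂ _<_ (sym (εS-column _)) (sym (φW-word m β)) (μ m lt′ ≤-refl)))
      (trans (cong (Maybe.map _) (f-word m l lt′ h (λ t a b → μ t a (m≤n⇒m≤1+n b))))
        (cong (λ c → just (c ∷ word n m γ)) (column-cong n (λ q _ → sym (Lowers-off l q (suc m) (λ z → <-irrefl (sym (suc-injective z)) lt′))))))
  ... | inj₂ refl =
    trans (f-left k k<n (column n (λ q → β q (suc s))) (word n s β) (subst₂ _≤_ (sym (φW-word s β)) (sym (εS-column _)) h))
      (trans (cong (Maybe.map _) (f₁-column l))
        (cong (λ c → just (_ ∷ c)) (word-cong n s (λ q t _ _ b → sym (Lowers-off l q t (λ z → <-irrefl z (s≤s b)))))))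

  edge : ∀ {m β γ} → fSVW (suc k) (word n m β) ≡ just (word n m γ) → InComponent (word n m γ) (word n m β)
  edge h = Eq.symmetric _ (Eq.return (suc k , s≤s z≤n , k<n , h))

  -- The upper word γ has counter d + 1 above that of β beyond s, so f acts at s.
  f-at : ∀ m {β γ δ s d} → Lowers γ δ (suc s) → s < m → φR γ s ≤ εR γ (suc s) →
         (∀ q t → suc s < t → t ≤ m → β q t ≡ γ q t) → φR γ (suc s) ≡ suc d + φR β (suc s) →
         Matched β (suc s) m → InComponent (word n m δ) (word n m γ)
  f-at m {β} {γ} {δ} {s} {d} l lt h e r μ = edge (f-word m l lt h μ′)
    where
    μ′ : ∀ t → s < t → t < m → εR γ (suc t) < φR γ t
    μ′ t a b = subst₂ _<_ (cong₂ ε (e k (suc t) (s≤s a) b) (e (suc k) (suc t) (s≤s a) b))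
      (sym (φR-raise β γ (suc d) (suc s) m e r μ t a (<⇒≤ b))) (s≤s (≤-trans (μ t a b) (m≤n+m (φR β t) d)))

  φR-upd : ∀ β q s v → φR (upd β q (suc s) v) s ≡ φR β s
  φR-upd β q s v = φR-cong _ _ s (λ p t le → upd-miss β q (suc s) v p t (λ _ z → <-irrefl z (s≤s le)))

  upd-after : ∀ (β : Rows) q s v p t → s < t → β p t ≡ upd β q s v p t
  upd-after β q s v p t lt = sym (upd-miss β q s v p t (λ _ z → <-irrefl (sym z) lt))

  φR-suc : ∀ γ s {a b x} → γ k (suc s) ≡ a → γ (suc k) (suc s) ≡ b → φR γ s ≡ x → φR γ (suc s) ≡ φ a b + (x ∸ ε a b)
  φR-suc γ s refl refl refl = refl

  -- The value `s + 1` alone in row `k + 1` is the end of a string whose top has it alone in row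
  -- `k`. The counter of the smaller values is 0, so both operators of the string act on this
  -- factor.
  move-up : ∀ m β s → s < m → β k (suc s) ≡ false → β (suc k) (suc s) ≡ true → φR β s ≡ 0 → Matched β (suc s) m →
            InComponent (word n m β) (word n m (upd (upd β k (suc s) true) (suc k) (suc s) false))
  move-up m β s lt a b z μ = Eq.transitive _
      (f-at m {β} {mid} {β} {d = 0} (second midk midk′ (≈-sym (upd-undo β k (suc s) true false a))) lt
        (subst (_≤ εR mid (suc s)) (sym midz) z≤n) (λ q t l _ → upd-after β k (suc s) true q t l)
        (trans (φR-suc mid s midk midk′ midz) (cong suc (sym low))) μ)
      (f-at m {β} {top} {mid} {d = 1} (first topk topk′ (≈-sym (upd-undo mid (suc k) (suc s) false true midk′))) lt
        (subst (_≤ εR top (suc s)) (sym topz) z≤n)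
        (λ q t l _ → trans (upd-after β k (suc s) true q t l) (upd-after mid (suc k) (suc s) false q t l))
        (trans (φR-suc top s topk topk′ topz) (cong (2 +_) (sym low))) μ)
    where
    mid = upd β k (suc s) true
    top = upd mid (suc k) (suc s) false
    low : φR β (suc s) ≡ 0
    low = φR-suc β s a b z
    midk : mid k (suc s) ≡ true
    midk = upd-hit β k (suc s) true
    midk′ : mid (suc k) (suc s) ≡ true
    midk′ = trans (upd-miss β k (suc s) true (suc k) (suc s) (λ e _ → 1+n≢n e)) b
    midz : φR mid s ≡ 0
    midz = trans (φR-upd β k s true) z
    topk : top k (suc s) ≡ true
    topk = trans (upd-miss mid (suc k) (suc s) false k (suc s) (λ e _ → 1+n≢n (sym e))) midk
    topk′ : top (suc k) (suc s) ≡ false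
    topk′ = upd-hit mid (suc k) (suc s) false
    topz : φR top s ≡ 0
    topz = trans (φR-upd mid (suc k) s false) midz

  -- A single `e` takes the factor from `{i , i+1}` back to `{i}`.
  drop-below : ∀ m β s → s < m → β k (suc s) ≡ true → β (suc k) (suc s) ≡ true → φR β s ≡ 0 → Matched β (suc s) m →
               InComponent (word n m β) (word n m (upd β (suc k) (suc s) false))
  drop-below m β s lt a b z μ =
      f-at m {β} {top} {β} {d = 0} (first topk topk′ (≈-sym (upd-undo β (suc k) (suc s) false true b))) lt
        (subst (_≤ εR top (suc s)) (sym topz) z≤n) (λ q t l _ → upd-after β (suc k) (suc s) false q t l)
        (trans (φR-suc top s topk topk′ topz) (cong suc (sym (φR-suc β s a b z)))) μ
    where
    top = upd β (suc k) (suc s) false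
    topk : top k (suc s) ≡ true
    topk = trans (upd-miss β (suc k) (suc s) false k (suc s) (λ e _ → 1+n≢n (sym e))) a
    topk′ : top (suc k) (suc s) ≡ false
    topk′ = upd-hit β (suc k) (suc s) false
    topz : φR top s ≡ 0
    topz = trans (φR-upd β (suc k) s false) z

  -- One operator gives `t + 1` its copy in row `k`: the counter 1 before `t + 1` equals `ε` of
  -- `{i , i+1}`, which makes `f` act exactly there. Removing the lower copy of `s + 1` then raises
  -- the counters between `s` and `t` by 1, so that the second `f` passes `t + 1` and acts at
  -- `s + 1`.
  exchange : ∀ m β s t → s < t → t < m → β k (suc s) ≡ true → β (suc k) (suc s) ≡ true → φR β s ≡ 0 → Matched β (suc s) t →
             β k (suc t) ≡ false → β (suc k) (suc t) ≡ true → φR β t ≡ 1 → Matched β (suc t) m →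
             InComponent (word n m β) (word n m (upd (upd β k (suc t) true) (suc k) (suc s) false))
  exchange m β s t s<t t<m a b z μ c d o ν = Eq.transitive _
      (f-at m {β} {mid} {β} {d = 0} (second midk midk′ (≈-sym (upd-undo β k (suc t) true false c))) t<m
        (≤-reflexive (trans midt (sym (cong₂ ε midk midk′)))) (λ q r l _ → upd-after β k (suc t) true q r l)
        (trans (φR-suc mid t midk midk′ midt) (cong suc (sym low))) ν)
      (edge (f-word m (first tops tops′ (≈-sym (upd-undo mid (suc k) (suc s) false true mids′))) (<-trans s<t t<m)
        (subst (_≤ εR top (suc s)) (sym topz) z≤n) acts))
    where
    mid = upd β k (suc t) true
    top = upd mid (suc k) (suc s) false
    s≢t : suc s ≢ suc t
    s≢t e = <-irrefl (suc-injective e) s<t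
    low : φR β (suc t) ≡ 0
    low = φR-suc β t c d o
    midk : mid k (suc t) ≡ true
    midk = upd-hit β k (suc t) true
    midk′ : mid (suc k) (suc t) ≡ true
    midk′ = trans (upd-miss β k (suc t) true (suc k) (suc t) (λ e _ → 1+n≢n e)) d
    midt : φR mid t ≡ 1
    midt = trans (φR-upd β k t true) o
    mids : mid k (suc s) ≡ true
    mids = trans (upd-miss β k (suc t) true k (suc s) (λ _ → s≢t)) a
    mids′ : mid (suc k) (suc s) ≡ true
    mids′ = trans (upd-miss β k (suc t) true (suc k) (suc s) (λ _ → s≢t)) b
    tops : top k (suc s) ≡ true
    tops = trans (upd-miss mid (suc k) (suc s) false k (suc s) (λ e _ → 1+n≢n (sym e))) mids
    tops′ : top (suc k) (suc s) ≡ false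
    tops′ = upd-hit mid (suc k) (suc s) false
    topt : top k (suc t) ≡ true
    topt = trans (upd-miss mid (suc k) (suc s) false k (suc t) (λ _ e → s≢t (sym e))) midk
    topt′ : top (suc k) (suc t) ≡ true
    topt′ = trans (upd-miss mid (suc k) (suc s) false (suc k) (suc t) (λ _ e → s≢t (sym e))) midk′
    topz : φR top s ≡ 0
    topz = trans (φR-upd mid (suc k) s false)
      (trans (φR-cong mid β s (λ p r le → upd-miss β k (suc t) true p r (λ _ e → <-irrefl e (s≤s (≤-trans le (<⇒≤ s<t)))))) z)
    same : ∀ q r → suc s < r → r ≢ suc t → β q r ≡ top q r
    same q r l ne = trans (sym (upd-miss β k (suc t) true q r (λ _ → ne))) (upd-after mid (suc k) (suc s) false q r l)
    before : ∀ r → s < r → r ≤ t → φR top r ≡ 1 + φR β r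
    before r = φR-raise β top 1 (suc s) t (λ q r l h → same q r l (λ e → <-irrefl e (s≤s h)))
      (trans (φR-suc top s tops tops′ topz) (cong suc (sym (φR-suc β s a b z)))) μ r
    after : ∀ r → t < r → r ≤ m → φR top r ≡ 2 + φR β r
    after r = φR-raise β top 2 (suc t) m (λ q r l h → same q r (<-trans (s≤s s<t) l) (λ e → <-irrefl (sym e) l))
      (trans (φR-suc top t topt topt′ (trans (before t s<t ≤-refl) (cong suc o))) (cong (2 +_) (sym low))) ν r
    acts : ∀ r → s < r → r < m → εR top (suc r) < φR top r
    acts r l h with <-cmp r t
    ... | tri< p _ _ = subst₂ _<_ (cong₂ ε (same k (suc r) (s≤s l) (λ e → <-irrefl (suc-injective e) p))
                                           (same (suc k) (suc r) (s≤s l) (λ e → <-irrefl (suc-injective e) p)))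
                                  (sym (before r l (<⇒≤ p))) (s≤s (μ r l p))
    ... | tri≈ _ refl _ = subst₂ _<_ (sym (cong₂ ε topt topt′)) (sym (trans (before t s<t ≤-refl) (cong suc o))) ≤-refl
    ... | tri> _ _ p = subst₂ _<_ (cong₂ ε (same k (suc r) (s≤s l) (λ e → <-irrefl (sym (suc-injective e)) p))
                                           (same (suc k) (suc r) (s≤s l) (λ e → <-irrefl (sym (suc-injective e)) p)))
                                  (sym (after r p (<⇒≤ h))) (s≤s (m≤n⇒m≤1+n (ν r p h)))

-- Tableaux inside the crystal

Bool-ext : ∀ {a b} → (a ≡ true → b ≡ true) → (b ≡ true → a ≡ true) → a ≡ b
Bool-ext {true} f g = sym (f refl)
Bool-ext {false} {true} f g = g refl
Bool-ext {false} {false} f g = refl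

≡ᵇ-refl : ∀ n → (n ≡ᵇ n) ≡ true
≡ᵇ-refl n = T⇒≡true (≡⇒≡ᵇ n n refl)

≡ᵇ-false : ∀ {m n} → m ≢ n → (m ≡ᵇ n) ≡ false
≡ᵇ-false {m} {n} ne = ¬T⇒≡false (λ h → ne (≡ᵇ⇒≡ m n h))

≡ᵇ-true⇒≡ : ∀ {m n} → (m ≡ᵇ n) ≡ true → m ≡ n
≡ᵇ-true⇒≡ {m} {n} h = ≡ᵇ⇒≡ m n (subst T (sym h) _)

-- The number of entries ≤ t in row r.
count : Filling → ℕ → ℕ → ℕ
count F r zero = 0
count F r (suc t) = if F r (count F r t) ≡ᵇ suc t then suc (count F r t) else count F r t

entries : Filling → Rows
entries F r zero = false
entries F r (suc t) = F r (count F r t) ≡ᵇ suc t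

Positive : Filling → Set
Positive F = ∀ r c → 1 ≤ F r c

Before : Filling → ℕ → ℕ → ℕ → Set
Before F r c t = ∀ k → c ≡ suc k → F r k ≤ t

module _ {F : Filling} (i : Inc F) (pos : Positive F) where

  count-spec : ∀ r t → Before F r (count F r t) t × t < F r (count F r t)
  count-spec r zero = (λ _ ()) , pos r 0
  count-spec r (suc t) with count-spec r t | F r (count F r t) ≟ suc t
  ... | a , b | yes p rewrite p | ≡ᵇ-refl t =
    (λ { k refl → ≤-reflexive p }) , subst (_< F r (suc (count F r t))) p (row i r _)
  ... | a , b | no p rewrite ≡ᵇ-false p = (λ k e → m≤n⇒m≤1+n (a k e)) , ≤∧≢⇒< b (λ e → p (sym e))

  count-unique : ∀ r c t → Before F r c t → t < F r c → count F r t ≡ c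
  count-unique r c t a b with count-spec r t
  ... | a′ , b′ = ≤-antisym (le (count F r t) c a′ b) (le c (count F r t) a b′)
    where
    le : ∀ c d → Before F r c t → t < F r d → c ≤ d
    le zero d _ _ = z≤n
    le (suc c) d h l = row-reflects i r (≤-<-trans (h c refl) l)

  entries⁻ : ∀ r t → entries F r t ≡ true → ∃ λ c → F r c ≡ t
  entries⁻ r (suc t) h = _ , ≡ᵇ-true⇒≡ h

  count-entry : ∀ r c t → F r c ≡ suc t → count F r t ≡ c
  count-entry r c t e = count-unique r c t (λ { k refl → s≤s⁻¹ (subst (F r k <_) e (row i r k)) }) (≤-reflexive (sym e))

  entries⁺ : ∀ r c → entries F r (F r c) ≡ true
  entries⁺ r c with F r c in e | pos r c
  ... | suc t | _ rewrite count-entry r c t e | e = ≡ᵇ-refl t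

  entries-gap : ∀ r c t → (∀ k → c ≡ suc k → F r k < t) → t < F r c → entries F r t ≡ false
  entries-gap r c zero a b = refl
  entries-gap r c (suc t) a b
    rewrite count-unique r c t (λ k e → s≤s⁻¹ (a k e)) (<-trans (n<1+n t) b) = ≡ᵇ-false (λ e → <-irrefl (sym e) b)

  count-le : ∀ r t → count F (suc r) t ≤ count F r t
  count-le r t with count F (suc r) t | count-spec (suc r) t | count-spec r t
  ... | zero | _ | _ = z≤n
  ... | suc c | a , _ | _ , b = row-reflects i r (<-≤-trans (col i r c) (≤-trans (a c refl) (<⇒≤ b)))

  -- The box above the entry `t + 1` holds an entry at most `t`, so row `r` is strictly ahead.
  count-ballot : ∀ r t → entries F (suc r) (suc t) ≡ true → count F (suc r) t < count F r t
  count-ballot r t h = row-reflects i r (<-≤-trans (col i r _)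
    (≤-trans (≤-reflexive (≡ᵇ-true⇒≡ h)) (proj₂ (count-spec r t))))

-- excess F r t is half the counter φ of rows r and r + 1 after the values 1, …, t.
excess : Filling → ℕ → ℕ → ℕ
excess F r t = count F r t ∸ count F (suc r) t

excess-entry : ∀ F r t → entries F r (suc t) ≡ true → entries F (suc r) (suc t) ≡ false →
               count F (suc r) t ≤ count F r t → excess F r (suc t) ≡ suc (excess F r t)
excess-entry F r t a b le rewrite a | b = +-∸-assoc 1 le

excess-none : ∀ F r t → entries F r (suc t) ≡ false → entries F (suc r) (suc t) ≡ false → excess F r (suc t) ≡ excess F r t
excess-none F r t a b rewrite a | b = refl

excess-both : ∀ F r t → entries F r (suc t) ≡ true → entries F (suc r) (suc t) ≡ true → excess F r (suc t) ≡ excess F r t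
excess-both F r t a b rewrite a | b = refl

excess-below : ∀ F r t → entries F r (suc t) ≡ false → entries F (suc r) (suc t) ≡ true → excess F r (suc t) ≡ excess F r t ∸ 1
excess-below F r t a b rewrite a | b = trans (cong (count F r t ∸_) (+-comm 1 (count F (suc r) t))) (sym (∸-+-assoc (count F r t) (count F (suc r) t) 1))

∸-step : ∀ d δ x e f g → x + δ ≡ d → e ≤ x → f + d ≡ g + e → f + (x ∸ e) + δ ≡ g
∸-step d δ x e f g refl le h = +-cancelʳ-≡ e _ _ (begin
  f + (x ∸ e) + δ + e   ≡⟨ +-assoc (f + (x ∸ e)) δ e ⟩
  f + (x ∸ e) + (δ + e) ≡⟨ cong (f + (x ∸ e) +_) (+-comm δ e) ⟩
  f + (x ∸ e) + (e + δ) ≡⟨ sym (+-assoc (f + (x ∸ e)) e δ) ⟩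
  f + (x ∸ e) + e + δ   ≡⟨ cong (_+ δ) (+-assoc f (x ∸ e) e) ⟩
  f + (x ∸ e + e) + δ   ≡⟨ cong (λ z → f + z + δ) (m∸n+n≡m le) ⟩
  f + x + δ             ≡⟨ +-assoc f x δ ⟩
  f + (x + δ)           ≡⟨ h ⟩
  g + e ∎)
  where open ≡-Reasoning

-- Counters of increasing fillings.

module Ballot {F : Filling} (i : Inc F) (pos : Positive F) (n r : ℕ) (r<n : suc r < n) where

  open Pair n r r<n

  -- `δ` is the defect of the counter `x` against twice the excess. A value in row `r` alone gains
  -- 2, in row `r + 1` alone costs 2, and in both costs and regains 1. The ballot condition pays for
  -- the last case; only the cost of 2 needs the excess to be larger than `δ`.
  step-counter : ∀ t {a b} δ x → δ ≤ 1 → entries F r (suc t) ≡ a → entries F (suc r) (suc t) ≡ b → x + δ ≡ 2 * excess F r t →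
                 (a ≡ false → b ≡ true → δ < excess F r t) →
                 ε a b ≤ x × φ a b + (x ∸ ε a b) + δ ≡ 2 * excess F r (suc t)
  step-counter t {false} {false} δ x _ ea eb h k rewrite excess-none F r t ea eb = z≤n , h
  step-counter t {true} {false} δ x _ ea eb h k rewrite excess-entry F r t ea eb (count-le i pos r t) =
    z≤n , trans (cong (2 +_) h) (sym (*-suc 2 _))
  step-counter t {true} {true} δ x δ≤1 ea eb h k rewrite excess-both F r t ea eb = le , ∸-step _ δ x 1 1 _ h le (+-comm 1 _)
    where
    le : 1 ≤ x
    le = +-cancelʳ-≤ δ 1 x (≤-trans (s≤s δ≤1) (subst (2 ≤_) (sym h) (*-monoʳ-≤ 2 (m<n⇒0<n∸m (count-ballot i pos r t eb)))))
  step-counter t {false} {true} δ x δ≤1 ea eb h k rewrite excess-below F r t ea eb = le , ∸-step _ δ x 2 0 _ h le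
      (trans (cong (2 *_) (sym (m∸n+n≡m 1≤d))) (*-distribˡ-+ 2 (excess F r t ∸ 1) 1))
    where
    1≤d : 1 ≤ excess F r t
    1≤d = ≤-trans (s≤s z≤n) (k refl refl)
    le : 2 ≤ x
    le = +-cancelʳ-≤ δ 2 x (subst (2 + δ ≤_) (sym h)
      (≤-trans (+-monoʳ-≤ 2 (m≤m+n δ (δ + 0))) (subst (_≤ 2 * excess F r t) (*-suc 2 δ) (*-monoʳ-≤ 2 (k refl refl)))))

  -- With an odd counter (δ = 1) one more entry of row r is needed to match an entry of row r + 1.
  suffix : ∀ {β} δ s m → δ ≤ 1 → (∀ t → s < t → t ≤ m → β r t ≡ entries F r t × β (suc r) t ≡ entries F (suc r) t) →
           φR β s + δ ≡ 2 * excess F r s →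
           (∀ t → s ≤ t → t < m → entries F r (suc t) ≡ false → entries F (suc r) (suc t) ≡ true → δ < excess F r t) →
           Matched β s m × (∀ t → s ≤ t → t ≤ m → φR β t + δ ≡ 2 * excess F r t)
  suffix {β} δ s m δ≤1 same h k = (λ t a b → proj₁ (next t a b)) , counter
    where
    next : ∀ t → s ≤ t → t < m → εR β (suc t) ≤ φR β t × φR β (suc t) + δ ≡ 2 * excess F r (suc t)
    counter : ∀ t → s ≤ t → t ≤ m → φR β t + δ ≡ 2 * excess F r t
    next t a b with same (suc t) (s≤s a) b
    ... | e , e′ = step-counter t δ (φR β t) δ≤1 (sym e) (sym e′) (counter t a (<⇒≤ b))
      (λ p q → k t a b (trans (sym e) p) (trans (sym e′) q))
    counter t a b with m≤n⇒m<n∨m≡n a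
    ... | inj₂ refl = h
    counter (suc t) a b | inj₁ lt = proj₂ (next t (s≤s⁻¹ lt) b)

  matched : ∀ {β} s m → (∀ t → s < t → t ≤ m → β r t ≡ entries F r t × β (suc r) t ≡ entries F (suc r) t) →
            φR β s ≡ 2 * excess F r s → Matched β s m
  matched s m same h = proj₁ (suffix 0 s m z≤n same (trans (+-identityʳ _) h)
    (λ t _ _ _ eb → m<n⇒0<n∸m (count-ballot i pos r t eb)))

  mono-step : ∀ a b x y → x ≤ y → φ a true + (x ∸ ε a true) ≤ φ a b + (y ∸ ε a b)
  mono-step a true x y le = +-monoʳ-≤ (φ a true) (∸-monoˡ-≤ (ε a true) le)
  mono-step false false x y le = ≤-trans (m∸n≤m x 2) le
  mono-step true false x y le = s≤s (≤-trans (m∸n≤m x 1) (m≤n⇒m≤1+n le))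

  -- Unread letters in row `r + 1` may be unmatched, so the counter has no exact value here; but
  -- further entries in that row only lower it. Where the excess is 0 the bound still forces the
  -- counter to be 0.
  prefix : ∀ {β} s → (∀ t → t ≤ s → β r t ≡ entries F r t) → (∀ t → t ≤ s → entries F (suc r) t ≡ true → β (suc r) t ≡ true) →
           φR β s ≤ 2 * excess F r s
  prefix zero same more = z≤n
  prefix {β} (suc s) same more = ≤-trans bound (≤-reflexive
      (trans (sym (+-identityʳ _)) (proj₂ (step-counter s 0 (2 * excess F r s) z≤n refl refl (+-identityʳ _)
        (λ _ eb → m<n⇒0<n∸m (count-ballot i pos r s eb))))))
    where
    IH = prefix {β} s (λ t le → same t (m≤n⇒m≤1+n le)) (λ t le → more t (m≤n⇒m≤1+n le))
    bound : φR β (suc s) ≤ φ (entries F r (suc s)) (entries F (suc r) (suc s)) +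
                           (2 * excess F r s ∸ ε (entries F r (suc s)) (entries F (suc r) (suc s)))
    bound rewrite same (suc s) ≤-refl with β (suc r) (suc s) | more (suc s) ≤-refl
    ... | true | _ = mono-step (entries F r (suc s)) _ _ _ IH
    ... | false | f with entries F (suc r) (suc s)
    ...   | true with f refl
    ...     | ()
    bound | false | f | false = +-monoʳ-≤ (φ (entries F r (suc s)) false) IH

-- The crystal elements met along an insertion path.

infixl 6 _∪_
_∪_ : Filling → Rows → Rows
(F ∪ R) q t = entries F q t ∨ R q t

entries-upd : ∀ {F r c x} → Inc F → Positive F → Inc (upd F r c x) → Positive (upd F r c x) →
              ∀ q t → (q ≡ r → t ≢ x × t ≢ F r c) → entries (upd F r c x) q t ≡ entries F q t
entries-upd {F} {r} {c} {x} i pos i′ pos′ q t ne = Bool-ext fwd bwd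
  where
  fwd : entries (upd F r c x) q t ≡ true → entries F q t ≡ true
  fwd h with entries⁻ i′ pos′ q t h
  ... | k , e with updView F r c x q k
  ...   | hit p _ e′ = ⊥-elim (proj₁ (ne p) (trans (sym e) e′))
  ...   | miss _ e′ rewrite sym e | e′ = entries⁺ i pos q k
  bwd : entries F q t ≡ true → entries (upd F r c x) q t ≡ true
  bwd h with entries⁻ i pos q t h
  ... | k , e with updView F r c x q k
  ...   | hit refl refl _ = ⊥-elim (proj₂ (ne refl) (sym e))
  ...   | miss _ e′ = subst (λ z → entries (upd F r c x) q z ≡ true) (trans e′ e) (entries⁺ i′ pos′ q k)

count-cong : ∀ {F G} → F ≈ G → ∀ r t → count F r t ≡ count G r t
count-cong e r zero = refl
count-cong {F} {G} e r (suc t) rewrite count-cong e r t | e r (count G r t) = refl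

entries-cong : ∀ {F G} → F ≈ G → ∀ r t → entries F r t ≡ entries G r t
entries-cong e r zero = refl
entries-cong {F} {G} e r (suc t) rewrite count-cong e r t | e r (count G r t) = refl

upd-Positive : ∀ {F r c x} → 1 ≤ x → Positive F → Positive (upd F r c x)
upd-Positive {F} {r} {c} {x} p pos q k with updView F r c x q k
... | hit _ _ e = subst (1 ≤_) (sym e) p
... | miss _ e = subst (1 ≤_) (sym e) (pos q k)

upd-move : ∀ (β : Rows) r r′ x y → β r′ y ≡ false → (r′ ≢ r) →
           upd (upd (upd β r′ y true) r x true) r′ y false ≈ upd β r x true
upd-move β r r′ x y e ne q t with updView (upd (upd β r′ y true) r x true) r′ y false q t
... | hit refl refl h = trans h (sym (trans (upd-miss β r x true q t (λ z _ → ne z)) e))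
... | miss h h′ with updView (upd β r′ y true) r x true q t | updView β r x true q t
...   | hit _ _ a | hit _ _ b = trans h′ (trans a (sym b))
...   | hit a b _ | miss c _ = ⊥-elim (c a b)
...   | miss c _ | hit a b _ = ⊥-elim (c a b)
...   | miss _ a | miss _ b = trans h′ (trans a (trans (upd-miss β r′ y true q t h) (sym b)))

-- The letter `x₀` comes from row `s`. As rows are read from the top and each row in decreasing
-- order, the unread letters `R` avoid the rows above `s` and are smaller than `x₀` in row `s`.
module Connected (n m s x₀ : ℕ) (s<n : s < n) (1≤x₀ : 1 ≤ x₀) (R : Rows)
                 (R-above : ∀ q t → q < s → R q t ≡ false) (R-below : ∀ t → x₀ ≤ t → R s t ≡ false) where

  open Paths (suc m)

  R-false : ∀ q t → q ≤ s → x₀ ≤ t → R q t ≡ false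
  R-false q t le l with m≤n⇒m<n∨m≡n le
  ... | inj₁ lt = R-above q t lt
  ... | inj₂ refl = R-below t l

  ∪-false : ∀ {F} q t → q ≤ s → x₀ ≤ t → (F ∪ R) q t ≡ entries F q t
  ∪-false {F} q t le l rewrite R-false q t le l with entries F q t
  ... | true = refl
  ... | false = refl

  ∪-above : ∀ {F} q t → q < s → (F ∪ R) q t ≡ entries F q t
  ∪-above {F} q t lt rewrite R-above q t lt with entries F q t
  ... | true = refl
  ... | false = refl

  ∪-true : ∀ {F} q t → entries F q t ≡ true → (F ∪ R) q t ≡ true
  ∪-true q t e rewrite e = refl

  -- The element of the crystal met while the letter x travels in row r of F and the
  -- letters R are still to be inserted.
  state : Filling → ℕ → ℕ → Rows
  state F r x = upd (F ∪ R) r x true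

  excess-counts : ∀ F r t {a b} → count F r t ≡ a → count F (suc r) t ≡ b → excess F r t ≡ a ∸ b
  excess-counts F r t = cong₂ _∸_

  state-upper : ∀ F r x q → r < s → state F (suc r) x r q ≡ entries F r q
  state-upper F r x q lt = trans (upd-miss (F ∪ R) (suc r) x true r q (λ e _ → 1+n≢n (sym e))) (∪-above r q lt)

  state-beyond : ∀ F r x q → r ≤ s → x₀ ≤ x → x < q → state F r x r q ≡ entries F r q
  state-beyond F r x q le l lt =
    trans (upd-miss (F ∪ R) r x true r q (λ _ e → <-irrefl (sym e) lt)) (∪-false r q le (≤-trans l (<⇒≤ lt)))

  state-more : ∀ F r x q → entries F r q ≡ true → state F r x r q ≡ true
  state-more F r x q e with updView (F ∪ R) r x true r q
  ... | hit _ _ h = h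
  ... | miss _ h = trans h (∪-true r q e)

  _~_ : Rows → Rows → Set
  β ~ γ = InComponent (word n m β) (word n m γ)

  ~-≈ : ∀ {β γ δ} → β ~ γ → γ ≈ δ → β ~ δ
  ~-≈ h e = subst (InComponent _) (word-cong n m (λ q t _ _ _ → e q t)) h

  -- In `F` both rows have exactly `c` entries below `x` and none equal to `x`, so the excess is 0
  -- just before and just after `x`. This is the situation of `move-up`.
  up-step : ∀ {F r c x} → Positive F → NI F (suc r) c x → suc r ≤ s → x₀ ≤ x → x < F r c → state F (suc r) x ~ state F r x
  up-step {F} {r} {c} {zero} pos i le l lt = ⊥-elim (<⇒≱ 1≤x₀ l)
  up-step {F} {r} {c} {suc t} pos i le l lt =
    ~-≈ (move-up m β t (s≤s⁻¹ (NI.x<M i)) upper (upd-hit _ (suc r) (suc t) true) z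
          (matched (suc t) m (λ q p _ → state-upper F r _ q le , state-beyond F (suc r) _ q le l p)
            (trans (φR-suc β t upper (upd-hit _ (suc r) (suc t) true) z) (sym (cong (2 *_) balance′)))))
        (upd-move (F ∪ R) r (suc r) (suc t) (suc t)
          (trans (∪-false {F} (suc r) (suc t) le l) (entries-gap inc′ pos (suc r) c (suc t) (NI.left i) (NI.lt i))) (λ e → 1+n≢n e))
    where
    inc′ = NI.inc i
    open Pair n r (≤-<-trans le s<n)
    open Ballot inc′ pos n r (≤-<-trans le s<n)
    β = state F (suc r) (suc t)
    upper : β r (suc t) ≡ false
    upper = trans (state-upper F r _ (suc t) le) (entries-gap inc′ pos r c (suc t) (Left-up inc′ r c (NI.left i)) lt)
    balance : excess F r t ≡ 0
    balance = trans (excess-counts F r t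
      (count-unique inc′ pos r c t (λ k e → s≤s⁻¹ (Left-up inc′ r c (NI.left i) k e)) (<-trans (n<1+n t) lt))
      (count-unique inc′ pos (suc r) c t (λ k e → s≤s⁻¹ (NI.left i k e)) (<-trans (n<1+n t) (NI.lt i)))) (n∸n≡0 c)
    balance′ : excess F r (suc t) ≡ 0
    balance′ = trans (excess-counts F r (suc t)
      (count-unique inc′ pos r c (suc t) (λ k e → <⇒≤ (Left-up inc′ r c (NI.left i) k e)) lt)
      (count-unique inc′ pos (suc r) c (suc t) (λ k e → <⇒≤ (NI.left i k e)) (NI.lt i))) (n∸n≡0 c)
    z : φR β t ≡ 0
    z = n≤0⇒n≡0 (subst (λ d → φR β t ≤ 2 * d) balance
      (prefix t (λ q _ → state-upper F r _ q le) (λ q _ → state-more F (suc r) _ q)))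

  put-step : ∀ {F r c x} → Positive F → 1 ≤ x → Inc F → Inc (upd F r c x) → ∀ q t →
             state F r x q t ≡ state (upd F r c x) r (F r c) q t
  put-step {F} {r} {c} {x} pos p i i′ q t
    with updView (F ∪ R) r x true q t | updView (upd F r c x ∪ R) r (F r c) true q t
  ... | hit _ _ a | hit _ _ b = trans a (sym b)
  ... | hit refl refl a | miss _ b =
    trans a (sym (trans b (∪-true r x (subst (λ z → entries (upd F r c x) r z ≡ true) (upd-hit F r c x) (entries⁺ i′ (upd-Positive p pos) r c)))))
  ... | miss _ a | hit refl refl b = trans a (trans (∪-true r (F r c) (entries⁺ i pos r c)) (sym b))
  ... | miss a a′ | miss b b′ =
    trans a′ (sym (trans b′ (cong (_∨ R q t) (entries-upd i pos i′ (upd-Positive p pos) q t (λ e → a e , b e)))))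

  -- The displaced default value lies beyond `m`, where there is no tensor factor.
  put-end : ∀ {F r c x F′} → Positive F → 1 ≤ x → Inc F → Inc (upd F r c x) → suc m ≤ F r c → upd F r c x ≈ F′ →
            ∀ q t → t ≤ m → state F r x q t ≡ (F′ ∪ R) q t
  put-end {F} {r} {c} {x} pos p i i′ le e q t b =
    trans (put-step pos p i i′ q t) (trans (upd-miss _ r (F r c) true q t (λ _ z → <⇒≱ le (subst (_≤ m) z b)))
      (cong (_∨ R q t) (entries-cong e q t)))

  -- A letter F r c₀ that was blocked below its own copy remains an extra entry of row
  -- r + 1 until the bumped letter leaves that row (exchange) or stops there (drop-below).
  record Held (F : Filling) (r c c₀ : ℕ) : Set where
    field
      c₀≤c : c₀ ≤ c
      x₀≤ : x₀ ≤ F r c₀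
      left : Left F (suc r) c₀ (F r c₀)
      run : ∀ k → c₀ ≤ k → k < c → F r (suc k) ≤ F (suc r) k

  module Hold {F r c c₀} (pos : Positive F) (i : KI F r c) (le : suc r ≤ s) (h : Held F r c c₀) (t : ℕ) (eq : F r c₀ ≡ suc t) where
    open Held h
    inc′ = KI.inc i
    open Pair n r (≤-<-trans le s<n) public
    open Ballot inc′ pos n r (≤-<-trans le s<n) public
    β = state F (suc r) (suc t)
    x₀≤t = subst (x₀ ≤_) eq x₀≤
    left′ = subst (Left F (suc r) c₀) eq left
    right′ : suc t < F (suc r) c₀
    right′ = subst (_< F (suc r) c₀) eq (col inc′ r c₀)
    t<m : t < m
    t<m = s≤s⁻¹ (subst (_< suc m) eq (≤-<-trans (row-mono inc′ r c₀≤c) (KI.lt i)))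
    upper : β r (suc t) ≡ true
    upper = trans (state-upper F r _ (suc t) le) (subst (λ z → entries F r z ≡ true) eq (entries⁺ inc′ pos r c₀))
    lower : β (suc r) (suc t) ≡ true
    lower = upd-hit _ (suc r) (suc t) true
    vacant : (F ∪ R) (suc r) (suc t) ≡ false
    vacant = trans (∪-false {F} (suc r) (suc t) le x₀≤t) (entries-gap inc′ pos (suc r) c₀ (suc t) left′ right′)
    balance : excess F r t ≡ 0
    balance = trans (excess-counts F r t (count-entry inc′ pos r c₀ t eq)
      (count-unique inc′ pos (suc r) c₀ t (λ k e → s≤s⁻¹ (left′ k e)) (<-trans (n<1+n t) right′))) (n∸n≡0 c₀)
    balance′ : excess F r (suc t) ≡ 1
    balance′ = trans (excess-counts F r (suc t)
      (count-unique inc′ pos r (suc c₀) (suc t) (λ { k refl → ≤-reflexive eq }) (subst (_< F r (suc c₀)) eq (row inc′ r c₀)))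
      (count-unique inc′ pos (suc r) c₀ (suc t) (λ k e → <⇒≤ (left′ k e)) right′)) (trans (+-∸-assoc 1 (≤-refl {c₀})) (cong suc (n∸n≡0 c₀)))
    z : φR β t ≡ 0
    z = n≤0⇒n≡0 (subst (λ d → φR β t ≤ 2 * d) balance
      (prefix t (λ q _ → state-upper F r _ q le) (λ q _ → state-more F (suc r) _ q)))
    same : ∀ q → suc t < q → β r q ≡ entries F r q × β (suc r) q ≡ entries F (suc r) q
    same q p = state-upper F r _ q le , state-beyond F (suc r) _ q le x₀≤t p
    -- If `q + 1` is entry number `k` of row `r + 1`, then `run` bounds entry `k + 1` of row `r` by
    -- `q + 1`, and equality is excluded. So row `r` has at least two more entries up to `q` than
    -- row `r + 1`, enough for an odd counter.
    run-excess : ∀ q → suc t ≤ q → suc q < F (suc r) c → entries F r (suc q) ≡ false → entries F (suc r) (suc q) ≡ true →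
                 1 < excess F r q
    run-excess q a b ea eb = m+n≤o⇒m≤o∸n 2 (row-reflects inc′ r (≤-<-trans below (proj₂ (count-spec inc′ pos r q))))
      where
      k = count F (suc r) q
      attained : F (suc r) k ≡ suc q
      attained = ≡ᵇ-true⇒≡ eb
      k<c : k < c
      k<c = row-reflects inc′ (suc r) (subst (_< F (suc r) c) (sym attained) b)
      c₀≤k : c₀ ≤ k
      c₀≤k = ≮⇒≥ (λ lt → ≤⇒≯ (low c₀ refl lt) (≤-<-trans a ≤-refl))
        where
        low : ∀ d → c₀ ≡ d → k < d → suc q ≤ suc t
        low (suc d) e lt = ≤-trans (≤-reflexive (sym attained)) (≤-trans (row-mono inc′ (suc r) (s≤s⁻¹ lt)) (<⇒≤ (left′ d e)))
      below : F r (suc k) ≤ q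
      below = s≤s⁻¹ (≤∧≢⇒< (subst (F r (suc k) ≤_) attained (run k c₀≤k k<c)) ne)
        where
        ne : F r (suc k) ≢ suc q
        ne e with trans (sym ea) (subst (λ v → entries F r v ≡ true) e (entries⁺ inc′ pos r (suc k)))
        ... | ()
    -- The held letter gives a factor `{i , i+1}`, hence the counter 1 where the tableau alone would
    -- give 2.
    odd : ∀ T → T ≤ m → T < F (suc r) c → Matched β (suc t) T × (∀ q → suc t ≤ q → q ≤ T → φR β q + 1 ≡ 2 * excess F r q)
    odd T T≤m b = suffix 1 (suc t) T ≤-refl (λ q p _ → same q p)
      (trans (cong (_+ 1) (φR-suc β t upper lower z)) (sym (cong (2 *_) balance′)))
      (λ q p p′ → run-excess q p (≤-<-trans p′ b))

  mutual
    N-connected : ∀ {F r c x F′ e} → Positive F → NI F r c x → r ≤ s → x₀ ≤ x → N F r c x F′ e → state F r x ~ (F′ ∪ R)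
    N-connected pos i le l (up p h) =
      Eq.transitive _ (up-step pos i le l p) (N-connected pos (NI-up p i) (<⇒≤ le) l h)
    N-connected {F} {r} {c} {x} pos i le l (put a refl p h) =
      subst (λ w → InComponent w _) (word-cong n m (λ q t _ _ _ → sym (put-step pos 1≤x (NI.inc i) (NI.inc i′) q t)))
        (N-connected (upd-Positive 1≤x pos) i′ le (≤-trans l (<⇒≤ (NI.lt i))) h)
      where
      1≤x = ≤-trans 1≤x₀ l
      i′ = NI-put a refl p i
    N-connected {F} {r} {c} {x} pos i le l (putE a p e) =
      subst (InComponent _) (word-cong n m (λ q t _ _ b → put-end pos (≤-trans 1≤x₀ l) (NI.inc i)
        (upd-lower-Inc (NI.inc i) (NI.lt i) (NI.left i) a) p e q t b)) (Eq.reflexive _)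
    N-connected {F} {suc r} {c} pos i le l (blk refl h) =
      K-connected pos (NI-blk refl i) le
        (record { c₀≤c = ≤-refl ; x₀≤ = l ; left = NI.left i ; run = λ k a b → ⊥-elim (<⇒≱ b a) }) h

    K-connected : ∀ {F r c c₀ F′ e} → Positive F → KI F r c → suc r ≤ s → Held F r c c₀ → K F r c F′ e →
                  state F (suc r) (F r c₀) ~ (F′ ∪ R)
    K-connected {c = c} pos i le h (kstay p q k) = K-connected pos (KI-stay p q i) le
      (record { Held h ; c₀≤c = m≤n⇒m≤1+n (Held.c₀≤c h) ; run = run′ }) k
      where
      run′ : ∀ j → _ → j < suc c → _
      run′ j a b with m≤n⇒m<n∨m≡n (s≤s⁻¹ b)
      ... | inj₁ lt = Held.run h j a lt
      ... | inj₂ refl = q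
    K-connected {F} {r} {c} {c₀} pos i le h (kend p _ _ _ e) with F r c₀ in eq | pos r c₀
    ... | suc t | _ =
      ~-≈ (drop-below m β t t<m upper lower z (proj₁ (odd m ≤-refl p)))
          (≈-trans (upd-undo (F ∪ R) (suc r) (suc t) true false vacant) (λ q u → cong (_∨ R q u) (entries-cong e q u)))
      where open Hold pos i le h t eq
    K-connected pos i le h (kup {y = zero} yeq _ _ _) = ⊥-elim (<⇒≱ (pos _ _) (≤-reflexive yeq))
    K-connected {F} {r} {c} {c₀} pos i le h (kup {y = suc u} yeq p q k) with F r c₀ in eq | pos r c₀
    ... | suc t | _ =
      Eq.transitive _
        (~-≈ (exchange m β t u t<u (s≤s⁻¹ p) upper lower z (proj₁ odd-u) upper-y lower-y φ-y
               -- After `y` the counter is even again: it and the excess are both 0 there, so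
               -- ordinary matching applies.
               (matched (suc u) m (λ v l _ → same v (<-trans (s≤s t<u) l))
                 (trans (φR-suc β u upper-y lower-y φ-y) (sym (cong (2 *_) balance-y′)))))
             (upd-move (F ∪ R) r (suc r) (suc u) (suc t) vacant (λ e → 1+n≢n e)))
        (N-connected pos (KI-up yeq p q i) (<⇒≤ le) (≤-trans x₀≤t (<⇒≤ (s≤s t<u))) k)
      where
      open Hold pos i le h t eq
      Frc<y : F r c < suc u
      Frc<y = subst (F r c <_) yeq (col inc′ r c)
      t<u : t < u
      t<u = s≤s⁻¹ (subst (_< suc u) eq (≤-<-trans (row-mono inc′ r (Held.c₀≤c h)) Frc<y))
      odd-u = odd u (≤-trans (n≤1+n u) (s≤s⁻¹ p)) (≤-reflexive (sym yeq))
      upper-y : β r (suc u) ≡ false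
      upper-y = trans (state-upper F r _ (suc u) le) (entries-gap inc′ pos r (suc c) (suc u) (λ { j refl → Frc<y }) q)
      lower-y : β (suc r) (suc u) ≡ true
      lower-y = state-more F (suc r) _ (suc u) (subst (λ v → entries F (suc r) v ≡ true) yeq (entries⁺ inc′ pos (suc r) c))
      balance-y : excess F r u ≡ 1
      balance-y = trans (excess-counts F r u
        (count-unique inc′ pos r (suc c) u (λ { j refl → s≤s⁻¹ Frc<y }) (<-trans (n<1+n u) q))
        (count-entry inc′ pos (suc r) c u yeq)) (trans (+-∸-assoc 1 (≤-refl {c})) (cong suc (n∸n≡0 c)))
      balance-y′ : excess F r (suc u) ≡ 0
      balance-y′ = trans (excess-counts F r (suc u)
        (count-unique inc′ pos r (suc c) (suc u) (λ { j refl → <⇒≤ Frc<y }) q)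
        (count-unique inc′ pos (suc r) (suc c) (suc u) (λ { j refl → ≤-reflexive yeq })
          (subst (_< F (suc r) (suc c)) yeq (row inc′ (suc r) c)))) (n∸n≡0 (suc c))
      φ-y : φR β u ≡ 1
      φ-y = +-cancelʳ-≡ 1 _ 1 (trans (proj₂ odd-u u t<u ≤-refl) (cong (2 *_) balance-y))

-- Tableaux as lists of rows

∧-intro : ∀ {a b} → T a → T b → T (a ∧ b)
∧-intro {true} {true} _ _ = tt

∧-elim : ∀ {a b} → T (a ∧ b) → T a × T b
∧-elim {true} {true} _ = tt , tt

nth-< : ∀ {A : Set} (l : List A) k {x} → nth l k ≡ just x → k < length l
nth-< (_ ∷ l) zero e = s≤s z≤n
nth-< (_ ∷ l) (suc k) e = s≤s (nth-< l k e)

<-nth : ∀ {A : Set} (l : List A) k → k < length l → ∃ λ x → nth l k ≡ just x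
<-nth (x ∷ l) zero lt = x , refl
<-nth (x ∷ l) (suc k) lt = <-nth l k (s≤s⁻¹ lt)

≥-nth : ∀ {A : Set} (l : List A) k → length l ≤ k → nth l k ≡ nothing
≥-nth [] k le = refl
≥-nth (_ ∷ l) (suc k) le = ≥-nth l k (s≤s⁻¹ le)

nothing-nth : ∀ {A : Set} (l : List A) k → nth l k ≡ nothing → length l ≤ k
nothing-nth l k e with k <? length l
... | no p = ≮⇒≥ p
... | yes p with <-nth l k p
...   | x , e′ with trans (sym e) e′
...     | ()

nth-ext : ∀ {A : Set} (l l′ : List A) → (∀ k → nth l k ≡ nth l′ k) → l ≡ l′
nth-ext [] [] e = refl
nth-ext [] (_ ∷ _) e with e 0
... | ()
nth-ext (_ ∷ _) [] e with e 0
... | ()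
nth-ext (x ∷ l) (y ∷ l′) e = cong₂ _∷_ (just-injective (e 0)) (nth-ext l l′ (λ k → e (suc k)))

nth-modify : ∀ {A : Set} (l : List A) k g → nth (modify l k g) k ≡ Maybe.map g (nth l k)
nth-modify [] k g = refl
nth-modify (x ∷ l) zero g = refl
nth-modify (x ∷ l) (suc k) g = nth-modify l k g

nth-modify-≢ : ∀ {A : Set} (l : List A) k g j → j ≢ k → nth (modify l k g) j ≡ nth l j
nth-modify-≢ [] k g j ne = refl
nth-modify-≢ (x ∷ l) zero g zero ne = ⊥-elim (ne refl)
nth-modify-≢ (x ∷ l) zero g (suc j) ne = refl
nth-modify-≢ (x ∷ l) (suc k) g zero ne = refl
nth-modify-≢ (x ∷ l) (suc k) g (suc j) ne = nth-modify-≢ l k g j (λ e → ne (cong suc e))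

length-modify : ∀ {A : Set} (l : List A) k g → length (modify l k g) ≡ length l
length-modify [] k g = refl
length-modify (x ∷ l) zero g = refl
length-modify (x ∷ l) (suc k) g = cong suc (length-modify l k g)

nth-snoc : ∀ {A : Set} (l : List A) x → nth (l ++ x ∷ []) (length l) ≡ just x
nth-snoc [] x = refl
nth-snoc (_ ∷ l) x = nth-snoc l x

nth-snoc-≢ : ∀ {A : Set} (l : List A) x k → k ≢ length l → nth (l ++ x ∷ []) k ≡ nth l k
nth-snoc-≢ [] x zero ne = ⊥-elim (ne refl)
nth-snoc-≢ [] x (suc k) ne = refl
nth-snoc-≢ (_ ∷ l) x zero ne = refl
nth-snoc-≢ (_ ∷ l) x (suc k) ne = nth-snoc-≢ l x k (λ e → ne (cong suc e))

NonEmptyRows : ∀ {A : Set} → Tab A → Set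
NonEmptyRows t = ∀ r row → nth t r ≡ just row → 1 ≤ length row

at-nth : ∀ {A : Set} (t : Tab A) r {row} → nth t r ≡ just row → ∀ c → at t r c ≡ nth row c
at-nth t r e c rewrite e = refl

at-nothing : ∀ {A : Set} (t : Tab A) r → nth t r ≡ nothing → ∀ c → at t r c ≡ nothing
at-nothing t r e c rewrite e = refl

at-row : ∀ {A : Set} (t : Tab A) r c {x} → at t r c ≡ just x → ∃ λ row → nth t r ≡ just row × nth row c ≡ just x
at-row t r c e with nth t r
... | just row = row , refl , e

nth-hole : ∀ {A : Set} (t : Tab A) r → NonEmptyRows t → at t r 0 ≡ nothing → nth t r ≡ nothing
nth-hole t r ne e with nth t r in eq
... | nothing = refl
... | just row with <-nth row 0 (ne r row eq)
...   | x , e′ with trans (sym e) e′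
...     | ()

-- An empty row at the end would be invisible to `at`; without empty rows the cells determine the
-- list.
tab-ext : ∀ {A : Set} (t t′ : Tab A) → NonEmptyRows t → NonEmptyRows t′ → (∀ r c → at t r c ≡ at t′ r c) → t ≡ t′
tab-ext t t′ ne ne′ e = nth-ext t t′ go
  where
  go : ∀ r → nth t r ≡ nth t′ r
  go r with nth t r in p | nth t′ r in p′
  ... | nothing | nothing = refl
  ... | just l | just l′ = cong just (nth-ext l l′ (λ c → trans (sym (at-nth t r p c)) (trans (e r c) (at-nth t′ r p′ c))))
  ... | just l | nothing with trans (sym (nth-hole t r ne (trans (e r 0) (at-nothing t′ r p′ 0)))) p
  ...   | ()
  go r | nothing | just l with trans (sym (nth-hole t′ r ne′ (trans (sym (e r 0)) (at-nothing t r p 0)))) p′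
  ...   | ()

at-modify : ∀ {A : Set} (t : Tab A) r c g {x} → at t r c ≡ just x →
            at (modify t r (λ row → modify row c g)) r c ≡ just (g x)
at-modify t r c g {x} e with at-row t r c e
... | row , p , q = trans (at-nth (modify t r _) r (trans (nth-modify t r _) (cong (Maybe.map _) p)) c)
  (trans (nth-modify row c g) (cong (Maybe.map g) q))

at-modify-≢ : ∀ {A : Set} (t : Tab A) r c g q k → (q ≡ r → k ≡ c → ⊥) →
              at (modify t r (λ row → modify row c g)) q k ≡ at t q k
at-modify-≢ t r c g q k ne with q ≟ r
... | no p rewrite nth-modify-≢ t r (λ row → modify row c g) q p = refl
... | yes refl rewrite nth-modify t r (λ row → modify row c g) with nth t r
...   | nothing = refl
...   | just row = nth-modify-≢ row c g k (ne refl)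

rows-modify : ∀ {A : Set} (t : Tab A) r c g → NonEmptyRows t → NonEmptyRows (modify t r (λ row → modify row c g))
rows-modify t r c g ne q row e with q ≟ r
... | no p = ne q row (trans (sym (nth-modify-≢ t r _ q p)) e)
... | yes refl with nth t r in eq | trans (sym (nth-modify t r (λ row → modify row c g))) e
...   | just row′ | refl = subst (1 ≤_) (sym (length-modify row′ c g)) (ne r row′ eq)

data Addable {A : Set} (t : Tab A) : ℕ → ℕ → Set where
  newRow : Addable t (length t) 0
  inRow : ∀ {r row} → nth t r ≡ just row → Addable t r (length row)

record Appended {A : Set} (t : Tab A) (r c : ℕ) (v : A) : Set where
  field
    t′ : Tab A
    eq : appendBox t r c v ≡ just t′
    added : at t′ r c ≡ just v
    others : ∀ q k → (q ≡ r → k ≡ c → ⊥) → at t′ q k ≡ at t q k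
    rows : NonEmptyRows t → NonEmptyRows t′

append : ∀ {A : Set} (t : Tab A) r c v → Addable t r c → Appended t r c v
append [] zero zero v newRow = record
  { eq = refl ; added = refl ; others = others ; rows = λ _ → λ { zero _ refl → s≤s z≤n } }
  where
  others : ∀ q k → (q ≡ 0 → k ≡ 0 → ⊥) → at ((v ∷ []) ∷ []) q k ≡ nothing
  others zero zero ne = ⊥-elim (ne refl refl)
  others zero (suc k) ne = refl
  others (suc q) k ne = refl
append (l ∷ t) zero c v (inRow refl) = record
  { eq = eq ; added = nth-snoc l v ; others = others ; rows = rows }
  where
  eq : appendBox (l ∷ t) 0 (length l) v ≡ just ((l ++ v ∷ []) ∷ t)
  eq rewrite T⇒≡true (≡⇒≡ᵇ (length l) (length l) refl) = refl
  others : ∀ q k → (q ≡ 0 → k ≡ length l → ⊥) → at ((l ++ v ∷ []) ∷ t) q k ≡ at (l ∷ t) q k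
  others zero k ne = nth-snoc-≢ l v k (ne refl)
  others (suc q) k ne = refl
  rows : NonEmptyRows (l ∷ t) → NonEmptyRows ((l ++ v ∷ []) ∷ t)
  rows ne zero _ refl = subst (1 ≤_) (sym (length-++ l)) (m≤n+m 1 (length l))
  rows ne (suc q) row e = ne (suc q) row e
append (l ∷ t) (suc r) c v a = record
  { t′ = l ∷ P.t′ ; eq = cong (Maybe.map (l ∷_)) P.eq ; added = P.added ; others = others ; rows = rows }
  where
  tail : ∀ {r c} → Addable (l ∷ t) (suc r) c → Addable t r c
  tail newRow = newRow
  tail (inRow e) = inRow e
  module P = Appended (append t r c v (tail a))
  others : ∀ q k → (q ≡ suc r → k ≡ c → ⊥) → at (l ∷ P.t′) q k ≡ at (l ∷ t) q k
  others zero k ne = refl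
  others (suc q) k ne = P.others q k (λ e → ne (cong suc e))
  rows : NonEmptyRows (l ∷ t) → NonEmptyRows (l ∷ P.t′)
  rows ne zero row e = ne zero row e
  rows ne (suc q) row e = P.rows (λ q row e → ne (suc q) row e) q row e

length-≤ : ∀ {A B : Set} (l : List A) (l′ : List B) → (∀ c {v} → nth l′ c ≡ just v → ∃ λ w → nth l c ≡ just w) → length l′ ≤ length l
length-≤ l [] h = z≤n
length-≤ l (x ∷ l′) h with <-nth (x ∷ l′) (length l′) ≤-refl
... | v , e with h (length l′) e
...   | w , e′ = nth-< l (length l′) e′

Supported : ∀ {A : Set} → Tab A → Set
Supported t = ∀ r c {v} → at t (suc r) c ≡ just v → ∃ λ w → at t r c ≡ just w

youngB⁺ : ∀ {A : Set} (t : Tab A) → NonEmptyRows t → Supported t → T (youngB (shape t))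
youngB⁺ [] ne h = tt
youngB⁺ (l ∷ []) ne h = ≤⇒≤ᵇ (ne 0 l refl)
youngB⁺ (l ∷ l′ ∷ t) ne h = ∧-intro (≤⇒≤ᵇ (ne 0 l refl)) (∧-intro (≤⇒≤ᵇ (length-≤ l l′ (h 0)))
  (youngB⁺ (l′ ∷ t) (λ q → ne (suc q)) (λ r → h (suc r))))

youngB⁻ : ∀ {A : Set} (t : Tab A) → T (youngB (shape t)) → NonEmptyRows t × Supported t
youngB⁻ [] h = (λ _ _ ()) , (λ _ _ ())
youngB⁻ (l ∷ []) h = (λ { zero _ refl → ≤ᵇ⇒≤ 1 _ h }) , (λ _ _ ())
youngB⁻ {A} (l ∷ l′ ∷ t) h with youngB⁻ (l′ ∷ t) (proj₂ (∧-elim {length l′ ≤ᵇ length l} (proj₂ (∧-elim {1 ≤ᵇ length l} h))))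
... | ne , sp = (λ { zero _ refl → ≤ᵇ⇒≤ 1 _ (proj₁ (∧-elim h)) ; (suc q) row e → ne q row e }) , supp
  where
  supp : Supported (l ∷ l′ ∷ t)
  supp zero c e = <-nth l c (<-≤-trans (nth-< l′ c e) (≤ᵇ⇒≤ (length l′) _ (proj₁ (∧-elim (proj₂ (∧-elim {1 ≤ᵇ length l} h))))))
  supp (suc r) c e = sp r c e

RowsStrict ColumnsStrict : Tab ℕ → Set
RowsStrict t = ∀ r c {v w} → at t r c ≡ just v → at t r (suc c) ≡ just w → v < w
ColumnsStrict t = ∀ r c {v w} → at t r c ≡ just v → at t (suc r) c ≡ just w → v < w

strictB⁺ : ∀ l → (∀ c {v w} → nth l c ≡ just v → nth l (suc c) ≡ just w → v < w) → T (strictB l)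
strictB⁺ [] h = tt
strictB⁺ (_ ∷ []) h = tt
strictB⁺ (a ∷ b ∷ l) h = ∧-intro (<⇒<ᵇ (h 0 refl refl)) (strictB⁺ (b ∷ l) (λ c → h (suc c)))

strictB⁻ : ∀ l → T (strictB l) → ∀ c {v w} → nth l c ≡ just v → nth l (suc c) ≡ just w → v < w
strictB⁻ (a ∷ b ∷ l) h zero refl refl = <ᵇ⇒< a b (proj₁ (∧-elim {a <ᵇ b} h))
strictB⁻ (a ∷ b ∷ l) h (suc c) e e′ = strictB⁻ (b ∷ l) (proj₂ (∧-elim {a <ᵇ b} h)) c e e′

colsB⁺ : ∀ l l′ → (∀ c {v w} → nth l c ≡ just v → nth l′ c ≡ just w → v < w) → T (colsB l l′)
colsB⁺ [] _ h = tt
colsB⁺ (_ ∷ _) [] h = tt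
colsB⁺ (a ∷ l) (b ∷ l′) h = ∧-intro (<⇒<ᵇ (h 0 refl refl)) (colsB⁺ l l′ (λ c → h (suc c)))

colsB⁻ : ∀ l l′ → T (colsB l l′) → ∀ c {v w} → nth l c ≡ just v → nth l′ c ≡ just w → v < w
colsB⁻ (a ∷ l) (b ∷ l′) h zero refl refl = <ᵇ⇒< a b (proj₁ (∧-elim {a <ᵇ b} h))
colsB⁻ (a ∷ l) (b ∷ l′) h (suc c) e e′ = colsB⁻ l l′ (proj₂ (∧-elim {a <ᵇ b} h)) c e e′

rowsAllB⁺ : ∀ t → RowsStrict t → T (rowsAllB t)
rowsAllB⁺ [] h = tt
rowsAllB⁺ (l ∷ t) h = ∧-intro (strictB⁺ l (h 0)) (rowsAllB⁺ t (λ r → h (suc r)))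

rowsAllB⁻ : ∀ t → T (rowsAllB t) → RowsStrict t
rowsAllB⁻ (l ∷ t) h zero = strictB⁻ l (proj₁ (∧-elim {strictB l} h))
rowsAllB⁻ (l ∷ t) h (suc r) = rowsAllB⁻ t (proj₂ (∧-elim {strictB l} h)) r

colsAllB⁺ : ∀ t → ColumnsStrict t → T (colsAllB t)
colsAllB⁺ [] h = tt
colsAllB⁺ (_ ∷ []) h = tt
colsAllB⁺ (l ∷ l′ ∷ t) h = ∧-intro (colsB⁺ l l′ (h 0)) (colsAllB⁺ (l′ ∷ t) (λ r → h (suc r)))

colsAllB⁻ : ∀ t → T (colsAllB t) → ColumnsStrict t
colsAllB⁻ (l ∷ l′ ∷ t) h zero = colsB⁻ l l′ (proj₁ (∧-elim {colsB l l′} h))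
colsAllB⁻ (l ∷ l′ ∷ t) h (suc r) = colsAllB⁻ (l′ ∷ t) (proj₂ (∧-elim {colsB l l′} h)) r
colsAllB⁻ (_ ∷ []) h zero c e ()

isIncB⁺ : ∀ t → NonEmptyRows t → Supported t → RowsStrict t → ColumnsStrict t → IsIncreasing t
isIncB⁺ t ne sp rs cs = ∧-intro (youngB⁺ t ne sp) (∧-intro (rowsAllB⁺ t rs) (colsAllB⁺ t cs))

isIncB⁻ : ∀ t → IsIncreasing t → NonEmptyRows t × Supported t × RowsStrict t × ColumnsStrict t
isIncB⁻ t h with ∧-elim {youngB (shape t)} h
... | a , h′ with ∧-elim {rowsAllB t} h′ | youngB⁻ t a
...   | b , c | ne , sp = ne , sp , rowsAllB⁻ t b , colsAllB⁻ t c

findBump-just : ∀ t c x r {y} → (∀ q → q < r → ∃ λ v → at t q c ≡ just v × v ≤ x) → at t r c ≡ just y → x < y →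
                findBump t c x ≡ just (r , y)
findBump-just (l ∷ t) c x zero h e lt rewrite e | <ᵇ-true lt = refl
findBump-just (l ∷ t) c x (suc r) h e lt with h 0 (s≤s z≤n)
... | v , e′ , le rewrite e′ | <ᵇ-false le | findBump-just t c x r (λ q p → h (suc q) (s≤s p)) e lt = refl

findBump-nothing : ∀ t c x r → (∀ q → q < r → ∃ λ v → at t q c ≡ just v × v ≤ x) → at t r c ≡ nothing →
                   findBump t c x ≡ nothing
findBump-nothing [] c x r h e = refl
findBump-nothing (l ∷ t) c x zero h e rewrite e = refl
findBump-nothing (l ∷ t) c x (suc r) h e with h 0 (s≤s z≤n)
... | v , e′ , le rewrite e′ | <ᵇ-false le | findBump-nothing t c x r (λ q p → h (suc q) (s≤s p)) e = refl

colH-≡ : ∀ {A : Set} (t : Tab A) c r → (∀ q → q < r → ∃ λ v → at t q c ≡ just v) → at t r c ≡ nothing → colH t c ≡ r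
colH-≡ [] c zero h e = refl
colH-≡ [] c (suc r) h e with h 0 (s≤s z≤n)
... | _ , ()
colH-≡ (l ∷ t) c zero h e rewrite <ᵇ-false (nothing-nth l c e) = refl
colH-≡ (l ∷ t) c (suc r) h e with h 0 (s≤s z≤n)
... | v , e′ rewrite <ᵇ-true (nth-< l c e′) = cong suc (colH-≡ t c r (λ q p → h (suc q) (s≤s p)) e)

rowLen-≡ : ∀ {A : Set} (t : Tab A) r c {x} → at t r c ≡ just x → at t r (suc c) ≡ nothing → rowLen t r ≡ suc c
rowLen-≡ t r c e e′ with at-row t r c e
... | row , p , q rewrite p = ≤-antisym (nothing-nth row (suc c) e′) (nth-< row c q)

at-row-left : ∀ {A : Set} (t : Tab A) r c {x} → at t r (suc c) ≡ just x → ∃ λ w → at t r c ≡ just w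
at-row-left t r c e with at-row t r (suc c) e
... | row , p , q with <-nth row c (<-trans (n<1+n c) (nth-< row (suc c) q))
...   | w , e′ = w , trans (at-nth t r p c) e′

addable : ∀ {A : Set} (t : Tab A) r c → NonEmptyRows t → at t r c ≡ nothing →
          (∀ q → r ≡ suc q → ∃ λ v → at t q c ≡ just v) → (∀ k → c ≡ suc k → ∃ λ v → at t r k ≡ just v) → Addable t r c
addable t r zero ne e up lt with nth-hole t r ne e
... | h = subst (λ z → Addable t z 0) (≤-antisym (nothing-nth t r h) (bound r up)) newRow
  where
  bound : ∀ r → (∀ q → r ≡ suc q → ∃ λ v → at t q 0 ≡ just v) → r ≤ length t
  bound zero _ = z≤n
  bound (suc r) up with at-row t r 0 (proj₂ (up r refl))
  ... | _ , p , _ = nth-< t r p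
addable t r (suc c) ne e up lt with at-row t r c (proj₂ (lt c refl))
... | row , p , q = subst (Addable t r) (≤-antisym (nothing-nth row (suc c) (trans (sym (at-nth t r p (suc c))) e)) (nth-< row c q)) (inRow p)

-- The insertion algorithm on lists follows the paths.

module Concrete (M : ℕ) where

  open Paths M

  cell : Filling → ℕ → ℕ → Maybe ℕ
  cell F r c = if F r c <ᵇ M then just (F r c) else nothing

  cell-in : ∀ {F r c} → F r c < M → cell F r c ≡ just (F r c)
  cell-in lt rewrite <ᵇ-true lt = refl

  cell-out : ∀ {F r c} → M ≤ F r c → cell F r c ≡ nothing
  cell-out le rewrite <ᵇ-false le = refl

  cell-just : ∀ {F r c v} → cell F r c ≡ just v → F r c < M × F r c ≡ v
  cell-just {F} {r} {c} e with F r c <? M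
  ... | yes p = p , just-injective (trans (sym (cell-in {F} p)) e)
  ... | no p with trans (sym (cell-out {F} (≮⇒≥ p))) e
  ...   | ()

  cell-nothing : ∀ {F r c} → cell F r c ≡ nothing → M ≤ F r c
  cell-nothing {F} {r} {c} e with F r c <? M
  ... | no p = ≮⇒≥ p
  ... | yes p with trans (sym (cell-in {F} p)) e
  ...   | ()

  record Rep (t : Tab ℕ) (F : Filling) : Set where
    field
      cells : ∀ r c → at t r c ≡ cell F r c
      rows : NonEmptyRows t

  Rep-cong : ∀ {t F G} → F ≈ G → Rep t F → Rep t G
  Rep-cong {F = F} {G} e ρ .Rep.cells r c = trans (Rep.cells ρ r c) (cong (λ v → if v <ᵇ M then just v else nothing) (e r c))
  Rep-cong e ρ .Rep.rows = Rep.rows ρ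

  Rep-unique : ∀ {t t′ F} → Rep t F → Rep t′ F → t ≡ t′
  Rep-unique {t} {t′} ρ ρ′ = tab-ext t t′ (Rep.rows ρ) (Rep.rows ρ′) (λ r c → trans (Rep.cells ρ r c) (sym (Rep.cells ρ′ r c)))

  module _ {t F} (ρ : Rep t F) where

    at-in : ∀ {r c} → F r c < M → at t r c ≡ just (F r c)
    at-in lt = trans (Rep.cells ρ _ _) (cell-in {F} lt)

    at-out : ∀ {r c} → M ≤ F r c → at t r c ≡ nothing
    at-out le = trans (Rep.cells ρ _ _) (cell-out {F} le)

    at-just : ∀ {r c v} → at t r c ≡ just v → F r c < M × F r c ≡ v
    at-just e = cell-just {F} (trans (sym (Rep.cells ρ _ _)) e)

    Inc⇒increasing : Inc F → IsIncreasing t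
    Inc⇒increasing i = isIncB⁺ t (Rep.rows ρ)
      (λ r c e → _ , at-in (<-trans (col i r c) (proj₁ (at-just e))))
      (λ r c e e′ → subst₂ _<_ (proj₂ (at-just e)) (proj₂ (at-just e′)) (row i r c))
      (λ r c e e′ → subst₂ _<_ (proj₂ (at-just e)) (proj₂ (at-just e′)) (col i r c))

    Rep-modify : ∀ r c x → x < M → F r c < M → Rep (modify t r (λ row → modify row c (λ _ → x))) (upd F r c x)
    Rep-modify r c x x<M lt .Rep.rows = rows-modify t r c (λ _ → x) (Rep.rows ρ)
    Rep-modify r c x x<M lt .Rep.cells q k with updView F r c x q k
    ... | hit refl refl e = trans (at-modify t r c (λ _ → x) (at-in lt))
      (sym (trans (cell-in {upd F r c x} {r} {c} (subst (_< M) (sym e) x<M)) (cong just e)))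
    ... | miss n e = trans (at-modify-≢ t r c (λ _ → x) q k n)
      (trans (Rep.cells ρ q k) (cong (λ v → if v <ᵇ M then just v else nothing) (sym e)))

    Rep-append : ∀ r c x → x < M → (a : Appended t r c x) → Rep (Appended.t′ a) (upd F r c x)
    Rep-append r c x x<M a .Rep.rows = Appended.rows a (Rep.rows ρ)
    Rep-append r c x x<M a .Rep.cells q k with updView F r c x q k
    ... | hit refl refl e = trans (Appended.added a)
      (sym (trans (cell-in {upd F r c x} {r} {c} (subst (_< M) (sym e) x<M)) (cong just e)))
    ... | miss n e = trans (Appended.others a q k n)
      (trans (Rep.cells ρ q k) (cong (λ v → if v <ᵇ M then just v else nothing) (sym e)))

  data Blocked (F : Filling) (x : ℕ) : ℕ → ℕ → Set where
    above : ∀ {r c} → F r c ≡ x → Blocked F x (suc r) c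
    left : ∀ {r c} → F r c ≡ x → Blocked F x r (suc c)

  blocked⇒¬increasing : ∀ {t F r c x} → x < M → Rep t (upd F r c x) → Blocked F x r c → isIncB t ≡ false
  blocked⇒¬increasing {t} {F} {suc r} {c} {x} lt ρ (above e) = ¬T⇒≡false λ h →
    <-irrefl refl (proj₂ (proj₂ (proj₂ (isIncB⁻ t h))) r c
      (trans (at-in ρ {r} {c} (subst (_< M) (sym e′) lt)) (cong just e′)) (trans (at-in ρ {suc r} {c} (subst (_< M) (sym h′) lt)) (cong just h′)))
    where
    e′ : upd F (suc r) c x r c ≡ x
    e′ = trans (upd-miss F (suc r) c x r c (λ z _ → 1+n≢n (sym z))) e
    h′ : upd F (suc r) c x (suc r) c ≡ x
    h′ = upd-hit F (suc r) c x
  blocked⇒¬increasing {t} {F} {r} {suc c} {x} lt ρ (left e) = ¬T⇒≡false λ h →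
    <-irrefl refl (proj₁ (proj₂ (proj₂ (isIncB⁻ t h))) r c
      (trans (at-in ρ {r} {c} (subst (_< M) (sym e′) lt)) (cong just e′)) (trans (at-in ρ {r} {suc c} (subst (_< M) (sym h′) lt)) (cong just h′)))
    where
    e′ : upd F r (suc c) x r c ≡ x
    e′ = trans (upd-miss F r (suc c) x r c (λ _ z → 1+n≢n (sym z))) e
    h′ : upd F r (suc c) x r (suc c) ≡ x
    h′ = upd-hit F r (suc c) x

  column-below : ∀ {t F r c x} → Rep t F → Inc F → x < M → Above F r c x ⊎ (∃ λ q → r ≡ suc q × F q c ≤ x) →
                 ∀ q → q < r → ∃ λ v → at t q c ≡ just v × v ≤ x
  column-below {F = F} {suc r} {c} ρ i lt a q p = F q c , at-in ρ (≤-<-trans le lt) , le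
    where
    weaken : ∀ {x} → F r c < x ⊎ (∃ λ q → suc r ≡ suc q × F q c ≤ x) → F r c ≤ x
    weaken (inj₁ h) = <⇒≤ h
    weaken (inj₂ (_ , refl , h)) = h
    le : F q c ≤ _
    le = ≤-trans (col-mono i c (s≤s⁻¹ p)) (weaken a)

  hins-bump : ∀ t c x {r y} k {t″} → findBump t c x ≡ just (r , y) →
              (if isIncB (modify t r (λ row → modify row c (λ _ → x))) then modify t r (λ row → modify row c (λ _ → x)) else t) ≡ t″ →
              hins (suc k) c x t ≡ hins k (suc c) y t″
  hins-bump t c x k e refl rewrite e = refl

  hins-end : ∀ t c x k → findBump t c x ≡ nothing → hins (suc k) c x t ≡ hinsEnd t c x
  hins-end t c x k e rewrite e = refl

  hinsEnd-new : ∀ t c x {h t′} → colH t c ≡ h → appendBox t h c x ≡ just t′ → isIncB t′ ≡ true →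
                hinsEnd t c x ≡ (t′ , (h , c))
  hinsEnd-new t c x refl e i rewrite e | i = refl

  hinsEnd-old : ∀ t c x {h t′} → colH t c ≡ h → appendBox t h c x ≡ just t′ → isIncB t′ ≡ false →
                hinsEnd t c x ≡ (t , (h ∸ 1 , rowLen t (h ∸ 1) ∸ 1))
  hinsEnd-old t c x refl e i rewrite e | i = refl

  endBox : End → ℕ × ℕ
  endBox e = endRow e , endCol e

  Result : ℕ → ℕ → ℕ → Tab ℕ → Filling → End → Set
  Result k c x t F′ e = ∃ λ t′ → hins k c x t ≡ (t′ , endBox e) × Rep t′ F′

  Wide : Filling → ℕ → Set
  Wide F W = M ≤ F 0 W

  within : ∀ {F W} → Inc F → Wide F W → ∀ r c → F r c < M → c < W
  within i w r c lt = row-reflects i 0 (≤-<-trans (col-mono i c z≤n) (<-≤-trans lt w))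

  mutual
    -- No box lies in column `W` or beyond, since row 0 is the longest. Hence every bump leads to a
    -- column at most `W`, and `W < c + k` keeps the fuel `k` positive.
    hins-N : ∀ {F r c x F′ e W t} k → NI F r c x → Rep t F → Wide F W → c ≤ W → W < c + k → N F r c x F′ e → Result k c x t F′ e
    hins-N k i ρ w cW Wk (up p n) = hins-N k (NI-up p i) ρ w cW Wk n
    hins-N {c = c} zero i ρ w cW Wk _ = ⊥-elim (<⇒≱ Wk (subst (_≤ _) (sym (+-identityʳ c)) cW))
    hins-N {F} {r} {c} {x} {W = W} {t} (suc k) i ρ w cW Wk (put a refl p n)
      with hins-N k (NI-put a refl p i) (Rep-modify ρ r c x (NI.x<M i) p)
             (subst (M ≤_) (sym (upd-miss F r c x 0 W (λ _ e → <-irrefl (sym e) (within (NI.inc i) w r c p)))) w) (within (NI.inc i) w r c p) (subst (W <_) (+-suc c k) Wk) n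
    ... | t′ , e , ρ′ = t′ , trans (hins-bump t c x k
          (findBump-just t c x r (column-below ρ (NI.inc i) (NI.x<M i) (inj₁ a)) (at-in ρ p) (NI.lt i))
          (cong (λ b → if b then modify t r (λ row → modify row c (λ _ → x)) else t) (T⇒≡true (Inc⇒increasing (Rep-modify ρ r c x (NI.x<M i) p) (NI.inc (NI-put a refl p i)))))) e , ρ′
    hins-N {F} {r} {c} {x} {t = t} (suc k) i ρ w cW Wk (putE a p eq) =
      Appended.t′ A ,
      trans (hins-end t c x k (findBump-nothing t c x r below (at-out ρ p)))
            (hinsEnd-new t c x (colH-≡ t c r (λ q l → _ , proj₁ (proj₂ (below q l))) (at-out ρ p)) (Appended.eq A)
              (T⇒≡true (Inc⇒increasing ρ′ (upd-lower-Inc (NI.inc i) (NI.lt i) (NI.left i) a)))) ,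
      Rep-cong eq ρ′
      where
      below = column-below ρ (NI.inc i) (NI.x<M i) (inj₁ a)
      A = append t r c x (addable t r c (Rep.rows ρ) (at-out ρ p)
        (λ { q refl → _ , proj₁ (proj₂ (below q ≤-refl)) })
        (λ { j refl → _ , at-in ρ (<-trans (NI.left i j refl) (NI.x<M i)) }))
      ρ′ = Rep-append ρ r c x (NI.x<M i) A
    hins-N {F} {suc r} {c} {x} (suc k) i ρ w cW Wk (blk refl n) =
      hins-K (suc k) (NI-blk refl i) (NI.x<M i) (NI.lt i) ≤-refl (above refl)
        (λ { j refl → <-trans (NI.left i j refl) (NI.x<M i) }) ρ w cW Wk n

    -- The path `K` omits the arriving letter `x`, but the algorithm uses it to find the box
    -- `(r + 1 , c)` and to test the overwriting. The test fails because `x` equals the entry above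
    -- in the first blocked column and the entry to the left in later ones.
    hins-K : ∀ {F r c x F′ e W t} k → KI F r c → x < M → x < F (suc r) c → F r c ≤ x → Blocked F x (suc r) c →
             (∀ j → c ≡ suc j → F (suc r) j < M) → Rep t F → Wide F W → c ≤ W → W < c + k → K F r c F′ e → Result k c x t F′ e
    hins-K {c = c} zero i x<M lt le b f ρ w cW Wk _ = ⊥-elim (<⇒≱ Wk (subst (_≤ _) (sym (+-identityʳ c)) cW))
    hins-K {F} {r} {c} {x} {t = t} (suc k) i x<M lt le b f ρ w cW Wk (kend {e = e} p _ s q eq) =
      t ,
      trans (hins-end t c x k (findBump-nothing t c x (suc r) below (at-out ρ p)))
        (trans (hinsEnd-old t c x (colH-≡ t c (suc r) (λ q l → _ , proj₁ (proj₂ (below q l))) (at-out ρ p)) (Appended.eq A)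
                 (blocked⇒¬increasing x<M (Rep-append ρ (suc r) c x x<M A) b))
               (cong (λ v → t , (r , v ∸ 1)) (rowLen-≡ t r e (at-in ρ s) (at-out ρ q)))) ,
      Rep-cong eq ρ
      where
      below = column-below ρ (KI.inc i) x<M (inj₂ (r , refl , le))
      A = append t (suc r) c x (addable t (suc r) c (Rep.rows ρ) (at-out ρ p)
        (λ { q refl → _ , proj₁ (proj₂ (below q ≤-refl)) })
        (λ { j refl → _ , at-in ρ (f j refl) }))
    hins-K {F} {r} {c} {x} {W = W} {t} (suc k) i x<M lt le b f ρ w cW Wk (kup refl p q n)
      with hins-N k (KI-up refl p q i) ρ w (within (KI.inc i) w (suc r) c p) (subst (W <_) (+-suc c k) Wk) n
    ... | t′ , e , ρ′ = t′ , trans (hins-blocked k i x<M lt le b p ρ) e , ρ′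
    hins-K {F} {r} {c} {x} {W = W} {t} (suc k) i x<M lt le b f ρ w cW Wk (kstay p q n)
      with hins-K k (KI-stay p q i) p (row (KI.inc i) (suc r) c) q (left refl) (λ { j refl → p }) ρ w
             (within (KI.inc i) w (suc r) c p) (subst (W <_) (+-suc c k) Wk) n
    ... | t′ , e , ρ′ = t′ , trans (hins-blocked k i x<M lt le b p ρ) e , ρ′

    hins-blocked : ∀ {F r c x t} k → KI F r c → x < M → x < F (suc r) c → F r c ≤ x → Blocked F x (suc r) c → F (suc r) c < M →
                   Rep t F → hins (suc k) c x t ≡ hins k (suc c) (F (suc r) c) t
    hins-blocked {F} {r} {c} {x} {t} k i x<M lt le b p ρ = hins-bump t c x k
      (findBump-just t c x (suc r) (column-below ρ (KI.inc i) x<M (inj₂ (r , refl , le))) (at-in ρ p) lt)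
      (cong (λ b → if b then modify t (suc r) (λ row → modify row c (λ _ → x)) else t) (blocked⇒¬increasing x<M (Rep-modify ρ (suc r) c x x<M p) b))

  heckeInsert-N : ∀ {F s x F′ e t} → NI F s 0 x → Rep t F → N F s 0 x F′ e →
                  ∃ λ t′ → heckeInsert x t ≡ (t′ , endBox e) × Rep t′ F′
  -- The width bound is the number of boxes, which is at least the length of row 0.
  heckeInsert-N {F} {t = t} i ρ n = hins-N _ i ρ (wide t ρ) z≤n (s≤s (n≤1+n _)) n
    where
    wide : ∀ t → Rep t F → Wide F (length (concat t))
    wide [] ρ = cell-nothing {F} (sym (Rep.cells ρ 0 0))
    wide (l ∷ t) ρ = cell-nothing {F} (trans (sym (Rep.cells ρ 0 _))
      (≥-nth l _ (subst (length l ≤_) (sym (length-++ l)) (m≤m+n (length l) _))))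

-- Recording tableaux

SVFilling : Set
SVFilling = ℕ → ℕ → List ℕ

∈-snoc⁻ : ∀ {x i : ℕ} l → x ∈ l ∷ʳ i → x ∈ l ⊎ x ≡ i
∈-snoc⁻ l p with ∈-++⁻ l p
... | inj₁ q = inj₁ q
... | inj₂ (here e) = inj₂ e

strictB-snoc : ∀ l i → T (strictB l) → (∀ {x} → x ∈ l → x < i) → T (strictB (l ∷ʳ i))
strictB-snoc [] i h f = tt
strictB-snoc (a ∷ []) i h f = ∧-intro (<⇒<ᵇ (f (here refl))) tt
strictB-snoc (a ∷ b ∷ l) i h f =
  ∧-intro (proj₁ (∧-elim {a <ᵇ b} h)) (strictB-snoc (b ∷ l) i (proj₂ (∧-elim {a <ᵇ b} h)) (λ p → f (there p)))

insSet-snoc : ∀ i l → (∀ {x} → x ∈ l → x < i) → insSet i l ≡ l ∷ʳ i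
insSet-snoc i [] f = refl
insSet-snoc i (y ∷ l) f
  rewrite <ᵇ-false (<⇒≤ (f (here refl))) | ≡ᵇ-false {i} {y} (λ e → <-irrefl (sym e) (f (here refl))) =
  cong (y ∷_) (insSet-snoc i l (λ p → f (there p)))

strictB-head : ∀ a l → T (strictB (a ∷ l)) → ∀ {x} → x ∈ l → a < x
strictB-head a (b ∷ l) h (here refl) = <ᵇ⇒< a b (proj₁ (∧-elim h))
strictB-head a (b ∷ l) h (there p) = <-trans (<ᵇ⇒< a b (proj₁ (∧-elim h))) (strictB-head b l (proj₂ (∧-elim {a <ᵇ b} h)) p)

strictB-tail : ∀ a l → T (strictB (a ∷ l)) → T (strictB l)
strictB-tail a [] h = tt
strictB-tail a (b ∷ l) h = proj₂ (∧-elim {a <ᵇ b} h)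

split-max : ∀ L i → T (strictB L) → i ∈ L → (∀ {x} → x ∈ L → x ≤ i) →
            ∃ λ l → L ≡ l ∷ʳ i × T (strictB l) × (∀ {x} → x ∈ l → x < i)
split-max (a ∷ []) i h (here refl) f = [] , refl , tt , λ ()
split-max (a ∷ b ∷ l) i h (here refl) f = ⊥-elim (<⇒≱ (strictB-head a (b ∷ l) h (here refl)) (f (there (here refl))))
split-max (a ∷ L) i h (there p) f with split-max L i (strictB-tail a L h) p (λ q → f (there q))
... | l , refl , h′ , g = a ∷ l , refl , strict l h , λ { (here refl) → strictB-head a (l ∷ʳ i) h (∈-++⁺ʳ l (here refl)) ; (there q) → g q }
  where
  strict : ∀ l → T (strictB (a ∷ l ∷ʳ i)) → T (strictB (a ∷ l))
  strict [] _ = tt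
  strict (b ∷ l) h = ∧-intro (proj₁ (∧-elim h)) h″
    where
    h″ : T (strictB (b ∷ l))
    h″ = prefix (b ∷ l) (proj₂ (∧-elim {a <ᵇ b} h))
      where
      prefix : ∀ l → T (strictB (l ∷ʳ i)) → T (strictB l)
      prefix [] _ = tt
      prefix (_ ∷ []) _ = tt
      prefix (a ∷ b ∷ l) h = ∧-intro (proj₁ (∧-elim h)) (prefix (b ∷ l) (proj₂ (∧-elim {a <ᵇ b} h)))

module Recording (M : ℕ) where

  open Paths M
  open Concrete M

  -- The entries of G are at most i, and those equal to i lie in columns < b.
  record Valid (i b : ℕ) (F : Filling) (G : SVFilling) : Set where
    field
      inc : Inc F
      std : Std F
      pos : Positive F
      empty : ∀ r c → M ≤ F r c → G r c ≡ []
      filled : ∀ r c → F r c < M → G r c ≢ []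
      strict : ∀ r c → T (strictB (G r c))
      bounded : ∀ r c {x} → x ∈ G r c → 1 ≤ x × x ≤ i
      rowW : ∀ r c {x y} → x ∈ G r c → y ∈ G r (suc c) → x ≤ y
      colS : ∀ r c {x y} → x ∈ G r c → y ∈ G (suc r) c → x < y
      recent : ∀ r c → i ∈ G r c → c < b

  ∉-empty : ∀ {i b F G} → Valid i b F G → ∀ {r c x} → M ≤ F r c → x ∈ G r c → ⊥
  ∉-empty v {r} {c} {x} le p with subst (x ∈_) (Valid.empty v r c le) p
  ... | ()

  ∈⇒< : ∀ {i b F G} → Valid i b F G → ∀ {r c x} → x ∈ G r c → F r c < M
  ∈⇒< {F = F} v {r} {c} p with F r c <? M
  ... | yes q = q
  ... | no q = ⊥-elim (∉-empty v (≮⇒≥ q) p)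

  -- The boxes in between are nonempty because the diagram is closed upwards, so strictness
  -- propagates. In particular a value occurs at most once in a column.
  colS* : ∀ {i b F G} → Valid i b F G → ∀ {r r′} c {x y} → r < r′ → x ∈ G r c → y ∈ G r′ c → x < y
  colS* {F = F} {G} v {r} {suc r′} c lt p q with m≤n⇒m<n∨m≡n (s≤s⁻¹ lt)
  ... | inj₂ refl = Valid.colS v r c p q
  ... | inj₁ lt′ with G r′ c in eq
  ...   | [] = ⊥-elim (Valid.filled v r′ c (<-trans (col (Valid.inc v) r′ c) (∈⇒< v q)) eq)
  ...   | z ∷ _ = <-trans (colS* v c lt′ p (subst (z ∈_) (sym eq) (here refl)))
                          (Valid.colS v r′ c (subst (z ∈_) (sym eq) (here refl)) q)

  same-row : ∀ {i b F G} → Valid i b F G → ∀ {r r′ c x} → x ∈ G r c → x ∈ G r′ c → r ≡ r′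
  same-row v {r} {r′} p q with <-cmp r r′
  ... | tri< lt _ _ = ⊥-elim (<-irrefl refl (colS* v _ lt p q))
  ... | tri≈ _ e _ = e
  ... | tri> _ _ lt = ⊥-elim (<-irrefl refl (colS* v _ lt q p))

  box : SVFilling → End → List ℕ
  box G e = G (endRow e) (endCol e)

  enter : SVFilling → End → ℕ → SVFilling
  enter G e i = upd G (endRow e) (endCol e) (box G e ∷ʳ i)

  Ins-Box : ∀ {F x F′ e} → Ins F x F′ e → Box F F′ e
  Ins-Box (_ , i , n) = N-Box i n

  Ins-≤ : ∀ {F x F′ e} → Ins F x F′ e → ∀ q k → F′ q k ≤ F q k
  Ins-≤ (_ , i , n) = N-≤ i n

  Ins-corner : ∀ {F x F′ e} → Ins F x F′ e → Corner F′ e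
  Ins-corner {e = new r c} h@(_ , i , _) with Ins-Box h
  ... | p , q , f = q , f r (suc c) (λ _ → 1+n≢n) (<⇒≤ (≤-<-trans p (row (NI.inc i) r c))) ,
                        f (suc r) c (λ e _ → 1+n≢n e) (<⇒≤ (≤-<-trans p (col (NI.inc i) r c)))
  Ins-corner {e = old r c} h with Ins-Box h
  ... | p , q , t , f = ≤-<-trans (Ins-≤ h r c) p , f r (suc c) q , f (suc r) c t

  Ins-right : ∀ {F x F′ e} → Ins F x F′ e → M ≤ F (endRow e) (suc (endCol e))
  Ins-right h = ≤-trans (proj₁ (proj₂ (Ins-corner h))) (Ins-≤ h _ _)

  Ins-below : ∀ {F x F′ e} → Ins F x F′ e → M ≤ F (suc (endRow e)) (endCol e)
  Ins-below h = ≤-trans (proj₂ (proj₂ (Ins-corner h))) (Ins-≤ h _ _)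

  Ins-grow : ∀ {F x F′ e} → Ins F x F′ e → ∀ q k → (q ≡ endRow e → k ≡ endCol e → ⊥) → M ≤ F q k → M ≤ F′ q k
  Ins-grow {e = new r c} h q k n = proj₂ (proj₂ (Ins-Box h)) q k n
  Ins-grow {e = old r c} h q k _ = proj₂ (proj₂ (proj₂ (Ins-Box h))) q k

  ∷ʳ≢[] : ∀ {A : Set} (l : List A) {x} → l ∷ʳ x ≢ []
  ∷ʳ≢[] [] ()
  ∷ʳ≢[] (_ ∷ _) ()

  module Step {i b F G x F′ e} (v : Valid i b F G) (1≤i : 1 ≤ i) (1≤x : 1 ≤ x) (h : Ins F x F′ e) (b≤ : b ≤ endCol e) where

    private
      er = endRow e
      ec = endCol e
      G′ = enter G e i

    box-< : ∀ {y} → y ∈ box G e → y < i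
    box-< p = ≤∧≢⇒< (proj₂ (Valid.bounded v er ec p)) (λ { refl → <⇒≱ (Valid.recent v er ec p) b≤ })

    cases : ∀ r c {y} → y ∈ G′ r c → y ∈ G r c ⊎ (r ≡ er × c ≡ ec × y ≡ i)
    cases r c {y} p with updView G er ec (box G e ∷ʳ i) r c
    ... | miss _ q = inj₁ (subst (y ∈_) q p)
    ... | hit refl refl q with ∈-snoc⁻ (box G e) (subst (y ∈_) q p)
    ...   | inj₁ p′ = inj₁ p′
    ...   | inj₂ eq = inj₂ (refl , refl , eq)

    private
      incstd : Inc F′ × Std F′
      incstd = N-Inc (proj₁ (proj₂ h)) (proj₂ (proj₂ h))

      pos′ : Positive F′
      pos′ r c with N-low (proj₁ (proj₂ h)) (proj₂ (proj₂ h)) r c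
      ... | inj₁ le = ≤-trans 1≤x le
      ... | inj₂ eq = subst (1 ≤_) (sym eq) (Valid.pos v r c)

      empty′ : ∀ r c → M ≤ F′ r c → G′ r c ≡ []
      empty′ r c le with updView G er ec (box G e ∷ʳ i) r c
      ... | miss _ q = trans q (Valid.empty v r c (≤-trans le (Ins-≤ h r c)))
      ... | hit refl refl q = ⊥-elim (<⇒≱ (proj₁ (Ins-corner h)) le)

      filled′ : ∀ r c → F′ r c < M → G′ r c ≢ []
      filled′ r c lt eq with updView G er ec (box G e ∷ʳ i) r c
      ... | hit _ _ q = ∷ʳ≢[] (box G e) (trans (sym q) eq)
      ... | miss n q = Valid.filled v r c (≰⇒> (λ le → <⇒≱ lt (Ins-grow h r c n le))) (trans (sym q) eq)

      strict′ : ∀ r c → T (strictB (G′ r c))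
      strict′ r c with updView G er ec (box G e ∷ʳ i) r c
      ... | hit _ _ q = subst (λ l → T (strictB l)) (sym q) (strictB-snoc (box G e) i (Valid.strict v er ec) box-<)
      ... | miss _ q = subst (λ l → T (strictB l)) (sym q) (Valid.strict v r c)

      rowW′ : ∀ r c {y z} → y ∈ G′ r c → z ∈ G′ r (suc c) → y ≤ z
      rowW′ r c p q with cases r c p | cases r (suc c) q
      ... | inj₁ p′ | inj₁ q′ = Valid.rowW v r c p′ q′
      ... | inj₁ p′ | inj₂ (_ , _ , refl) = proj₂ (Valid.bounded v r c p′)
      ... | inj₂ (refl , refl , refl) | inj₁ q′ = ⊥-elim (∉-empty v (Ins-right h) q′)
      ... | inj₂ (_ , refl , _) | inj₂ (_ , z , _) = ⊥-elim (1+n≢n z)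

      colS′ : ∀ r c {y z} → y ∈ G′ r c → z ∈ G′ (suc r) c → y < z
      colS′ r c p q with cases r c p | cases (suc r) c q
      ... | inj₁ p′ | inj₁ q′ = Valid.colS v r c p′ q′
      ... | inj₁ p′ | inj₂ (_ , refl , refl) = ≤∧≢⇒< (proj₂ (Valid.bounded v r c p′)) (λ { refl → <⇒≱ (Valid.recent v r c p′) b≤ })
      ... | inj₂ (refl , refl , refl) | inj₁ q′ = ⊥-elim (∉-empty v (Ins-below h) q′)
      ... | inj₂ (refl , _ , _) | inj₂ (z , _ , _) = ⊥-elim (1+n≢n z)

    -- All earlier `i` lie in columns left of the end, so `i` is new to its column; and the end is a
    -- corner of the new diagram, so nothing to its right or below has to be compared with it.
    valid : Valid i (suc ec) F′ G′
    valid = record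
      { inc = proj₁ incstd ; std = proj₂ incstd ; pos = pos′ ; empty = empty′ ; filled = filled′ ; strict = strict′
      ; bounded = bounded′ ; rowW = rowW′ ; colS = colS′ ; recent = recent′ }
      where
      bounded′ : ∀ r c {y} → y ∈ G′ r c → 1 ≤ y × y ≤ i
      bounded′ r c p with cases r c p
      ... | inj₁ p′ = Valid.bounded v r c p′
      ... | inj₂ (_ , _ , refl) = 1≤i , ≤-refl
      recent′ : ∀ r c → i ∈ G′ r c → c < suc ec
      recent′ r c p with cases r c p
      ... | inj₁ p′ = <-trans (Valid.recent v r c p′) (s≤s b≤)
      ... | inj₂ (_ , refl , _) = ≤-refl

  Valid-cong : ∀ {i b F G G′} → G ≈ G′ → Valid i b F G → Valid i b F G′
  Valid-cong {G = G} {G′} e v = record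
    { Valid v
    ; empty = λ r c le → trans (sym (e r c)) (Valid.empty v r c le)
    ; filled = λ r c lt q → Valid.filled v r c lt (trans (e r c) q)
    ; strict = λ r c → subst (λ l → T (strictB l)) (e r c) (Valid.strict v r c)
    ; bounded = λ r c p → Valid.bounded v r c (back r c p)
    ; rowW = λ r c p q → Valid.rowW v r c (back r c p) (back r (suc c) q)
    ; colS = λ r c p q → Valid.colS v r c (back r c p) (back (suc r) c q)
    ; recent = λ r c p → Valid.recent v r c (back r c p)
    }
    where
    back : ∀ r c {y} → y ∈ G′ r c → y ∈ G r c
    back r c {y} = subst (y ∈_) (sym (e r c))

  -- Run w F G i b y: inserting the biword w produces (F , G), the current letter is i,
  -- the last letter i went to column b - 1, and its companion letter was y.
  data Run : List (ℕ × ℕ) → Filling → SVFilling → ℕ → ℕ → ℕ → Set where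
    start : ∀ {F G} → Inc F → Std F → Positive F → (∀ r c → M ≤ F r c) → (∀ r c → G r c ≡ []) → Run [] F G 0 0 M
    -- No `i + 1` has been inserted yet: the column bound 0 and the letter bound `M` exclude
    -- nothing.
    next : ∀ {w F G i b y} → Run w F G i b y → Run w F G (suc i) 0 M
    snoc : ∀ {w F G i b y x F′ G′ e} → Run w F G i b y → 1 ≤ i → 1 ≤ x → x < y → Ins F x F′ e → b ≤ endCol e →
           enter G e i ≈ G′ → Run (w ∷ʳ (x , i)) F′ G′ i (suc (endCol e)) x

  Run-valid : ∀ {w F G i b y} → Run w F G i b y → Valid i b F G
  Run-valid (start i s p f g) = record
    { inc = i ; std = s ; pos = p
    ; empty = λ r c _ → g r c
    ; filled = λ r c lt → ⊥-elim (<⇒≱ lt (f r c))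
    ; strict = λ r c → subst (λ l → T (strictB l)) (sym (g r c)) tt
    ; bounded = λ r c p → ⊥-elim (none r c p)
    ; rowW = λ r c p → ⊥-elim (none r c p)
    ; colS = λ r c p → ⊥-elim (none r c p)
    ; recent = λ r c p → ⊥-elim (none r c p)
    }
    where
    none : ∀ r c {x} → x ∈ _ → ⊥
    none r c {x} p with subst (x ∈_) (g r c) p
    ... | ()
  Run-valid (next ρ) = record
    { Valid v
    ; bounded = λ r c p → proj₁ (Valid.bounded v r c p) , m≤n⇒m≤1+n (proj₂ (Valid.bounded v r c p))
    ; recent = λ r c p → ⊥-elim (1+n≰n (proj₂ (Valid.bounded v r c p)))
    }
    where v = Run-valid ρ
  Run-valid (snoc ρ 1≤i 1≤x _ h b≤ e) = Valid-cong e (Step.valid (Run-valid ρ) 1≤i 1≤x h b≤)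

  Run-last : ∀ {w F G i b y} → Run w F G i b y → (b ≡ 0 × y ≡ M) ⊎ (∃ λ F₀ → ∃ λ e → Ins F₀ y F e × b ≡ suc (endCol e))
  Run-last (start _ _ _ _ _) = inj₁ (refl , refl)
  Run-last (next _) = inj₁ (refl , refl)
  Run-last (snoc _ _ _ _ h _ _) = inj₂ (_ , _ , h , refl)

  Run-insert : ∀ {w F G i b y x F′ e} → Run w F G i b y → 1 ≤ i → 1 ≤ x → x < y → Ins F x F′ e →
               Run (w ∷ʳ (x , i)) F′ (enter G e i) i (suc (endCol e)) x
  Run-insert ρ p q lt h = snoc ρ p q lt h (after (Run-last ρ)) ≈-refl
    where
    after : _ → _ ≤ _
    after (inj₁ (refl , _)) = z≤n
    after (inj₂ (_ , _ , h′ , refl)) = pieri h′ h lt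

  Ins-cong : ∀ {F x F′ F″ e} → F′ ≈ F″ → Ins F x F′ e → RStart F″ e F x
  Ins-cong {e = e} q h = RStart-cong e q (Ins⇒RStart h)

  module _ {w F G i b y x F′ G′ e} (ρ : Run w F G i b y) (h : Ins F x F′ e) (b≤ : b ≤ endCol e) (1≤i : 1 ≤ i) (1≤x : 1 ≤ x)
           (eq : enter G e i ≈ G′) where

    last-∈ : i ∈ box G′ e
    last-∈ = subst (i ∈_) (trans (sym (upd-hit G (endRow e) (endCol e) _)) (eq _ _)) (∈-++⁺ʳ (box G e) (here refl))

    last-split : box G′ e ≡ box G e ∷ʳ i
    last-split = trans (sym (eq _ _)) (upd-hit G (endRow e) (endCol e) _)

  -- The kind of end shows in the box before its last element was recorded: empty for a new box,
  -- nonempty for an old one.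
  end-ext : ∀ {F₁ F₂ F₁′ F₂′ G₁ G₂ i₁ i₂ b₁ b₂ x₁ x₂} e₁ e₂ → Valid i₁ b₁ F₁ G₁ → Valid i₂ b₂ F₂ G₂ →
            Ins F₁ x₁ F₁′ e₁ → Ins F₂ x₂ F₂′ e₂ → endRow e₁ ≡ endRow e₂ → endCol e₁ ≡ endCol e₂ → box G₁ e₁ ≡ box G₂ e₂ → e₁ ≡ e₂
  end-ext (new r c) (new .r .c) v v′ h h′ refl refl q = refl
  end-ext (old r c) (old .r .c) v v′ h h′ refl refl q = refl
  end-ext (new r c) (old .r .c) v v′ h h′ refl refl q =
    ⊥-elim (Valid.filled v′ r c (proj₁ (Ins-Box h′)) (trans (sym q) (Valid.empty v r c (proj₁ (Ins-Box h)))))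
  end-ext (old r c) (new .r .c) v v′ h h′ refl refl q =
    ⊥-elim (Valid.filled v r c (proj₁ (Ins-Box h)) (trans q (Valid.empty v′ r c (proj₁ (Ins-Box h′)))))

  -- The last `i` was recorded at the rightmost occurrence of `i`, and a column contains `i` only
  -- once, so the box is determined. The remaining content of the box gives the kind of end, and
  -- determinism of reverse paths gives the letter and the earlier filling.
  Run-unique : ∀ {w w′ F F′ G G′ i b b′ y y′} → Run w F G i b y → Run w′ F′ G′ i b′ y′ → F ≈ F′ → G ≈ G′ → w ≡ w′
  Run-unique (start _ _ _ _ _) (start _ _ _ _ _) f g = refl
  Run-unique (start _ _ _ _ _) (snoc _ () _ _ _ _ _) f g
  Run-unique (snoc _ () _ _ _ _ _) (start _ _ _ _ _) f g
  Run-unique (next ρ) (next ρ′) f g = Run-unique ρ ρ′ f g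
  Run-unique (next ρ) (snoc {e = e} ρ′ p q _ h b≤ eq) f g =
    ⊥-elim (1+n≰n (proj₂ (Valid.bounded (Run-valid ρ) _ _ (subst (_ ∈_) (sym (g _ _)) (last-∈ ρ′ h b≤ p q eq)))))
  Run-unique (snoc {e = e} ρ p q _ h b≤ eq) (next ρ′) f g =
    ⊥-elim (1+n≰n (proj₂ (Valid.bounded (Run-valid ρ′) _ _ (subst (_ ∈_) (g _ _) (last-∈ ρ h b≤ p q eq)))))
  Run-unique {G = G} {G′} {i = i} σ@(snoc {G = G₀} {x = x} {e = e} ρ p q l h b≤ eq) σ′@(snoc {G = G₀′} {e = e′} ρ′ p′ q′ l′ h′ b≤′ eq′) f g = result
    where
    m₁ : i ∈ box G′ e
    m₁ = subst (i ∈_) (g _ _) (last-∈ ρ h b≤ p q eq)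
    m₂ : i ∈ box G e′
    m₂ = subst (i ∈_) (sym (g _ _)) (last-∈ ρ′ h′ b≤′ p′ q′ eq′)
    cols : endCol e ≡ endCol e′
    cols = ≤-antisym (s≤s⁻¹ (Valid.recent (Run-valid σ′) _ _ m₁)) (s≤s⁻¹ (Valid.recent (Run-valid σ) _ _ m₂))
    rows : endRow e ≡ endRow e′
    rows = same-row (Run-valid σ) (last-∈ ρ h b≤ p q eq) (subst (λ c → i ∈ G (endRow e′) c) (sym cols) m₂)
    boxes : box G₀ e ≡ box G₀′ e′
    boxes = ∷ʳ-injectiveˡ _ _ (trans (sym (last-split ρ h b≤ p q eq))
      (trans (g _ _) (trans (cong₂ G′ rows cols) (last-split ρ′ h′ b≤′ p′ q′ eq′))))
    ends : e ≡ e′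
    ends = end-ext e e′ (Run-valid ρ) (Run-valid ρ′) h h′ rows cols boxes
    result : _ ≡ _
    result with ends
    ... | refl with RStart-det e (Ins-cong f h) (Ins⇒RStart h′)
    ...   | f₀ , refl = cong (_∷ʳ (x , i)) (Run-unique ρ ρ′ f₀ g₀)
      where
      g₀ : G₀ ≈ G₀′
      g₀ r c with updView G₀ (endRow e) (endCol e) (box G₀ e ∷ʳ i) r c | updView G₀′ (endRow e) (endCol e) (box G₀′ e ∷ʳ i) r c
      ... | hit refl refl _ | _ = boxes
      ... | miss n _ | hit a b _ = ⊥-elim (n a b)
      ... | miss _ u | miss _ u′ = trans (sym u) (trans (eq r c) (trans (g r c) (trans (sym (eq′ r c)) u′)))

  -- Reconstruction of a run from a pair of fillings.

  module Peel {i b F G} (v : Valid i (suc b) F G) (r : ℕ) (p : i ∈ G r b) where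

    right : M ≤ F r (suc b)
    right = ≮⇒≥ λ lt → absurd lt
      where
      absurd : F r (suc b) < M → ⊥
      absurd lt with G r (suc b) in eq
      ... | [] = Valid.filled v r (suc b) lt eq
      ... | z ∷ _ with subst (z ∈_) (sym eq) (here refl)
      ...   | z∈ with ≤-antisym (Valid.rowW v r b p z∈) (proj₂ (Valid.bounded v r (suc b) z∈))
      ...     | refl = 1+n≰n (Valid.recent v r (suc b) z∈)

    below : M ≤ F (suc r) b
    below = ≮⇒≥ λ lt → absurd lt
      where
      absurd : F (suc r) b < M → ⊥
      absurd lt with G (suc r) b in eq
      ... | [] = Valid.filled v (suc r) b lt eq
      ... | z ∷ _ with subst (z ∈_) (sym eq) (here refl)
      ...   | z∈ = <⇒≱ (Valid.colS v r b p z∈) (proj₂ (Valid.bounded v (suc r) b z∈))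

    split = split-max (G r b) i (Valid.strict v r b) p (λ q → proj₂ (Valid.bounded v r b q))
    rest = proj₁ split

    -- If `i` is the only element, its insertion created the box.
    kind : List ℕ → End
    kind [] = new r b
    kind (_ ∷ _) = old r b

    e : End
    e = kind rest

    end-row : ∀ l → endRow (kind l) ≡ r
    end-row [] = refl
    end-row (_ ∷ _) = refl

    end-col : ∀ l → endCol (kind l) ≡ b
    end-col [] = refl
    end-col (_ ∷ _) = refl

    corner : Corner F e
    corner rewrite end-row rest | end-col rest = ∈⇒< v p , right , below

    reversed : Reversed F e
    reversed = reverse-insert e (Valid.inc v) (Valid.std v) (Valid.pos v) corner

    open Reversed reversed public

    G₀ : SVFilling
    G₀ = upd G r b rest

    private
      sub : ∀ q k {z} → z ∈ G₀ q k → z ∈ G q k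
      sub q k {z} h with updView G r b rest q k
      ... | miss _ u = subst (z ∈_) u h
      ... | hit refl refl u = subst (z ∈_) (sym (proj₁ (proj₂ split))) (∈-++⁺ˡ (subst (z ∈_) u h))

      empty₀ : ∀ q k → M ≤ F₀ q k → G₀ q k ≡ []
      empty₀ q k le with updView G r b rest q k
      ... | hit refl refl u = trans u (gone rest (Ins-Box ins))
        where
        gone : ∀ l → Box F₀ F (kind l) → l ≡ []
        gone [] _ = refl
        gone (_ ∷ _) (lt , _) = ⊥-elim (<⇒≱ lt le)
      ... | miss n u = trans u (Valid.empty v q k (Ins-grow ins q k
          (λ s t → n (trans s (end-row rest)) (trans t (end-col rest))) le))

      filled₀ : ∀ q k → F₀ q k < M → G₀ q k ≢ []
      filled₀ q k lt eq with updView G r b rest q k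
      ... | miss n u = Valid.filled v q k (≤-<-trans (F≤F₀ q k) lt) (trans (sym u) eq)
      ... | hit refl refl u = absurd rest (trans (sym u) eq) (Ins-Box ins)
        where
        absurd : ∀ l → l ≡ [] → Box F₀ F (kind l) → ⊥
        absurd [] _ (le , _) = <⇒≱ lt le

    valid₀ : Valid i b F₀ G₀
    valid₀ = record
      { inc = NI.inc (proj₁ (proj₂ ins)) ; std = NI.std (proj₁ (proj₂ ins))
      ; pos = λ q k → ≤-trans (Valid.pos v q k) (F≤F₀ q k)
      ; empty = empty₀
      ; filled = filled₀
      ; strict = strict₀
      ; bounded = λ q k h → Valid.bounded v q k (sub q k h)
      ; rowW = λ q k h h′ → Valid.rowW v q k (sub q k h) (sub q (suc k) h′)
      ; colS = λ q k h h′ → Valid.colS v q k (sub q k h) (sub (suc q) k h′)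
      ; recent = recent₀
      }
      where
      strict₀ : ∀ q k → T (strictB (G₀ q k))
      strict₀ q k with updView G r b rest q k
      ... | hit _ _ u = subst (λ l → T (strictB l)) (sym u) (proj₁ (proj₂ (proj₂ split)))
      ... | miss _ u = subst (λ l → T (strictB l)) (sym u) (Valid.strict v q k)
      recent₀ : ∀ q k → i ∈ G₀ q k → k < b
      recent₀ q k h with m≤n⇒m<n∨m≡n (s≤s⁻¹ (Valid.recent v q k (sub q k h)))
      ... | inj₁ lt = lt
      ... | inj₂ refl with same-row v (sub q k h) p
      ...   | refl = ⊥-elim (<-irrefl refl (proj₂ (proj₂ (proj₂ split)) (subst (i ∈_) (upd-hit G r b rest) h)))

    restore : enter G₀ e i ≈ G
    restore rewrite end-row rest | end-col rest | upd-hit G r b rest = upd-undo G r b rest _ (proj₁ (proj₂ split))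

  search : ∀ {i b F G} → Valid i b F G → ∀ c → (∃ λ r → i ∈ G r c) ⊎ (∀ r → i ∈ G r c → ⊥)
  -- By `col-index` the rows from `M` on lie outside the diagram, so `M` rows are enough.
  search {i} {F = F} {G} v c with go M
    where
    go : ∀ n → (∃ λ r → i ∈ G r c) ⊎ (∀ r → r < n → i ∈ G r c → ⊥)
    go zero = inj₂ (λ _ ())
    go (suc n) with i ∈? G n c | go n
    ... | yes p | _ = inj₁ (n , p)
    ... | no _ | inj₁ h = inj₁ h
    ... | no p | inj₂ h = inj₂ λ r lt q → split r (m≤n⇒m<n∨m≡n (s≤s⁻¹ lt)) q
      where
      split : ∀ r → r < n ⊎ r ≡ n → i ∈ G r c → ⊥
      split r (inj₁ lt) q = h r lt q
      split r (inj₂ refl) q = p q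
  ... | inj₁ h = inj₁ h
  ... | inj₂ h = inj₂ λ r p → h r (≤-<-trans (col-index (Valid.inc v) r c) (∈⇒< v p)) p

  hollow : ∀ {F G} → Valid 0 0 F G → ∀ r c → G r c ≡ []
  hollow {G = G} v r c with G r c in eq
  ... | [] = refl
  ... | z ∷ _ with Valid.bounded v r c (subst (z ∈_) (sym eq) (here refl))
  ...   | a , b = ⊥-elim (<⇒≱ a b)

  -- The column bound `M` is the trivial one: a box in column `c` has an entry at least `c`, so
  -- every column of the diagram is below `M`.
  lower : ∀ {i F G} → Valid (suc i) 0 F G → Valid i M F G
  lower v = record
    { Valid v
    ; bounded = λ r c p → proj₁ (Valid.bounded v r c p) ,
        s≤s⁻¹ (≤∧≢⇒< (proj₂ (Valid.bounded v r c p)) (λ { refl → n≮0 (Valid.recent v r c p) }))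
    ; recent = λ r c p → ≤-<-trans (row-index (Valid.inc v) r c) (∈⇒< v p)
    }

  narrow : ∀ {i b F G} → Valid i (suc b) F G → (∀ r → i ∈ G r b → ⊥) → Valid i b F G
  narrow {i} {b} {G = G} v none = record { Valid v ; recent = earlier }
    where
    earlier : ∀ r c → i ∈ G r c → c < b
    earlier r c p with m≤n⇒m<n∨m≡n (s≤s⁻¹ (Valid.recent v r c p))
    ... | inj₁ lt = lt
    ... | inj₂ refl = ⊥-elim (none r p)

  -- Recursion on `(i , b)`: the occurrences of the largest letter are peeled from right to left, at
  -- most one in each column. At `b = 0` none is left and `i` drops.
  build : ∀ i b {F G} → Valid i b F G → ∃ λ w → ∃ λ b′ → ∃ λ y → b′ ≤ b × Run w F G i b′ y
  build zero zero v = [] , 0 , M , z≤n ,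
    start (Valid.inc v) (Valid.std v) (Valid.pos v) (λ r c → ≮⇒≥ (λ lt → Valid.filled v r c lt (hollow v r c))) (hollow v)
  build (suc i) zero v with build i M (lower v)
  ... | w , b′ , y , _ , ρ = w , 0 , M , z≤n , next ρ
  build i (suc b) v with search v b
  ... | inj₂ none with build i b (narrow v none)
  ...   | w , b′ , y , le , ρ = w , b′ , y , m≤n⇒m≤1+n le , ρ
  build i (suc b) {F} {G} v | inj₁ (r , p) with build i b (Peel.valid₀ v r p)
  ... | w , b′ , y , le , ρ = _ , _ , x , s≤s (≤-reflexive (end-col rest)) ,
      snoc ρ (≤-trans (proj₁ bnd) (proj₂ bnd)) x≥1 (smaller (Run-last ρ)) ins (≤-trans le (≤-reflexive (sym (end-col rest)))) restore
    where
    open Peel v r p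
    bnd = Valid.bounded v r b p
    -- Either no `i` precedes, and the bound is `M`, or the preceding `i` ended further left, and
    -- `reverse-pieri` shows that the letters decrease.
    smaller : (b′ ≡ 0 × y ≡ M) ⊎ (∃ λ F₁ → ∃ λ e₁ → Ins F₁ y F₀ e₁ × b′ ≡ suc (endCol e₁)) → x < y
    smaller (inj₁ (_ , refl)) = NI.x<M (proj₁ (proj₂ ins))
    smaller (inj₂ (F₁ , e₁ , h , refl)) =
      reverse-pieri e e₁ (Valid.inc v) (Valid.std v) corner retrace (Valid.inc valid₀) (Valid.std valid₀)
        (Ins-corner h) (Ins⇒RStart h) (subst (endCol e₁ <_) (sym (end-col rest)) le)

-- Recording tableaux as lists of rows.

boxCell : List ℕ → Maybe (List ℕ)
boxCell [] = nothing
boxCell l@(_ ∷ _) = just l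

boxCell-just : ∀ l {B} → boxCell l ≡ just B → l ≡ B × 1 ≤ length B
boxCell-just (_ ∷ _) refl = refl , s≤s z≤n

boxCell-nothing : ∀ l → boxCell l ≡ nothing → l ≡ []
boxCell-nothing [] _ = refl

boxCell-≢[] : ∀ l → l ≢ [] → boxCell l ≡ just l
boxCell-≢[] [] n = ⊥-elim (n refl)
boxCell-≢[] (_ ∷ _) _ = refl

-- `boxCell` reads the empty list as the absence of a box, so an `SVFilling` describes diagram and
-- entries at once.
record RepQ (q : SVTab) (G : SVFilling) : Set where
  field
    cells : ∀ r c → at q r c ≡ boxCell (G r c)
    rows : NonEmptyRows q

RepQ-cong : ∀ {q G G′} → G ≈ G′ → RepQ q G → RepQ q G′
RepQ-cong e ρ .RepQ.cells r c = trans (RepQ.cells ρ r c) (cong boxCell (e r c))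
RepQ-cong e ρ .RepQ.rows = RepQ.rows ρ

RepQ-unique : ∀ {q q′ G} → RepQ q G → RepQ q′ G → q ≡ q′
RepQ-unique {q} {q′} ρ ρ′ = tab-ext q q′ (RepQ.rows ρ) (RepQ.rows ρ′) (λ r c → trans (RepQ.cells ρ r c) (sym (RepQ.cells ρ′ r c)))

RepQ-≈ : ∀ {q G G′} → RepQ q G → RepQ q G′ → G ≈ G′
RepQ-≈ {G = G} {G′} ρ ρ′ r c with G r c | G′ r c | trans (sym (RepQ.cells ρ r c)) (RepQ.cells ρ′ r c)
... | [] | [] | _ = refl
... | _ ∷ _ | _ ∷ _ | e = just-injective e

nth-map : ∀ {A B : Set} (f : A → B) l k → nth (map f l) k ≡ Maybe.map f (nth l k)
nth-map f [] k = refl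
nth-map f (_ ∷ l) zero = refl
nth-map f (_ ∷ l) (suc k) = nth-map f l k

length-by-nothing : ∀ {A B : Set} (l : List A) (l′ : List B) → (∀ c → nth l c ≡ nothing → nth l′ c ≡ nothing) → length l′ ≤ length l
length-by-nothing l l′ h = nothing-nth l′ _ (h _ (≥-nth l _ ≤-refl))

shape-≡ : ∀ {A B : Set} (t : Tab A) (t′ : Tab B) → NonEmptyRows t → NonEmptyRows t′ →
          (∀ r c → at t r c ≡ nothing → at t′ r c ≡ nothing) → (∀ r c → at t′ r c ≡ nothing → at t r c ≡ nothing) → shape t ≡ shape t′
shape-≡ t t′ ne ne′ f g = nth-ext _ _ (λ r → trans (nth-map length t r) (trans (go r) (sym (nth-map length t′ r))))
  where
  go : ∀ r → Maybe.map length (nth t r) ≡ Maybe.map length (nth t′ r)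
  go r with nth t r in p | nth t′ r in p′
  ... | nothing | nothing = refl
  ... | just l | just l′ = cong just (≤-antisym
    (length-by-nothing l′ l (λ c e → trans (sym (at-nth t r p c)) (g r c (trans (at-nth t′ r p′ c) e))))
    (length-by-nothing l l′ (λ c e → trans (sym (at-nth t′ r p′ c)) (f r c (trans (at-nth t r p c) e)))))
  ... | just l | nothing with trans (sym (nth-hole t r ne (g r 0 (at-nothing t′ r p′ 0)))) p
  ...   | ()
  go r | nothing | just l with trans (sym (nth-hole t′ r ne′ (f r 0 (at-nothing t r p 0)))) p′
  ...   | ()

shape-at : ∀ {A B : Set} (t : Tab A) (t′ : Tab B) → shape t ≡ shape t′ → ∀ r c → at t r c ≡ nothing → at t′ r c ≡ nothing
shape-at t t′ e r c h with nth t r | nth t′ r | trans (sym (nth-map length t r)) (trans (cong (λ s → nth s r) e) (nth-map length t′ r))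
... | _ | nothing | _ = refl
... | just l | just l′ | q = ≥-nth l′ c (subst (_≤ c) (just-injective q) (nothing-nth l c h))

choice-∈ : ∀ {t q} → Choice t q → ∀ r c {x} → at t r c ≡ just x → ∃ λ B → at q r c ≡ just B × x ∈ B
choice-∈ (p ∷ _) zero c e = line p c e
  where
  line : ∀ {l m} → Pointwise _∈_ l m → ∀ c {x} → nth l c ≡ just x → ∃ λ B → nth m c ≡ just B × x ∈ B
  line (p ∷ _) zero refl = _ , refl , p
  line (_ ∷ ps) (suc c) e = line ps c e
choice-∈ (_ ∷ ps) (suc r) c e = choice-∈ ps r c e

chooseRow : (ℕ → ℕ) → List (List ℕ) → List ℕ
chooseRow χ [] = []
chooseRow χ (_ ∷ l) = χ 0 ∷ chooseRow (λ c → χ (suc c)) l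

choose : (ℕ → ℕ → ℕ) → SVTab → Tab ℕ
choose χ [] = []
choose χ (l ∷ q) = chooseRow (χ 0) l ∷ choose (λ r → χ (suc r)) q

choose-choice : ∀ χ q → (∀ r c {B} → at q r c ≡ just B → χ r c ∈ B) → Choice (choose χ q) q
choose-choice χ [] h = []
choose-choice χ (l ∷ q) h = line (χ 0) l (h 0) ∷ choose-choice _ q (λ r → h (suc r))
  where
  line : ∀ χ l → (∀ c {B} → nth l c ≡ just B → χ c ∈ B) → Pointwise _∈_ (chooseRow χ l) l
  line χ [] h = []
  line χ (_ ∷ l) h = h 0 refl ∷ line _ l (λ c → h (suc c))

at-choose : ∀ χ q r c {B} → at q r c ≡ just B → at (choose χ q) r c ≡ just (χ r c)
at-choose χ (l ∷ q) zero c e = line (χ 0) l c e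
  where
  line : ∀ χ l c {B} → nth l c ≡ just B → nth (chooseRow χ l) c ≡ just (χ c)
  line χ (_ ∷ l) zero e = refl
  line χ (_ ∷ l) (suc c) e = line _ l c e
at-choose χ (l ∷ q) (suc r) c e = at-choose _ q r c e

some : List ℕ → ℕ
some [] = 0
some (x ∷ _) = x

some-∈ : ∀ l → 1 ≤ length l → some l ∈ l
some-∈ (x ∷ l) _ = here refl

module Record (M : ℕ) where

  open Paths M
  open Concrete M
  open Recording M

  module _ {q G} (κ : RepQ q G) where

    box-at : ∀ {r c B} → at q r c ≡ just B → G r c ≡ B × 1 ≤ length B
    box-at {r} {c} e = boxCell-just (G r c) (trans (sym (RepQ.cells κ r c)) e)

    at-box : ∀ {r c} → G r c ≢ [] → at q r c ≡ just (G r c)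
    at-box {r} {c} n = trans (RepQ.cells κ r c) (boxCell-≢[] (G r c) n)

    at-∈ : ∀ {r c x} → x ∈ G r c → at q r c ≡ just (G r c)
    at-∈ {r} {c} {x} p = at-box (λ e → none (subst (x ∈_) e p))
      where
      none : x ∈ [] → ⊥
      none ()

  -- As `i` exceeds all elements of its box, `insSet` puts it at the end, just as `enter` does. A
  -- missing box can be appended because its left and upper neighbours belong to the new diagram,
  -- hence already to the old one.
  addQ-Rep : ∀ {i b F G x F′ e q} → Valid i b F G → 1 ≤ i → 1 ≤ x → (h : Ins F x F′ e) → b ≤ endCol e → RepQ q G →
             RepQ (addQ q (endRow e) (endCol e) i) (enter G e i)
  addQ-Rep {i} {b} {F} {G} {x} {F′} {e} {q} v 1≤i 1≤x h b≤ κ with at q (endRow e) (endCol e) in eq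
  ... | just B = record { rows = rows-modify q er ec (insSet i) (RepQ.rows κ) ; cells = cells }
    where
    er = endRow e
    ec = endCol e
    cells : ∀ r c → at (modify q er (λ row → modify row ec (insSet i))) r c ≡ boxCell (enter G e i r c)
    cells r c with updView G er ec (box G e ∷ʳ i) r c
    ... | miss n u = trans (at-modify-≢ q er ec (insSet i) r c n) (trans (RepQ.cells κ r c) (cong boxCell (sym u)))
    ... | hit refl refl u = trans (at-modify q er ec (insSet i) eq)
      (trans (cong just (trans (cong (insSet i) (sym (proj₁ (box-at κ eq)))) (insSet-snoc i (box G e) (Step.box-< v 1≤i 1≤x h b≤))))
             (trans (sym (boxCell-≢[] _ (∷ʳ≢[] (box G e)))) (cong boxCell (sym u))))
  ... | nothing = subst (λ o → RepQ (Maybe.fromMaybe q o) (enter G e i)) (sym (Appended.eq A))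
      (record { rows = Appended.rows A (RepQ.rows κ) ; cells = cells })
    where
    er = endRow e
    ec = endCol e
    inside : ∀ r c → (r ≡ er → c ≡ ec → ⊥) → F′ r c < M → ∃ λ B → at q r c ≡ just B
    inside r c n lt = _ , at-box κ (Valid.filled v r c (≰⇒> (λ le → <⇒≱ lt (Ins-grow h r c n le))))
    F′-Inc : Inc F′
    F′-Inc = Valid.inc (Step.valid v 1≤i 1≤x h b≤)
    A : Appended q er ec (i ∷ [])
    A = append q er ec (i ∷ []) (addable q er ec (RepQ.rows κ) eq
      (λ r z → inside r ec (λ z′ _ → 1+n≢n (trans (sym z) (sym z′)))
        (<-trans (subst (λ s → F′ r ec < F′ s ec) (sym z) (col F′-Inc r ec)) (proj₁ (Ins-corner h))))
      (λ c z → inside er c (λ _ z′ → 1+n≢n (trans (sym z) (sym z′)))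
        (<-trans (subst (λ s → F′ er c < F′ er s) (sym z) (row F′-Inc er c)) (proj₁ (Ins-corner h)))))
    cells : ∀ r c → at (Appended.t′ A) r c ≡ boxCell (enter G e i r c)
    cells r c with updView G er ec (box G e ∷ʳ i) r c
    ... | miss n u = trans (Appended.others A r c n) (trans (RepQ.cells κ r c) (cong boxCell (sym u)))
    ... | hit refl refl u rewrite u | boxCell-nothing (box G e) (trans (sym (RepQ.cells κ er ec)) eq) = Appended.added A

  Run-hecke : ∀ {w F G i b y} → Run w F G i b y →
              ∃ λ p → ∃ λ q → foldl heckeStep ([] , []) w ≡ (p , q) × Rep p F × RepQ q G
  Run-hecke {F = F} (start _ _ _ f g) = [] , [] , refl ,
    record { cells = λ r c → sym (cell-out {F} (f r c)) ; rows = λ _ _ () } ,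
    record { cells = λ r c → sym (cong boxCell (g r c)) ; rows = λ _ _ () }
  Run-hecke (next ρ) = Run-hecke ρ
  Run-hecke (snoc {w} {i = i} {x = x} {e = e} ρ p q _ h b≤ eq) with Run-hecke ρ
  ... | P , Q , s , α , κ with heckeInsert-N (proj₁ (proj₂ h)) α (proj₂ (proj₂ h))
  ...   | P′ , z , α′ = P′ , addQ Q (endRow e) (endCol e) i ,
    trans (foldl-∷ʳ heckeStep _ (x , i) w) (trans (cong (λ s → heckeStep s (x , i)) s) step) , α′ ,
    RepQ-cong eq (addQ-Rep (Run-valid ρ) p q h b≤ κ)
    where
    step : heckeStep (P , Q) (x , i) ≡ (P′ , addQ Q (endRow e) (endCol e) i)
    step rewrite z = refl

  module _ {n b F G p q} (v : Valid n b F G) (α : Rep p F) (κ : RepQ q G) where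

    same-shape : shape p ≡ shape q
    same-shape = shape-≡ p q (Rep.rows α) (RepQ.rows κ)
      (λ r c e → trans (RepQ.cells κ r c) (cong boxCell (Valid.empty v r c (cell-nothing {F} (trans (sym (Rep.cells α r c)) e)))))
      (λ r c e → at-out α (≮⇒≥ (λ lt → Valid.filled v r c lt (boxCell-nothing (G r c) (trans (sym (RepQ.cells κ r c)) e)))))

    semistandard : IsSemistandardSetValued q
    semistandard = youngB⁺ q (RepQ.rows κ) supported , boxes , choices
      where
      supported : Supported q
      supported r c e with box-at κ {suc r} {c} e
      ... | refl , le = _ , at-box κ (Valid.filled v r c (<-trans (col (Valid.inc v) r c) (∈⇒< v {suc r} {c} (some-∈ _ le))))
      boxes : ∀ r c B → at q r c ≡ just B → T (strictB B) × (1 ≤ length B) × (∀ x → x ∈ B → 1 ≤ x)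
      boxes r c B e with box-at κ {r} {c} e
      ... | refl , le = Valid.strict v r c , le , λ x m → proj₁ (Valid.bounded v r c m)
      member : ∀ {t} → Choice t q → ∀ r c {x} → at t r c ≡ just x → x ∈ G r c
      member ch r c e with choice-∈ ch r c e
      ... | B , e′ , m with box-at κ {r} {c} e′
      ...   | refl , _ = m
      choices : ∀ t → Choice t q → RowsWeak t × ColsStrict t
      choices t ch = (λ r c x y e e′ → Valid.rowW v r c (member ch r c e) (member ch r (suc c) e′)) ,
                     (λ r c x y e e′ → Valid.colS v r c (member ch r c e) (member ch (suc r) c e′))

    entries-in : EntriesIn n q
    entries-in r c B x e m with box-at κ {r} {c} e
    ... | refl , _ = Valid.bounded v r c m

  boxes : SVTab → SVFilling
  boxes q r c = Maybe.fromMaybe [] (at q r c)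

  module _ {n p q F} (i : Inc F) (s : Std F) (pos : Positive F) (α : Rep p F) (sh : shape p ≡ shape q)
           (ss : IsSemistandardSetValued q) (en : EntriesIn n q) where

    private
      G = boxes q

      box-nonempty : ∀ r c {B} → at q r c ≡ just B → 1 ≤ length B
      box-nonempty r c e = proj₁ (proj₂ (proj₁ (proj₂ ss) r c _ e))

    boxes-RepQ : RepQ q (boxes q)
    boxes-RepQ .RepQ.rows = proj₁ (youngB⁻ q (proj₁ ss))
    boxes-RepQ .RepQ.cells r c with at q r c in e
    ... | nothing = refl
    ... | just [] = ⊥-elim (n≮0 (box-nonempty r c e))
    ... | just (_ ∷ _) = refl

    private
      κ = boxes-RepQ

      -- Semistandardness speaks of choices over the whole tableau. Elements of two different boxes
      -- are completed to such a choice by the first element of every other box.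
      pick : ∀ r c {x y} r′ c′ → x ∈ G r c → y ∈ G r′ c′ → (r ≡ r′ → c ≡ c′ → ⊥) →
             ∃ λ t → Choice t q × at t r c ≡ just x × at t r′ c′ ≡ just y
      pick r c {x} {y} r′ c′ m m′ ne = choose χ q , choose-choice χ q legal ,
          trans (at-choose χ q r c (at-∈ κ m)) (cong just (upd-hit _ r c x)) ,
          trans (at-choose χ q r′ c′ (at-∈ κ m′))
                (cong just (trans (upd-miss _ r c x r′ c′ (λ a b → ne (sym a) (sym b))) (upd-hit _ r′ c′ y)))
        where
        base χ : ℕ → ℕ → ℕ
        base r c = some (G r c)
        χ = upd (upd base r′ c′ y) r c x
        legal : ∀ s d {B} → at q s d ≡ just B → χ s d ∈ B
        legal s d e with box-at κ {s} {d} e | updView (upd base r′ c′ y) r c x s d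
        ... | refl , _ | hit refl refl u = subst (_∈ G r c) (sym u) m
        ... | refl , le | miss _ u with updView base r′ c′ y s d
        ...   | hit refl refl u′ = subst (_∈ G r′ c′) (sym (trans u u′)) m′
        ...   | miss _ u′ = subst (_∈ G s d) (sym (trans u u′)) (some-∈ _ le)

    boxes-Valid : Valid n M F (boxes q)
    boxes-Valid = record
      { inc = i ; std = s ; pos = pos
      ; empty = λ r c le → cong (Maybe.fromMaybe []) (shape-at p q sh r c (at-out α le))
      ; filled = λ r c lt e → absurd r c lt e
      ; strict = strict
      ; bounded = λ r c {x} m → en r c _ x (at-∈ κ m) m
      ; rowW = λ r c m m′ → case-row r c m m′
      ; colS = λ r c m m′ → case-col r c m m′
      ; recent = λ r c m → ≤-<-trans (row-index i r c) (≰⇒> (λ le → out r c le m))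
      }
      where
      absurd : ∀ r c → F r c < M → G r c ≡ [] → ⊥
      absurd r c lt e with trans (sym (at-in α lt)) (shape-at q p (sym sh) r c
        (trans (RepQ.cells κ r c) (cong boxCell e)))
      ... | ()
      out : ∀ r c → M ≤ F r c → ∀ {x} → x ∈ G r c → ⊥
      out r c le {x} m with subst (x ∈_) (cong (Maybe.fromMaybe []) (shape-at p q sh r c (at-out α le))) m
      ... | ()
      strict : ∀ r c → T (strictB (G r c))
      strict r c with at q r c in e
      ... | nothing = tt
      ... | just B = proj₁ (proj₁ (proj₂ ss) r c B e)
      case-row : ∀ r c {x y} → x ∈ G r c → y ∈ G r (suc c) → x ≤ y
      case-row r c m m′ with pick r c r (suc c) m m′ (λ _ z → 1+n≢n (sym z))
      ... | t , ch , e , e′ = proj₁ (proj₂ (proj₂ ss) t ch) r c _ _ e e′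
      case-col : ∀ r c {x y} → x ∈ G r c → y ∈ G (suc r) c → x < y
      case-col r c m m′ with pick r c (suc r) c m m′ (λ z _ → 1+n≢n (sym z))
      ... | t , ch , e , e′ = proj₂ (proj₂ (proj₂ ss) t ch) r c _ _ e e′

-- Words, tableaux and the correspondence

letters : (ℕ → Bool) → ℕ → List ℕ
letters g zero = []
letters g (suc t) = if g (suc t) then suc t ∷ letters g t else letters g t

letters-true : ∀ g t → g (suc t) ≡ true → letters g (suc t) ≡ suc t ∷ letters g t
letters-true g t e rewrite e = refl

letters-false : ∀ g t → g (suc t) ≡ false → letters g (suc t) ≡ letters g t
letters-false g t e rewrite e = refl

letters-∈⁺ : ∀ g t u → g (suc u) ≡ true → u < t → suc u ∈ letters g t
letters-∈⁺ g (suc t) u e lt with m≤n⇒m<n∨m≡n (s≤s⁻¹ lt)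
... | inj₂ refl rewrite e = here refl
... | inj₁ lt′ with g (suc t)
...   | true = there (letters-∈⁺ g t u e lt′)
...   | false = letters-∈⁺ g t u e lt′

letters-∈⁻ : ∀ g t {u} → u ∈ letters g t → g u ≡ true
letters-∈⁻ g (suc t) p with g (suc t) in e
letters-∈⁻ g (suc t) (here refl) | true = e
letters-∈⁻ g (suc t) (there p) | true = letters-∈⁻ g t p
letters-∈⁻ g (suc t) p | false = letters-∈⁻ g t p

letters-cong : ∀ {g h} t → (∀ u → u ≤ t → g u ≡ h u) → letters g t ≡ letters h t
letters-cong zero e = refl
letters-cong {g} {h} (suc t) e rewrite e (suc t) ≤-refl | letters-cong {g} {h} t (λ u le → e u (m≤n⇒m≤1+n le)) = refl

letters-none : ∀ {g} t → (∀ u → u ≤ t → g u ≡ false) → letters g t ≡ []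
letters-none zero e = refl
letters-none {g} (suc t) e = trans (letters-false g t (e (suc t) ≤-refl)) (letters-none t (λ u le → e u (m≤n⇒m≤1+n le)))

letters-snoc : ∀ {g h} x t → suc x ≤ t → h (suc x) ≡ true → (∀ u → u ≢ suc x → h u ≡ g u) → (∀ u → u ≤ suc x → g u ≡ false) →
               letters h t ≡ letters g t ∷ʳ suc x
letters-snoc {g} {h} x (suc t) le e same none with m≤n⇒m<n∨m≡n (s≤s⁻¹ le)
... | inj₂ refl = trans (letters-true h x e)
  (trans (cong (suc x ∷_) (letters-none x (λ u l → trans (same u (λ z → 1+n≰n (subst (_≤ x) z l))) (none u (m≤n⇒m≤1+n l)))))
         (sym (cong (_∷ʳ suc x) (letters-none {g} (suc x) none))))
... | inj₁ lt rewrite same (suc t) (λ z → <-irrefl (sym (suc-injective z)) lt) | letters-snoc {g} {h} x t lt e same none with g (suc t)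
...   | true = refl
...   | false = refl

-- The equation `j + m′ ≡ suc m` says that the value `m + 1 - j` of the head factor is the number of
-- remaining factors.
lettersFrom-word : ∀ n m k j m′ β → j + m′ ≡ suc m → k < n → lettersFrom m (suc k) j (word n m′ β) ≡ letters (β k) m′
lettersFrom-word n m k j zero β e lt = refl
lettersFrom-word n m k j (suc m′) β e lt
  rewrite mem-column n (λ q → β q (suc m′)) k lt
        | lettersFrom-word n m k (suc j) m′ β (trans (sym (+-suc j m′)) e) lt
        | trans (cong (_∸ j) (sym e)) (m+n∸m≡n j (suc m′)) = refl

Aᵢ-word : ∀ n m k β → k < n → Aᵢ (suc k) (word n m β) ≡ letters (β k) m
Aᵢ-word n m k β lt = lettersFrom-word n m k 1 m β refl lt

biletters : ℕ → Rows → ℕ → List (ℕ × ℕ)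
biletters m β zero = []
biletters m β (suc k) = biletters m β k ++ map (_, suc k) (letters (β k) m)

biword-word : ∀ n m β → biword (word n m β) ≡ biletters m β n
biword-word n m β = go n ≤-refl
  where
  h : ℕ → List (ℕ × ℕ)
  h i = map (_, i) (Aᵢ i (word n m β))
  go : ∀ k → k ≤ n → concatMap h (map suc (upTo k)) ≡ biletters m β k
  go zero le = refl
  go (suc k) le = begin
    concatMap h (map suc (upTo (suc k)))                ≡⟨ cong (λ l → concatMap h (map suc l)) (sym (upTo-∷ʳ k)) ⟩
    concatMap h (map suc (upTo k ∷ʳ k))                 ≡⟨ cong (concatMap h) (map-++ suc (upTo k) (k ∷ [])) ⟩
    concatMap h (map suc (upTo k) ∷ʳ suc k)             ≡⟨ concatMap-++ h (map suc (upTo k)) (suc k ∷ []) ⟩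
    concatMap h (map suc (upTo k)) ++ (h (suc k) ++ []) ≡⟨ cong₂ _++_ (go k (≤-trans (n≤1+n k) le))
                                                             (trans (++-identityʳ _) (cong (map (_, suc k)) (Aᵢ-word n m k β le))) ⟩
    biletters m β (suc k) ∎
    where open ≡-Reasoning

biletters-cong : ∀ {m β γ} k → (∀ q u → q < k → β q u ≡ γ q u) → biletters m β k ≡ biletters m γ k
biletters-cong zero e = refl
biletters-cong {m} (suc k) e = cong₂ _++_ (biletters-cong k (λ q u lt → e q u (m≤n⇒m≤1+n lt)))
  (cong (map (_, suc k)) (letters-cong m (λ u _ → e k u ≤-refl)))

biletters-∈⁺ : ∀ m β n q u → q < n → u < m → β q (suc u) ≡ true → (suc u , suc q) ∈ biletters m β n
biletters-∈⁺ m β (suc n) q u lt um e with m≤n⇒m<n∨m≡n (s≤s⁻¹ lt)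
... | inj₁ lt′ = ∈-++⁺ˡ (biletters-∈⁺ m β n q u lt′ um e)
... | inj₂ refl = ∈-++⁺ʳ (biletters m β q) (∈-map⁺ (_, suc q) (letters-∈⁺ (β q) m u e um))

biletters-∈⁻ : ∀ m β n q {u} → (u , suc q) ∈ biletters m β n → β q u ≡ true
biletters-∈⁻ m β (suc n) q p with ∈-++⁻ (biletters m β n) p
... | inj₁ p′ = biletters-∈⁻ m β n q p′
... | inj₂ p′ with ∈-map⁻ (_, suc n) p′
...   | _ , p″ , refl = letters-∈⁻ (β n) m p″

biletters-injective : ∀ m n {β γ} → biletters m β n ≡ biletters m γ n → word n m β ≡ word n m γ
biletters-injective m n {β} {γ} e = word-cong n m same
  where
  same : ∀ q t → q < n → 1 ≤ t → t ≤ m → β q t ≡ γ q t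
  same q (suc t) lt _ le = Bool-ext
    (λ h → biletters-∈⁻ m γ n q (subst (_ ∈_) e (biletters-∈⁺ m β n q t lt le h)))
    (λ h → biletters-∈⁻ m β n q (subst (_ ∈_) (sym e) (biletters-∈⁺ m γ n q t lt le h)))

toRows : ∀ {n m} → SVW n m → Rows
toRows [] q t = false
toRows {m = suc m} (s ∷ S) q t = if t ≡ᵇ suc m then mem (suc q) s else toRows S q t

column-mem : ∀ {n} (s : Subset n) → column n (λ q → mem (suc q) s) ≡ s
column-mem [] = refl
column-mem (b ∷ s) = cong (b ∷_) (column-mem s)

word-toRows : ∀ {n m} (S : SVW n m) → word n m (toRows S) ≡ S
word-toRows [] = refl
word-toRows {n} {suc m} (s ∷ S) = cong₂ _∷_
  (trans (column-cong n (λ q _ → cong (λ b → if b then mem (suc q) s else toRows S q (suc m)) (≡ᵇ-refl m))) (column-mem s))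
  (trans (word-cong n m (λ q t _ _ le → cong (λ b → if b then mem (suc q) s else toRows S q t)
           (≡ᵇ-false {t} {suc m} (λ e → 1+n≰n (subst (_≤ m) e le))))) (word-toRows S))

-- The tableau `tab` in terms of rows of values.

ascending : (ℕ → Bool) → ℕ → List ℕ
ascending g zero = []
ascending g (suc t) = if g (suc t) then ascending g t ∷ʳ suc t else ascending g t

reverse-letters : ∀ g t → reverse (letters g t) ≡ ascending g t
reverse-letters g zero = refl
reverse-letters g (suc t) with g (suc t)
... | true = trans (unfold-reverse (suc t) (letters g t)) (cong (_∷ʳ suc t) (reverse-letters g t))
... | false = reverse-letters g t

nth-∈ : ∀ {A : Set} (l : List A) c {x} → nth l c ≡ just x → x ∈ l
nth-∈ (_ ∷ l) zero refl = here refl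
nth-∈ (_ ∷ l) (suc c) e = there (nth-∈ l c e)

∈-nth : ∀ {A : Set} {l : List A} {x} → x ∈ l → ∃ λ c → nth l c ≡ just x
∈-nth (here refl) = 0 , refl
∈-nth (there p) with ∈-nth p
... | c , e = suc c , e

ascending-∈⁻ : ∀ g t {u} → u ∈ ascending g t → g u ≡ true × 1 ≤ u × u ≤ t
ascending-∈⁻ g (suc t) p with g (suc t) in e
... | false with ascending-∈⁻ g t p
...   | a , b , c = a , b , m≤n⇒m≤1+n c
ascending-∈⁻ g (suc t) p | true with ∈-snoc⁻ (ascending g t) p
... | inj₂ refl = e , s≤s z≤n , ≤-refl
... | inj₁ p′ with ascending-∈⁻ g t p′
...   | a , b , c = a , b , m≤n⇒m≤1+n c

ascending-∈⁺ : ∀ g t u → g (suc u) ≡ true → u < t → suc u ∈ ascending g t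
ascending-∈⁺ g (suc t) u e lt with m≤n⇒m<n∨m≡n (s≤s⁻¹ lt)
... | inj₂ refl rewrite e = ∈-++⁺ʳ (ascending g u) (here refl)
... | inj₁ lt′ with g (suc t)
...   | true = ∈-++⁺ˡ (ascending-∈⁺ g t u e lt′)
...   | false = ascending-∈⁺ g t u e lt′

module _ {F : Filling} (i : Inc F) (pos : Positive F) where

  ascending-entries : ∀ r t → length (ascending (entries F r) t) ≡ count F r t ×
                      (∀ c → c < count F r t → nth (ascending (entries F r) t) c ≡ just (F r c))
  ascending-entries r zero = refl , λ _ ()
  ascending-entries r (suc t) with F r (count F r t) ≡ᵇ suc t in e | ascending-entries r t
  ... | false | h = h
  ... | true | l , h = trans (length-++ (ascending (entries F r) t)) (trans (+-comm _ 1) (cong suc l)) , go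
    where
    go : ∀ c → c < suc (count F r t) → nth (ascending (entries F r) t ∷ʳ suc t) c ≡ just (F r c)
    go c lt with m≤n⇒m<n∨m≡n (s≤s⁻¹ lt)
    ... | inj₁ lt′ = trans (nth-snoc-≢ (ascending (entries F r) t) (suc t) c (λ z → <-irrefl (trans z l) lt′)) (h c lt′)
    ... | inj₂ refl = trans (subst (λ k → nth (ascending (entries F r) t ∷ʳ suc t) k ≡ just (suc t)) l (nth-snoc (ascending (entries F r) t) (suc t)))
                            (cong just (sym (≡ᵇ-true⇒≡ e)))

  nth-ascending : ∀ m r c → nth (ascending (entries F r) m) c ≡ Concrete.cell (suc m) F r c
  nth-ascending m r c with F r c <? suc m | ascending-entries r m
  ... | yes p | l , h = trans (h c (row-reflects i r (≤-<-trans (s≤s⁻¹ p) (proj₂ (count-spec i pos r m)))))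
                              (sym (Concrete.cell-in (suc m) {F} p))
  ... | no p | l , h = trans (≥-nth (ascending (entries F r) m) c (subst (_≤ c) (sym l) (≮⇒≥ λ lt → p (s≤s (bound (count F r m) lt (proj₁ (count-spec i pos r m)))))))
                             (sym (Concrete.cell-out (suc m) {F} (≮⇒≥ p)))
    where
    bound : ∀ k → c < k → Before F r k m → F r c ≤ m
    bound (suc k) lt b = ≤-trans (row-mono i r (s≤s⁻¹ lt)) (b k refl)

nth-applyUpTo : ∀ {A : Set} (f : ℕ → A) n k → k < n → nth (applyUpTo f n) k ≡ just (f k)
nth-applyUpTo f (suc n) zero lt = refl
nth-applyUpTo f (suc n) (suc k) lt = nth-applyUpTo (λ j → f (suc j)) n k (s≤s⁻¹ lt)

rowsOf : ∀ n m → Rows → Tab ℕ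
rowsOf n m β = map (λ i → reverse (Aᵢ i (word n m β))) (rowsIdx n)

nth-rowsOf : ∀ n m β k → k < n → nth (rowsOf n m β) k ≡ just (ascending (β k) m)
nth-rowsOf n m β k lt
  rewrite nth-map (λ i → reverse (Aᵢ i (word n m β))) (rowsIdx n) k | nth-map suc (upTo n) k | nth-applyUpTo (λ j → j) n k lt
        | Aᵢ-word n m k β lt = cong just (reverse-letters (β k) m)

length-rowsOf : ∀ n m β → length (rowsOf n m β) ≡ n
length-rowsOf n m β = trans (length-map _ (rowsIdx n)) (trans (length-map suc (upTo n)) (length-upTo n))

at-rowsOf : ∀ n m β r c → r < n → at (rowsOf n m β) r c ≡ nth (ascending (β r) m) c
at-rowsOf n m β r c lt = at-nth (rowsOf n m β) r (nth-rowsOf n m β r lt) c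

at-rowsOf-out : ∀ n m β r c → n ≤ r → at (rowsOf n m β) r c ≡ nothing
at-rowsOf-out n m β r c le = at-nothing (rowsOf n m β) r (≥-nth (rowsOf n m β) r (subst (_≤ r) (sym (length-rowsOf n m β)) le)) c

dropEmpty-split : ∀ X → ∃ λ k → X ≡ replicate k [] ++ dropEmpty X
dropEmpty-split [] = 0 , refl
dropEmpty-split ([] ∷ X) with dropEmpty-split X
... | k , e = suc k , cong ([] ∷_) e
dropEmpty-split ((_ ∷ _) ∷ X) = 0 , refl

dropEmpty-head : ∀ X {l Y} → dropEmpty X ≡ l ∷ Y → 1 ≤ length l
dropEmpty-head ([] ∷ X) e = dropEmpty-head X e
dropEmpty-head ((_ ∷ _) ∷ X) refl = s≤s z≤n

at-snoc-empty : ∀ (X : Tab ℕ) r c → at (X ∷ʳ []) r c ≡ at X r c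
at-snoc-empty [] zero c = refl
at-snoc-empty [] (suc r) c = refl
at-snoc-empty (_ ∷ X) zero c = refl
at-snoc-empty (_ ∷ X) (suc r) c = at-snoc-empty X r c

at-++-empty : ∀ (X : Tab ℕ) k r c → at (X ++ reverse (replicate k [])) r c ≡ at X r c
at-++-empty X zero r c = cong (λ Y → at Y r c) (++-identityʳ X)
at-++-empty X (suc k) r c = begin
  at (X ++ reverse ([] ∷ replicate k [])) r c      ≡⟨ cong (λ Y → at (X ++ Y) r c) (unfold-reverse [] (replicate k [])) ⟩
  at (X ++ (reverse (replicate k []) ∷ʳ [])) r c   ≡⟨ cong (λ Y → at Y r c) (sym (++-assoc X (reverse (replicate k [])) _)) ⟩
  at ((X ++ reverse (replicate k [])) ∷ʳ []) r c   ≡⟨ at-snoc-empty (X ++ reverse (replicate k [])) r c ⟩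
  at (X ++ reverse (replicate k [])) r c           ≡⟨ at-++-empty X k r c ⟩
  at X r c ∎
  where open ≡-Reasoning

trim : Tab ℕ → Tab ℕ
trim X = reverse (dropEmpty (reverse X))

at-trim : ∀ X r c → at (trim X) r c ≡ at X r c
at-trim X r c with dropEmpty-split (reverse X)
... | k , e = trans (sym (at-++-empty (trim X) k r c)) (cong (λ Y → at Y r c) (sym whole))
  where
  whole : X ≡ trim X ++ reverse (replicate k [])
  whole = trans (sym (reverse-involutive X)) (trans (cong reverse e) (reverse-++ (replicate k []) (dropEmpty (reverse X))))

-- After trimming, the last row is nonempty, and the hypothesis carries the presence of a first
-- entry from there to every row above.
trim-rows : ∀ X → (∀ r {v} → at X (suc r) 0 ≡ just v → ∃ λ w → at X r 0 ≡ just w) → NonEmptyRows (trim X)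
trim-rows X h r line e with dropEmpty (reverse X) in eq
... | l ∷ Y = conclude (descend (length Y) (s≤s⁻¹ (subst (r <_) len (nth-< (reverse (l ∷ Y)) r e))) last)
  where
  same : ∀ q → at (reverse (l ∷ Y)) q 0 ≡ at X q 0
  same q = trans (cong (λ Z → at (reverse Z) q 0) (sym eq)) (at-trim X q 0)
  len : length (reverse (l ∷ Y)) ≡ suc (length Y)
  len = length-reverse (l ∷ Y)
  last : ∃ λ v → at X (length Y) 0 ≡ just v
  last with <-nth l 0 (dropEmpty-head (reverse X) eq)
  ... | v , e′ = v , trans (sym (same (length Y))) (trans (at-nth (reverse (l ∷ Y)) (length Y) here′ 0) e′)
    where
    here′ : nth (reverse (l ∷ Y)) (length Y) ≡ just l
    here′ = trans (cong (λ Z → nth Z (length Y)) (unfold-reverse l Y))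
      (subst (λ k → nth (reverse Y ∷ʳ l) k ≡ just l) (length-reverse Y) (nth-snoc (reverse Y) l))
  descend : ∀ q → r ≤ q → (∃ λ v → at X q 0 ≡ just v) → ∃ λ v → at X r 0 ≡ just v
  descend q le p with m≤n⇒m<n∨m≡n le
  ... | inj₂ refl = p
  descend (suc q) le (_ , p) | inj₁ lt = descend q (s≤s⁻¹ lt) (h q p)
  conclude : (∃ λ v → at X r 0 ≡ just v) → 1 ≤ length line
  conclude (v , p) = nth-< line 0 (trans (sym (at-nth (reverse (l ∷ Y)) r e 0)) (trans (same r) p))

at-tab : ∀ n m β r c → r < n → at (tab (word n m β)) r c ≡ nth (ascending (β r) m) c
at-tab n m β r c lt = trans (at-trim (rowsOf n m β) r c) (at-rowsOf n m β r c lt)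

at-tab-out : ∀ n m β r c → n ≤ r → at (tab (word n m β)) r c ≡ nothing
at-tab-out n m β r c le = trans (at-trim (rowsOf n m β) r c) (at-rowsOf-out n m β r c le)

-- Insertion of a whole biword.

module Final (n m : ℕ) where

  open Paths (suc m)
  open Concrete (suc m)
  open Recording (suc m)
  open Record (suc m)

  tab-Rep : ∀ {F} → Inc F → Positive F → (∀ q c → n ≤ q → suc m ≤ F q c) → Rep (tab (word n m (entries F))) F
  tab-Rep {F} i pos low = record { cells = cells ; rows = trim-rows (rowsOf n m (entries F)) support }
    where
    raw : ∀ r c → at (rowsOf n m (entries F)) r c ≡ cell F r c
    raw r c with r <? n
    ... | yes p = trans (at-rowsOf n m (entries F) r c p) (nth-ascending i pos m r c)
    ... | no p = trans (at-rowsOf-out n m (entries F) r c (≮⇒≥ p)) (sym (cell-out {F} (low r c (≮⇒≥ p))))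
    cells : ∀ r c → at (tab (word n m (entries F))) r c ≡ cell F r c
    cells r c = trans (at-trim (rowsOf n m (entries F)) r c) (raw r c)
    support : ∀ r {v} → at (rowsOf n m (entries F)) (suc r) 0 ≡ just v → ∃ λ w → at (rowsOf n m (entries F)) r 0 ≡ just w
    support r e = F r 0 , trans (raw r 0) (cell-in {F} (<-trans (col i r 0) (proj₁ (cell-just {F} (trans (sym (raw (suc r) 0)) e)))))

  tableau-highest : ∀ {F} → Inc F → Positive F → HighestWeight (word n m (entries F))
  tableau-highest {F} i pos (suc r) _ lt =
    Pair.matched⇒e≡nothing n r lt m (entries F) (Ballot.matched i pos n r lt 0 m (λ _ _ _ → refl , refl) refl)

  -- The letters still to be read once those > t of row k have been inserted.
  rest : Rows → ℕ → ℕ → Rows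
  rest β k t q u with <-cmp q k
  ... | tri< _ _ _ = false
  ... | tri≈ _ _ _ = if u ≤ᵇ t then β q u else false
  ... | tri> _ _ _ = β q u

  ≤ᵇ-false : ∀ {u t} → t < u → (u ≤ᵇ t) ≡ false
  ≤ᵇ-false lt = ¬T⇒≡false (λ h → <⇒≱ lt (≤ᵇ⇒≤ _ _ h))

  rest-above : ∀ β k t q u → q < k → rest β k t q u ≡ false
  rest-above β k t q u lt with <-cmp q k
  ... | tri< _ _ _ = refl
  ... | tri≈ n _ _ = ⊥-elim (n lt)
  ... | tri> n _ _ = ⊥-elim (n lt)

  rest-done : ∀ β k t u → t < u → rest β k t k u ≡ false
  rest-done β k t u lt with <-cmp k k
  ... | tri< _ _ _ = refl
  ... | tri≈ _ _ _ rewrite ≤ᵇ-false lt = refl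
  ... | tri> _ n _ = ⊥-elim (n refl)

  rest-todo : ∀ β k t u → u ≤ t → rest β k t k u ≡ β k u
  rest-todo β k t u le with <-cmp k k
  ... | tri< _ n _ = ⊥-elim (n refl)
  ... | tri≈ _ _ _ rewrite ≤ᵇ-true le = refl
  ... | tri> _ n _ = ⊥-elim (n refl)

  rest-later : ∀ β k t q u → k < q → rest β k t q u ≡ β q u
  rest-later β k t q u lt with <-cmp q k
  ... | tri< _ _ n = ⊥-elim (n lt)
  ... | tri≈ _ _ n = ⊥-elim (n lt)
  ... | tri> _ _ _ = refl

  rest-next : ∀ β k q u → 1 ≤ u → u ≤ m → rest β k 0 q u ≡ rest β (suc k) m q u
  rest-next β k q u p le with <-cmp q k
  ... | tri< lt _ _ = sym (rest-above β (suc k) m q u (m≤n⇒m≤1+n lt))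
  ... | tri≈ _ refl _ rewrite ≤ᵇ-false p = sym (rest-above β (suc q) m q u ≤-refl)
  ... | tri> _ _ lt with m≤n⇒m<n∨m≡n lt
  ...   | inj₁ lt′ = sym (rest-later β (suc k) m q u lt′)
  ...   | inj₂ refl = sym (rest-todo β (suc k) m u le)

  rest-step : ∀ β k t q u → (q ≡ k → u ≡ suc t → ⊥) → rest β k (suc t) q u ≡ rest β k t q u
  rest-step β k t q u ne with <-cmp q k in c
  ... | tri< _ _ _ = refl
  ... | tri> _ _ _ = refl
  ... | tri≈ _ refl _ with <-cmp u (suc t)
  ...   | tri< lt _ _ rewrite ≤ᵇ-true (<⇒≤ lt) | ≤ᵇ-true (s≤s⁻¹ lt) = refl
  ...   | tri≈ _ e _ = ⊥-elim (ne refl e)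
  ...   | tri> _ _ gt rewrite ≤ᵇ-false gt | ≤ᵇ-false (<-trans (n<1+n t) gt) = refl

  module Forward (β : Rows) where

    -- By `low` and `bottom` a letter of row `k` can enter column 0 in row `k`: there is nothing
    -- below, and the first entry of row `k` exceeds the remaining letters. So its path starts in
    -- the row where the letter lies in the crystal element.
    record State (k t : ℕ) : Set where
      field
        {F} : Filling
        {G} : SVFilling
        {b y} : ℕ
        {w} : List (ℕ × ℕ)
        run : Run w F G (suc k) b y
        t<y : t < y
        reads : w ++ map (_, suc k) (letters (β k) t) ≡ biletters m β (suc k)
        low : ∀ q c → k < q → suc m ≤ F q c
        bottom : t < F k 0
        linked : InComponent (word n m β) (word n m (F ∪ rest β k t))

    record Stage (k : ℕ) : Set where
      field
        {F} : Filling
        {G} : SVFilling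
        {b y} : ℕ
        run : Run (biletters m β k) F G k b y
        low : ∀ q c → k ≤ q → suc m ≤ F q c
        linked : InComponent (word n m β) (word n m (F ∪ rest β k m))

    relink : ∀ {γ δ} → InComponent (word n m β) (word n m γ) → (∀ q u → q < n → 1 ≤ u → u ≤ m → γ q u ≡ δ q u) →
             InComponent (word n m β) (word n m δ)
    relink h e = subst (InComponent _) (word-cong n m e) h

    entering : ∀ {k t} → suc t ≤ m → (σ : State k (suc t)) → NI (State.F σ) k 0 (suc t)
    entering le σ = record { inc = Valid.inc v ; std = Valid.std v ; x<M = s≤s le ; lt = State.bottom σ ; left = λ _ () }
      where v = Run-valid (State.run σ)

    step : ∀ k t → k < n → suc t ≤ m → State k (suc t) → State k t
    step k t k<n le σ with β k (suc t) in e
    ... | false = record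
      { State σ
      ; t<y = <-trans (n<1+n t) (State.t<y σ)
      ; reads = trans (cong (λ l → State.w σ ++ map (_, suc k) l) (sym (letters-false (β k) t e))) (State.reads σ)
      ; bottom = <-trans (n<1+n t) (State.bottom σ)
      ; linked = relink (State.linked σ) same
      }
      where
      same : ∀ q u → q < n → 1 ≤ u → u ≤ m → (State.F σ ∪ rest β k (suc t)) q u ≡ (State.F σ ∪ rest β k t) q u
      same q u _ _ _ = cong (entries (State.F σ) q u ∨_) (decide (q ≟ k) (u ≟ suc t))
        where
        decide : Dec (q ≡ k) → Dec (u ≡ suc t) → rest β k (suc t) q u ≡ rest β k t q u
        decide (yes refl) (yes refl) = trans (rest-todo β q (suc t) (suc t) ≤-refl) (trans e (sym (rest-done β q t (suc t) ≤-refl)))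
        decide (no ne) _ = rest-step β k t q u (λ a _ → ne a)
        decide (yes _) (no ne) = rest-step β k t q u (λ _ a → ne a)
    ... | true with Ins-total (entering le σ)
    ...   | F′ , end , path = record
      { run = Run-insert run (s≤s z≤n) (s≤s z≤n) t<y (k , entering le σ , path)
      ; t<y = ≤-refl
      ; reads = trans (∷ʳ-++ w _ _) (trans (cong (λ l → w ++ map (_, suc k) l) (sym (letters-true (β k) t e))) reads)
      ; low = λ q c lt → subst (suc m ≤_) (sym (N-local path q c (inj₂ lt))) (low q c lt)
      ; bottom = kept (N-low (entering le σ) path k 0)
      ; linked = Eq.transitive _ (relink linked start-state)
          (Connected.N-connected n m k (suc t) k<n (s≤s z≤n) (rest β k t) (λ q u lt → rest-above β k t q u lt)
            (λ u lt → rest-done β k t u lt) (Valid.pos (Run-valid run)) (entering le σ) ≤-refl ≤-refl path)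
      }
      where
      open State σ
      kept : suc t ≤ F′ k 0 ⊎ F′ k 0 ≡ F k 0 → t < F′ k 0
      kept (inj₁ h) = h
      kept (inj₂ h) = subst (t <_) (sym h) (<-trans (n<1+n t) bottom)
      start-state : ∀ q u → q < n → 1 ≤ u → u ≤ m → (F ∪ rest β k (suc t)) q u ≡ upd (F ∪ rest β k t) k (suc t) true q u
      start-state q u _ _ _ with updView (F ∪ rest β k t) k (suc t) true q u
      ... | hit refl refl h = trans (trans (cong (entries F q u ∨_) (trans (rest-todo β q u u ≤-refl) e)) (or-true (entries F q u))) (sym h)
        where
        or-true : ∀ a → (a ∨ true) ≡ true
        or-true true = refl
        or-true false = refl
      ... | miss ne h = trans (cong (entries F q u ∨_) (rest-step β k t q u ne)) (sym h)

    finish : ∀ k t → k < n → t ≤ m → State k t → State k 0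
    finish k zero lt le σ = σ
    finish k (suc t) lt le σ = finish k t lt (≤-trans (n≤1+n t) le) (step k t lt le σ)

    stage : ∀ k → k ≤ n → Stage k
    stage zero le = record
      { run = start (record { row = λ r c → +-monoʳ-< (suc m) (+-monoʳ-< r (n<1+n c)) ; col = λ r c → +-monoʳ-< (suc m) (n<1+n (r + c)) })
                    (λ _ _ _ → refl) (λ r c → s≤s z≤n) (λ r c → m≤m+n (suc m) (r + c)) (λ _ _ → refl)
      ; low = λ q c _ → m≤m+n (suc m) (q + c)
      ; linked = relink (Eq.reflexive _) same
      }
      where
      empty : Filling
      empty r c = suc m + (r + c)
      empty-Inc : Inc empty
      empty-Inc = record { row = λ r c → +-monoʳ-< (suc m) (+-monoʳ-< r (n<1+n c)) ; col = λ r c → +-monoʳ-< (suc m) (n<1+n (r + c)) }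
      same : ∀ q u → q < n → 1 ≤ u → u ≤ m → β q u ≡ (empty ∪ rest β 0 m) q u
      same q u _ _ le rewrite entries-gap empty-Inc (λ r c → s≤s z≤n) q 0 u (λ _ ()) (s≤s (≤-trans le (m≤m+n m _))) with q
      ... | zero = sym (rest-todo β 0 m u le)
      ... | suc q = sym (rest-later β 0 m (suc q) u (s≤s z≤n))
    stage (suc k) le with stage k (≤-trans (n≤1+n k) le)
    ... | σ with finish k m le ≤-refl (record
          { run = next (Stage.run σ) ; t<y = ≤-refl ; reads = refl
          ; low = λ q c lt → Stage.low σ q c (<⇒≤ lt) ; bottom = Stage.low σ k 0 ≤-refl ; linked = Stage.linked σ })
    ...   | τ = record
      { run = subst (λ w → Run w _ _ _ _ _) (trans (sym (++-identityʳ _)) (State.reads τ)) (State.run τ)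
      ; low = State.low τ
      ; linked = relink (State.linked τ) (λ q u _ p h → cong (entries (State.F τ) q u ∨_) (rest-next β k q u p h))
      }

    forward : ∃ λ F → ∃ λ G → ∃ λ b → ∃ λ y → Run (biletters m β n) F G n b y × (∀ q c → n ≤ q → suc m ≤ F q c) ×
              InComponent (word n m β) (word n m (entries F))
    forward = _ , _ , _ , _ , run , low , relink linked (λ q u lt _ _ →
        trans (cong (entries F q u ∨_) (rest-above β n m q u lt)) (∨-identityʳ _))
      where open Stage (stage n ≤-refl)

  -- Letters with equal `i` decrease strictly, so they list a set of values. The last component says
  -- that values below the latest letter are still free, which places a further letter at the end of
  -- the list.
  Run-rows : ∀ {w F G i b y} → Run w F G i b y →
             ∃ λ β → w ≡ biletters m β i × (∀ q u → i ≤ q → β q u ≡ false) × (∀ k u → i ≡ suc k → u < y → β k u ≡ false)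
  Run-rows (start _ _ _ _ _) = (λ _ _ → false) , refl , (λ _ _ _ → refl) , λ _ _ ()
  Run-rows (next {i = i} ρ) with Run-rows ρ
  ... | β , e , f , g = β ,
    trans e (sym (trans (cong (λ l → biletters m β i ++ map (_, suc i) l) (letters-none m (λ u _ → f i u ≤-refl))) (++-identityʳ _))) ,
    (λ q u le → f q u (<⇒≤ le)) , (λ { k u refl _ → f k u ≤-refl })
  Run-rows (snoc {w} {i = suc k} {x = suc x} ρ _ _ lt h _ _) with Run-rows ρ
  ... | β , e , f , g = β′ , word-eq , (λ q u le → trans (off q u (λ z → <-irrefl (sym z) le)) (f q u le)) ,
    λ { _ u refl l → trans (upd-miss β k (suc x) true k u (λ _ z → <-irrefl z l)) (g k u refl (<-trans l lt)) }
    where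
    β′ = upd β k (suc x) true
    off : ∀ q u → q ≢ k → β′ q u ≡ β q u
    off q u ne = upd-miss β k (suc x) true q u (λ z _ → ne z)
    word-eq : w ∷ʳ (suc x , suc k) ≡ biletters m β′ (suc k)
    word-eq = begin
      w ∷ʳ (suc x , suc k)
        ≡⟨ cong (_∷ʳ _) e ⟩
      (biletters m β k ++ map (_, suc k) (letters (β k) m)) ∷ʳ (suc x , suc k)
        ≡⟨ ++-assoc (biletters m β k) _ _ ⟩
      biletters m β k ++ (map (_, suc k) (letters (β k) m) ∷ʳ (suc x , suc k))
        ≡⟨ cong (biletters m β k ++_) (sym (map-++ (_, suc k) (letters (β k) m) (suc x ∷ []))) ⟩
      biletters m β k ++ map (_, suc k) (letters (β k) m ∷ʳ suc x)
        ≡⟨ cong₂ (λ l l′ → l ++ map (_, suc k) l′)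
             (biletters-cong k (λ q u l → sym (off q u (λ z → <-irrefl z l))))
             (sym (letters-snoc {β k} {β′ k} x m (s≤s⁻¹ (NI.x<M (proj₁ (proj₂ h)))) (upd-hit β k (suc x) true)
               (λ u ne → upd-miss β k (suc x) true k u (λ _ z → ne z)) (λ u l → g k u refl (≤-<-trans l lt)))) ⟩
      biletters m β′ (suc k) ∎
      where open ≡-Reasoning

-- The bijection on a component.

module Main (n m : ℕ) where

  open Paths (suc m)
  open Concrete (suc m)
  open Recording (suc m)
  open Record (suc m)
  open Final n m

  -- `Std` prescribes the values outside the diagram, so the tableau determines the filling on the
  -- whole quadrant.
  Rep-≈ : ∀ {t F F′} → Std F → Std F′ → Rep t F → Rep t F′ → F ≈ F′
  Rep-≈ {F = F} {F′} s s′ α α′ r c with F r c <? suc m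
  ... | yes lt = sym (proj₂ (at-just α′ (at-in α lt)))
  ... | no ge = trans (s r c (≮⇒≥ ge)) (sym (s′ r c (cell-nothing {F′} (trans (sym (Rep.cells α′ r c)) (at-out α (≮⇒≥ ge))))))

  record Image (S : SVW n m) : Set where
    field
      {P} : Tab ℕ
      {Q} : SVTab
      {F} : Filling
      {G} : SVFilling
      {b y} : ℕ
      run : Run (biletters m (toRows S) n) F G n b y
      rep : Rep P F
      repQ : RepQ Q G
      low : ∀ q c → n ≤ q → suc m ≤ F q c
      linked : InComponent S (word n m (entries F))
      hecke≡ : hecke S ≡ (P , Q)

    valid = Run-valid run

  hecke-biletters : (S : SVW n m) → hecke S ≡ foldl heckeStep ([] , []) (biletters m (toRows S) n)
  hecke-biletters S = cong (foldl heckeStep ([] , [])) (trans (cong (biword {n} {m}) (sym (word-toRows S))) (biword-word n m (toRows S)))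

  image : ∀ S → Image S
  image S with Forward.forward (toRows S)
  ... | F , G , b , y , run , low , linked with Run-hecke run
  ...   | P , Q , e , α , κ = record
    { run = run ; rep = α ; repQ = κ ; low = low
    ; linked = subst (λ S → InComponent {n} {m} S (word n m (entries F))) (word-toRows S) linked
    ; hecke≡ = trans (hecke-biletters S) e }

  good : ∀ S₀ S → InComponent S₀ S → GoodPair S₀ (hecke S)
  good S₀ S comp = subst (GoodPair S₀) (sym hecke≡)
    ( same-shape valid rep repQ
    , (Inc⇒increasing rep (Valid.inc valid)
      , word n m (entries F) , Eq.transitive _ comp linked , tableau-highest (Valid.inc valid) (Valid.pos valid)
      , Rep-unique rep (tab-Rep (Valid.inc valid) (Valid.pos valid) low))
    , semistandard valid rep repQ , entries-in valid rep repQ )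
    where open Image (image S)

  injective : (S S′ : SVW n m) → hecke S ≡ hecke S′ → S ≡ S′
  injective S S′ e with image S | image S′
  ... | ι | ι′ with ,-injective (trans (sym (Image.hecke≡ ι)) (trans e (Image.hecke≡ ι′)))
  ...   | refl , refl = trans (sym (word-toRows S)) (trans
    (biletters-injective m n (Run-unique (Image.run ι) (Image.run ι′)
      (Rep-≈ (Valid.std (Image.valid ι)) (Valid.std (Image.valid ι′)) (Image.rep ι) (Image.rep ι′))
      (RepQ-≈ (Image.repQ ι) (Image.repQ ι′)))) (word-toRows S′))

  module Surjective (S′ : SVW n m) (inc-tab : IsIncreasing (tab S′)) where

    β = toRows S′

    P : Tab ℕ
    P = tab S′

    F : Filling
    F r c = Maybe.fromMaybe (suc m + (r + c)) (at P r c)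

    at-P : ∀ r c → r < n → at P r c ≡ nth (ascending (β r) m) c
    at-P r c lt = trans (cong (λ S → at (tab S) r c) (sym (word-toRows S′))) (at-tab n m β r c lt)

    at-P-out : ∀ r c → n ≤ r → at P r c ≡ nothing
    at-P-out r c le = trans (cong (λ S → at (tab S) r c) (sym (word-toRows S′))) (at-tab-out n m β r c le)

    bounds : ∀ r c {v} → at P r c ≡ just v → r < n × β r v ≡ true × 1 ≤ v × v ≤ m
    bounds r c e with r <? n
    ... | yes lt = lt , ascending-∈⁻ (β r) m (nth-∈ _ c (trans (sym (at-P r c lt)) e))
    ... | no ge with trans (sym (at-P-out r c (≮⇒≥ ge))) e
    ...   | ()

    rep : Rep P F
    rep .Rep.rows = proj₁ (isIncB⁻ P inc-tab)
    rep .Rep.cells r c with at P r c in e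
    ... | just v rewrite <ᵇ-true (s≤s (proj₂ (proj₂ (proj₂ (bounds r c e))))) = refl
    ... | nothing rewrite <ᵇ-false (m≤m+n (suc m) (r + c)) = refl

    std : Std F
    std r c le with at P r c in e
    ... | nothing = refl
    ... | just v = ⊥-elim (1+n≰n (≤-trans le (proj₂ (proj₂ (proj₂ (bounds r c e))))))

    pos : Positive F
    pos r c with at P r c in e
    ... | nothing = s≤s z≤n
    ... | just v = proj₁ (proj₂ (proj₂ (bounds r c e)))

    inc : Inc F
    inc .row r c with at P r c in e | at P r (suc c) in e′
    ... | just v | just w = proj₁ (proj₂ (proj₂ (isIncB⁻ P inc-tab))) r c e e′
    ... | just v | nothing = <-≤-trans (s≤s (proj₂ (proj₂ (proj₂ (bounds r c e))))) (m≤m+n (suc m) _)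
    ... | nothing | nothing = +-monoʳ-< (suc m) (+-monoʳ-< r (n<1+n c))
    ... | nothing | just w with trans (sym e) (proj₂ (at-row-left P r c e′))
    ...   | ()
    inc .col r c with at P r c in e | at P (suc r) c in e′
    ... | just v | just w = proj₂ (proj₂ (proj₂ (isIncB⁻ P inc-tab))) r c e e′
    ... | just v | nothing = <-≤-trans (s≤s (proj₂ (proj₂ (proj₂ (bounds r c e))))) (m≤m+n (suc m) _)
    ... | nothing | nothing = +-monoʳ-< (suc m) (n<1+n (r + c))
    ... | nothing | just w with trans (sym e) (proj₂ (proj₁ (proj₂ (isIncB⁻ P inc-tab)) r c e′))
    ...   | ()

    -- `tab` keeps all values of every row, so reading the filling back as a crystal element returns
    -- the element given with `P`.
    recover : word n m (entries F) ≡ S′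
    recover = trans (word-cong n m same) (word-toRows S′)
      where
      same : ∀ q t → q < n → 1 ≤ t → t ≤ m → entries F q t ≡ β q t
      same q (suc t) lt _ le = Bool-ext fwd bwd
        where
        fwd : entries F q (suc t) ≡ true → β q (suc t) ≡ true
        fwd h with entries⁻ inc pos q (suc t) h
        ... | c , e = proj₁ (proj₂ (bounds q c (trans (at-in rep (subst (_< suc m) (sym e) (s≤s le))) (cong just e))))
        bwd : β q (suc t) ≡ true → entries F q (suc t) ≡ true
        bwd h with ∈-nth (ascending-∈⁺ (β q) m t h le)
        ... | c , e = subst (λ v → entries F q v ≡ true) (proj₂ (at-just rep (trans (at-P q c lt) e))) (entries⁺ inc pos q c)

    preimage : ∀ {Q} → shape P ≡ shape Q → IsSemistandardSetValued Q → EntriesIn n Q →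
               Σ (SVW n m) λ S → InComponent S S′ × hecke S ≡ (P , Q)
    preimage {Q} sh ss en with build n (suc m) (boxes-Valid inc std pos rep sh ss en)
    ... | w , b , y , _ , run with Run-rows run | Run-hecke run
    ...   | γ , refl , _ | P₁ , Q₁ , e , α , κ = S , linked′ , h
      where
      S = word n m γ
      h : hecke S ≡ (P , Q)
      h = trans (cong (foldl heckeStep ([] , [])) (biword-word n m γ))
        (trans e (cong₂ _,_ (Rep-unique α rep) (RepQ-unique κ (boxes-RepQ inc std pos rep sh ss en))))
      linked′ : InComponent S S′
      -- The filling reached by inserting `S` and the one read from `P` represent the same tableau,
      -- so `Image.linked` already leads to `S′`.
      linked′ with image S
      ... | ι with ,-injective (trans (sym (Image.hecke≡ ι)) h)
      ...   | refl , _ = subst (InComponent S)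
        (trans (word-cong n m (λ q t _ _ _ → entries-cong (Rep-≈ (Valid.std (Image.valid ι)) std (Image.rep ι) rep) q t)) recover)
        (Image.linked ι)

theorem3p14 : (n m : ℕ) (S₀ : SVW n m) →
    ((S : SVW n m) → InComponent S₀ S → GoodPair S₀ (hecke S)) ×
    ((S S′ : SVW n m) → InComponent S₀ S → InComponent S₀ S′ → hecke S ≡ hecke S′ → S ≡ S′) ×
    ((P : Tab ℕ) (Q : SVTab) → GoodPair S₀ (P , Q) → Σ (SVW n m) λ S → InComponent S₀ S × (hecke S ≡ (P , Q)))
theorem3p14 n m S₀ = good S₀ , (λ S S′ _ _ → injective S S′) , surjective
  where
  open Main n m
  surjective : (P : Tab ℕ) (Q : SVTab) → GoodPair S₀ (P , Q) → Σ (SVW n m) λ S → InComponent S₀ S × (hecke S ≡ (P , Q))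
  surjective _ Q (sh , (inc , S′ , comp , _ , refl) , ss , en) with Surjective.preimage S′ inc sh ss en
  ... | S , linked , e = S , Eq.transitive _ comp (Eq.symmetric _ linked) , e
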